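{- Let $E$ be an elliptic curve over $\overline{\mathbb{Q}}$ with a given Weierstrass equation. The set of $x$-coordinates of the torsion points of $E(\overline{\mathbb{Q}})$ does not contain arbitrarily long non-trivial arithmetic progressions, and the same holds for the set of $y$-coordinates of the torsion points. Moreover, a bound for the length of such progressions can be effectively computed from the $j$-invariant of $E$.
   Context: A non-trivial arithmetic progression in a field is a sequence $u_1,\dots,u_n$ with $u_j=a+jb$ for some $a,b$ in the field, $b\neq 0$. Torsion points are taken with finite coordinates (i.e. excluding the point at infinity). -}

module Defs where

open import Level using (Level; _⊔_) renaming (suc to lsuc)
open import Algebra.Bundles using (CommutativeRing)
open import Data.Nat as ℕ using (ℕ; zero; suc)
open import Data.Integer as ℤ using (ℤ; +_; -[1+_])
open import Data.List using (List; []; _∷_; _++_; map)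
open import Data.List.Relation.Unary.Any using (Any)
open import Data.Maybe using (Maybe; just; nothing)
open import Data.Product using (_×_; _,_; ∃; Σ-syntax)
open import Relation.Nullary using (¬_)
open import Relation.Binary using (Decidable)
open import Relation.Binary.PropositionalEquality using (_≡_)
open import Data.Unit using (⊤)
open import Level using (Lift)
open import Data.Fin using (Fin; toℕ)

module FieldOps {c ℓ} (R : CommutativeRing c ℓ) where
  open CommutativeRing R

  fromℕ : ℕ → Carrier
  fromℕ zero    = 0#
  fromℕ (suc n) = 1# + fromℕ n

  fromℤ : ℤ → Carrier
  fromℤ (+ n)     = fromℕ n
  fromℤ -[1+ n ]  = - fromℕ (suc n)

  eval : List Carrier → Carrier → Carrier
  eval []       x = 0#
  eval (a ∷ as) x = a + x * eval as x


record AlgClosureℚ (c ℓ : Level) : Set (lsuc (c ⊔ ℓ)) where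
  field
    commRing : CommutativeRing c ℓ
  open CommutativeRing commRing public
  open FieldOps commRing public
  field
    _≟_        : Decidable _≈_
    1≉0        : 1# ≉ 0#
    inverse    : ∀ x → x ≉ 0# → ∃ λ y → x * y ≈ 1#
    char0      : ∀ n → fromℕ (suc n) ≉ 0#
    algebraic  : ∀ x → ∃ λ (p : List ℤ) →
                   Any (λ a → ¬ (a ≡ + 0)) p × (eval (map fromℤ p) x ≈ 0#)
    algClosed  : ∀ (a : Carrier) (as : List Carrier) →
                   ∃ λ x → eval ((a ∷ as) ++ (1# ∷ [])) x ≈ 0#

module Elliptic {c ℓ} (K : AlgClosureℚ c ℓ) where
  open AlgClosureℚ K

  infixr 8 _²
  _² : Carrier → Carrier
  x ² = x * x

  _³ : Carrier → Carrier
  x ³ = x * x * x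

  -- a Weierstrass equation (coefficients only; nonsingularity Δ ≉ 0 is
  -- imposed separately, see IsEllipticCurve)
  record Weierstrass : Set c where
    field
      a₁ a₂ a₃ a₄ a₆ : Carrier

  module Curve (E : Weierstrass) where
    open Weierstrass E

    b₂ b₄ b₆ b₈ c₄ Δ : Carrier
    b₂ = a₁ ² + fromℕ 4 * a₂
    b₄ = fromℕ 2 * a₄ + a₁ * a₃
    b₆ = a₃ ² + fromℕ 4 * a₆
    b₈ = a₁ ² * a₆ + fromℕ 4 * a₂ * a₆ - a₁ * a₃ * a₄ + a₂ * a₃ ² - a₄ ²
    c₄ = b₂ ² - fromℕ 24 * b₄
    Δ  = - (b₂ ² * b₈) - fromℕ 8 * b₄ ³ - fromℕ 27 * b₆ ² + fromℕ 9 * b₂ * b₄ * b₆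

    IsEllipticCurve : Set ℓ
    IsEllipticCurve = Δ ≉ 0#

    IsJInvariant : Carrier → Set ℓ
    IsJInvariant j = j * Δ ≈ c₄ ³

    OnCurve : Carrier → Carrier → Set ℓ
    OnCurve x y = y ² + a₁ * x * y + a₃ * y ≈ x ³ + a₂ * x ² + a₄ * x + a₆

    -- points of E: nothing = point at infinity O, just (x , y) affine
    Point : Set c
    Point = Maybe (Carrier × Carrier)

    OnE : Point → Set ℓ
    OnE nothing        = Lift ℓ ⊤
    OnE (just (x , y)) = OnCurve x y

    -- third intersection with the line of slope λ through (x₁,y₁), then
    -- reflected: the standard chord-tangent formulas
    sumX : Carrier → Carrier → Carrier → Carrier
    sumX s x₁ x₂ = s ² + a₁ * s - a₂ - x₁ - x₂

    sumY : Carrier → Carrier → Carrier → Carrier → Carrier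
    sumY s x₁ y₁ x₃ = - ((s + a₁) * x₃) - (y₁ - s * x₁) - a₃

    data Add : Point → Point → Point → Set (c ⊔ ℓ) where
      O+  : ∀ Q → Add nothing Q Q
      +O  : ∀ P → Add P nothing P
      neg : ∀ {x₁ y₁ x₂ y₂} → x₁ ≈ x₂ → y₁ + y₂ + a₁ * x₂ + a₃ ≈ 0# →
            Add (just (x₁ , y₁)) (just (x₂ , y₂)) nothing
      chord : ∀ {x₁ y₁ x₂ y₂} s → x₁ ≉ x₂ → s * (x₂ - x₁) ≈ y₂ - y₁ →
            Add (just (x₁ , y₁)) (just (x₂ , y₂))
                (just (sumX s x₁ x₂ , sumY s x₁ y₁ (sumX s x₁ x₂)))
      tangent : ∀ {x₁ y₁ x₂ y₂} s → x₁ ≈ x₂ → y₁ ≈ y₂ →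
            fromℕ 2 * y₁ + a₁ * x₁ + a₃ ≉ 0# →
            s * (fromℕ 2 * y₁ + a₁ * x₁ + a₃) ≈
              fromℕ 3 * x₁ ² + fromℕ 2 * a₂ * x₁ + a₄ - a₁ * y₁ →
            Add (just (x₁ , y₁)) (just (x₂ , y₂))
                (just (sumX s x₁ x₂ , sumY s x₁ y₁ (sumX s x₁ x₂)))

    data Mul : ℕ → Point → Point → Set (c ⊔ ℓ) where
      mul0 : ∀ {P} → Mul ℕ.zero P nothing
      mulS : ∀ {n P R S} → Mul n P R → Add R P S → Mul (ℕ.suc n) P S

    IsTorsion : Point → Set (c ⊔ ℓ)
    IsTorsion P = OnE P × ∃ λ n → Mul (ℕ.suc n) P nothing

    TorsionX : Carrier → Set (c ⊔ ℓ)
    TorsionX x = ∃ λ y → IsTorsion (just (x , y))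

    TorsionY : Carrier → Set (c ⊔ ℓ)
    TorsionY y = ∃ λ x → IsTorsion (just (x , y))

  ContainsAP : ∀ {p} → (Carrier → Set p) → ℕ → Set (c ⊔ ℓ ⊔ p)
  ContainsAP S n = ∃ λ a → ∃ λ b → b ≉ 0# ×
                     (∀ (i : Fin n) → S (a + fromℕ (ℕ.suc (toℕ i)) * b))

{-# OPTIONS --safe #-}
-- Over the algebraic closure, E has a model y² = x³ + A x + B with discriminant 1, on which the x- and
-- y-coordinates of E become affine functions α x + β y + const. If l is the leading coefficient of an
-- integral polynomial with root j, then at every place above q = 6|l| + 1 the coefficients A and B are
-- integral, so the model has good reduction. A torsion point reducing to O modulo q is O, because a
-- multiple of it of prime order p would make p divisible by q². Hence distinct torsion points are never
-- congruent modulo q. Terms of the progression whose indices agree modulo q⁶ give torsion points lying,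
-- modulo q⁶, on one line. Of seven such points, four reduce to affine points or four reduce to O; as the
-- line meets the cubic only three times, two of these four would be congruent modulo q.
--
-- No place is constructed outright. A place is approximated by a subring O with an ideal M not containing
-- 1, which is enlarged whenever an element has to be compared with 1; as the conclusion is a decidable
-- inequality and only finitely many elements matter, the enlargement may take place under a double negation.
module Submission where

open import Defs
open import Level using (_⊔_; Lift; lift) renaming (suc to lsuc)
open import Algebra.Bundles using (AbelianGroup; CommutativeRing)
open import Algebra.Solver.Ring.AlmostCommutativeRing
  using (fromCommutativeRing; _-Raw-AlmostCommutative⟶_; Induced-equivalence)
open import Data.Bool using (Bool; true; T)
open import Data.Empty using (⊥; ⊥-elim)
open import Data.Fin using (Fin; toℕ; fromℕ<)
import Data.Fin.Properties as Finₚ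
open import Data.Integer as ℤ using (ℤ; +_; -[1+_])
import Data.Integer.Properties as ℤₚ
open import Data.List as List using (List; []; _∷_; _++_; length; map)
open import Data.List.Relation.Unary.All as All using (All; []; _∷_)
import Data.List.Relation.Unary.All.Properties as Allₚ
open import Data.List.Relation.Unary.AllPairs as AllPairs using (AllPairs; []; _∷_)
import Data.List.Relation.Unary.AllPairs.Properties as AllPairsₚ
open import Data.List.Relation.Unary.Any using (Any; here; there)
open import Data.Maybe using (Maybe; just; nothing; is-just)
open import Data.Nat as ℕ using (ℕ; zero; suc; _≤_)
import Data.Nat.Divisibility as ℕ∣
import Data.Nat.Properties as ℕₚ
open import Data.Nat.Coprimality using (Coprime; coprime-Bézout)
open import Data.Nat.GCD using (module Bézout)
open import Data.Nat.Primality using (Prime; prime⇒nonZero; prime⇒irreducible)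
open import Data.Nat.ListAction using (product)
open import Data.Nat.Primality.Factorisation using (factorise; module PrimeFactorisation)
open import Data.Product using (_×_; _,_; proj₁; proj₂; ∃; Σ)
import Data.Sign as Sign
open import Data.Sum using (_⊎_; inj₁; inj₂; [_,_]′)
open import Data.Unit.Polymorphic using (⊤; tt)
open import Data.Vec using ([]; _∷_; tabulate)
open import Data.Vec.N-ary using (N-ary; _$ⁿ_; ∀ⁿ; curryⁿ)
open import Function using (_∘_)
open import Relation.Binary.Definitions using (WeaklyDecidable)
import Relation.Binary.PropositionalEquality as ≡
open ≡ using (_≡_)
open import Relation.Nullary using (¬_; yes; no; Dec)
open import Relation.Nullary.Decidable using (decidable-stable)

-- The exponent 6 is the number of pairs among four points. Restricted to a line α x + β y = γ, the
-- equation of the cubic becomes a polynomial in one coordinate, whose values at points lying on the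
-- line modulo q⁶ are multiples of q⁶. When one of its divided differences is a principal unit (an
-- element of 1 + M), the product of the differences of the coordinates is a multiple of q⁶; but
-- points that are incongruent modulo q make each difference a proper divisor of q. Which coordinate
-- serves, and how many points, depends on which of α, β, γ is a unit; dividing by the largest of
-- them ensures that one is. A multiple of prime order p forces q² to divide p because
-- multiplication by p is p t + O(t³) in t = x/y, without a quadratic term. The square matters: q
-- may itself be the prime p. Dividing out a twelfth root of the discriminant Δ turns c₄³ = j Δ into
-- A³ = -j/48³, and discriminant 1 then determines B². The coefficients thus become integral
-- wherever j and 1/6 are, which is why j alone controls the bound.

module LinearCombinations {c ℓ} (R : CommutativeRing c ℓ) where
  open CommutativeRing R
  open FieldOps R
  open import Algebra.Properties.Ring ring
  open import Algebra.Properties.AbelianGroup +-abelianGroup using (⁻¹-∙-comm)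
  import Relation.Binary.Reasoning.Setoid setoid as ≈R

  -- Integer coefficients in a commutative ring, and identities that follow from hypotheses.

  fromℕ-+ : ∀ m n → fromℕ (m ℕ.+ n) ≈ fromℕ m + fromℕ n
  fromℕ-+ zero    n = sym (+-identityˡ _)
  fromℕ-+ (suc m) n = trans (+-congˡ (fromℕ-+ m n)) (sym (+-assoc _ _ _))

  fromℕ-* : ∀ m n → fromℕ (m ℕ.* n) ≈ fromℕ m * fromℕ n
  fromℕ-* zero    n = sym (zeroˡ _)
  fromℕ-* (suc m) n = begin
    fromℕ (n ℕ.+ m ℕ.* n)             ≈⟨ fromℕ-+ n (m ℕ.* n) ⟩
    fromℕ n + fromℕ (m ℕ.* n)         ≈⟨ +-cong (sym (*-identityˡ _)) (fromℕ-* m n) ⟩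
    1# * fromℕ n + fromℕ m * fromℕ n  ≈⟨ distribʳ _ _ _ ⟨
    (1# + fromℕ m) * fromℕ n          ∎
    where open ≈R

  fromℤ-⊖ : ∀ m n → fromℤ (m ℤ.⊖ n) ≈ fromℕ m - fromℕ n
  fromℤ-⊖ m       zero    = sym (trans (+-congˡ -0#≈0#) (+-identityʳ _))
  fromℤ-⊖ zero    (suc n) = sym (+-identityˡ _)
  fromℤ-⊖ (suc m) (suc n) = begin
    fromℤ (suc m ℤ.⊖ suc n)              ≡⟨ ≡.cong fromℤ (ℤₚ.[1+m]⊖[1+n]≡m⊖n m n) ⟩
    fromℤ (m ℤ.⊖ n)                      ≈⟨ fromℤ-⊖ m n ⟩
    fromℕ m - fromℕ n                    ≈⟨ +-congʳ (+-identityˡ _) ⟨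
    0# + fromℕ m - fromℕ n               ≈⟨ +-congʳ (+-congʳ (-‿inverseʳ 1#)) ⟨
    1# - 1# + fromℕ m - fromℕ n          ≈⟨ +-congʳ (trans (+-assoc _ _ _) (+-congˡ (+-comm _ _))) ⟩
    1# + (fromℕ m - 1#) - fromℕ n        ≈⟨ +-congʳ (sym (+-assoc _ _ _)) ⟩
    1# + fromℕ m - 1# - fromℕ n          ≈⟨ +-assoc _ _ _ ⟩
    1# + fromℕ m + (- 1# - fromℕ n)      ≈⟨ +-congˡ (⁻¹-∙-comm _ _) ⟩
    1# + fromℕ m - (1# + fromℕ n)        ∎
    where open ≈R

  fromℤ-+ : ∀ i j → fromℤ (i ℤ.+ j) ≈ fromℤ i + fromℤ j
  fromℤ-+ (+ m)    (+ n)    = fromℕ-+ m n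
  fromℤ-+ (+ m)    -[1+ n ] = fromℤ-⊖ m (suc n)
  fromℤ-+ -[1+ m ] (+ n)    = trans (fromℤ-⊖ n (suc m)) (+-comm _ _)
  fromℤ-+ -[1+ m ] -[1+ n ] = begin
    - (1# + (1# + fromℕ (m ℕ.+ n)))        ≈⟨ -‿cong (+-congˡ (+-congˡ (fromℕ-+ m n))) ⟩
    - (1# + (1# + (fromℕ m + fromℕ n)))    ≈⟨ -‿cong (+-congˡ (trans (sym (+-assoc _ _ _)) (trans (+-congʳ
        (+-comm _ _)) (+-assoc _ _ _)))) ⟩
    - (1# + (fromℕ m + (1# + fromℕ n)))    ≈⟨ -‿cong (sym (+-assoc _ _ _)) ⟩
    - (1# + fromℕ m + (1# + fromℕ n))      ≈⟨ ⁻¹-∙-comm _ _ ⟨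
    - (1# + fromℕ m) + - (1# + fromℕ n)    ∎
    where open ≈R

  fromℤ-neg : ∀ i → fromℤ (ℤ.- i) ≈ - fromℤ i
  fromℤ-neg (+ zero)  = sym -0#≈0#
  fromℤ-neg (+ suc n) = refl
  fromℤ-neg -[1+ n ]  = sym (-‿involutive _)

  fromℤ-+◃ : ∀ n → fromℤ (Sign.+ ℤ.◃ n) ≈ fromℕ n
  fromℤ-+◃ zero    = refl
  fromℤ-+◃ (suc n) = refl

  fromℤ--◃ : ∀ n → fromℤ (Sign.- ℤ.◃ n) ≈ - fromℕ n
  fromℤ--◃ zero    = sym -0#≈0#
  fromℤ--◃ (suc n) = refl

  fromℤ-* : ∀ i j → fromℤ (i ℤ.* j) ≈ fromℤ i * fromℤ j
  fromℤ-* (+ m)    (+ n)    = trans (fromℤ-+◃ (m ℕ.* n)) (fromℕ-* m n)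
  fromℤ-* (+ m)    -[1+ n ] = trans (fromℤ--◃ (m ℕ.* suc n)) (trans (-‿cong (fromℕ-* m (suc n))) (-‿distribʳ-* _ _))
  fromℤ-* -[1+ m ] (+ n)    = trans (fromℤ--◃ (suc m ℕ.* n)) (trans (-‿cong (fromℕ-* (suc m) n)) (-‿distribˡ-* _ _))
  fromℤ-* -[1+ m ] -[1+ n ] = begin
    fromℕ (suc m ℕ.* suc n)              ≈⟨ fromℕ-* (suc m) (suc n) ⟩
    fromℕ (suc m) * fromℕ (suc n)        ≈⟨ -‿involutive _ ⟨
    - - (fromℕ (suc m) * fromℕ (suc n))  ≈⟨ -‿cong (-‿distribˡ-* _ _) ⟩
    - (- fromℕ (suc m) * fromℕ (suc n))  ≈⟨ -‿distribʳ-* _ _ ⟩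
    - fromℕ (suc m) * - fromℕ (suc n)    ∎
    where open ≈R

  -- With integers as coefficients the normal forms can be compared by computation, although the
  -- ring itself is abstract.
  fromℤ-homomorphism : ℤ.+-*-rawRing -Raw-AlmostCommutative⟶ fromCommutativeRing R
  fromℤ-homomorphism = record
    { ⟦_⟧    = fromℤ
    ; +-homo = fromℤ-+
    ; *-homo = fromℤ-*
    ; -‿homo = fromℤ-neg
    ; 0-homo = refl
    ; 1-homo = +-identityʳ 1#
    }

  coefficient≟ : WeaklyDecidable (Induced-equivalence fromℤ-homomorphism)
  coefficient≟ i j with i ℤₚ.≟ j
  ... | yes i≡j = just (reflexive (≡.cong fromℤ i≡j))
  ... | no  _   = nothing

  open import Algebra.Solver.Ring ℤ.+-*-rawRing (fromCommutativeRing R)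
    fromℤ-homomorphism coefficient≟ public
    using (Polynomial; con; var; _:+_; _:*_; _:-_; :-_; _:^_; ⟦_⟧; ⟦_⟧N-cong; normalise; _≟N_; correct; Env)

  infix 10 #_
  #_ : ∀ {n} → ℕ → Polynomial n
  # k = con (+ k)

  -- Unlike # 1, it evaluates to 1# on the nose.
  one : ∀ {n} → Polynomial n
  one = # 1 :^ 0

  infix 4 _:=_
  data Equation (n : ℕ) : Set where
    _:=_ : Polynomial n → Polynomial n → Equation n

  infixr 3 _∙_⇒_ ⊢_
  -- A certificate of ideal membership: each hypothesis carries the polynomial by which its
  -- difference is multiplied, so that verification is a single polynomial identity and involves no
  -- search.
  data Entailment (n : ℕ) : Set where
    ⊢_    : Equation n → Entailment n
    _∙_⇒_ : Polynomial n → Equation n → Entailment n → Entailment n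

  difference : ∀ {n} → Equation n → Polynomial n
  difference (a := b) = a :- b

  goal : ∀ {n} → Entailment n → Equation n
  goal (⊢ e)       = e
  goal (_ ∙ _ ⇒ s) = goal s

  combination : ∀ {n} → Entailment n → Polynomial n
  combination (⊢ e)       = # 0
  combination (k ∙ h ⇒ s) = k :* difference h :+ combination s

  ⟦_⟧ᵉ : ∀ {n} → Equation n → Env n → Set ℓ
  ⟦ a := b ⟧ᵉ ρ = ⟦ a ⟧ ρ ≈ ⟦ b ⟧ ρ

  ⟦_⟧ˢ : ∀ {n} → Entailment n → Env n → Set ℓ
  ⟦ ⊢ e ⟧ˢ       ρ = ⟦ e ⟧ᵉ ρ
  ⟦ _ ∙ h ⇒ s ⟧ˢ ρ = ⟦ h ⟧ᵉ ρ → ⟦ s ⟧ˢ ρ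

  x-y≈0⇒x≈y : ∀ {x y} → x - y ≈ 0# → x ≈ y
  x-y≈0⇒x≈y {x} {y} p = x∙y⁻¹≈ε⇒x≈y x y p

  x≈y⇒x-y≈0 : ∀ {x y} → x ≈ y → x - y ≈ 0#
  x≈y⇒x-y≈0 {x} {y} p = trans (+-congʳ p) (-‿inverseʳ y)

  private
    entails′ : ∀ {n} (s : Entailment n) ρ → ⟦ difference (goal s) ⟧ ρ ≈ ⟦ combination s ⟧ ρ → ⟦ s ⟧ˢ ρ
    entails′ (⊢ a := b)         ρ p = x-y≈0⇒x≈y p
    entails′ (k ∙ (a := b) ⇒ s) ρ p h = entails′ s ρ (begin
      ⟦ difference (goal s) ⟧ ρ                              ≈⟨ p ⟩
      ⟦ k ⟧ ρ * (⟦ a ⟧ ρ - ⟦ b ⟧ ρ) + ⟦ combination s ⟧ ρ    ≈⟨ +-congʳ (*-congˡ (x≈y⇒x-y≈0 h)) ⟩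
      ⟦ k ⟧ ρ * 0# + ⟦ combination s ⟧ ρ                     ≈⟨ +-congʳ (zeroʳ _) ⟩
      0# + ⟦ combination s ⟧ ρ                               ≈⟨ +-identityˡ _ ⟩
      ⟦ combination s ⟧ ρ                                    ∎)
      where open ≈R

  checks : ∀ {n} → Entailment n → Bool
  checks s = is-just (normalise (difference (goal s)) ≟N normalise (combination s))

  checks-sound : ∀ {n} (s : Entailment n) ρ → checks s ≡ true → ⟦ s ⟧ˢ ρ
  checks-sound s ρ eq with normalise (difference (goal s)) ≟N normalise (combination s)
  checks-sound s ρ eq | just p =
    entails′ s ρ (trans (sym (correct (difference (goal s)) ρ))
                 (trans (⟦ p ⟧N-cong ρ) (correct (combination s) ρ)))
  checks-sound s ρ () | nothing

  ∀ⁿ-curry : ∀ n {P : Env n → Set ℓ} → (∀ ρ → P ρ) → ∀ⁿ n (curryⁿ {n = n} P)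
  ∀ⁿ-curry zero    p = p []
  ∀ⁿ-curry (suc n) p = λ x → ∀ⁿ-curry n λ ρ → p (x ∷ ρ)

  -- A linear combination of the hypotheses, with the polynomial multipliers listed in front of them,
  -- is compared with the conclusion as a normal form over ℤ.
  lincomb : ∀ n (f : N-ary n (Polynomial n) (Entailment n)) {_ : T (checks (f $ⁿ tabulate var))} →
            ∀ⁿ n (curryⁿ {n = n} ⟦ f $ⁿ tabulate var ⟧ˢ)
  lincomb n f {t} = ∀ⁿ-curry n λ ρ → checks-sound (f $ⁿ tabulate var) ρ (T⇒≡ t)
    where
    T⇒≡ : ∀ {b} → T b → b ≡ true
    T⇒≡ {true} _ = ≡.refl

-- Consequences of the field axioms and of characteristic zero.

module FieldProperties {c ℓ} (K : AlgClosureℚ c ℓ) where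
  open AlgClosureℚ K
  open LinearCombinations commRing

  cancelˡ : ∀ {z x y} → z ≉ 0# → z * x ≈ z * y → x ≈ y
  cancelˡ {z} {x} {y} z≉0 zx≈zy with w , zw≈1 ← inverse z z≉0 =
    (lincomb 4 (λ x y z w → (:- x :+ y) ∙ z :* w := one ⇒ w ∙ z :* x := z :* y ⇒ ⊢ x := y) x y z w) zw≈1 zx≈zy

  xy≈0⇒y≈0 : ∀ {x y} → x ≉ 0# → x * y ≈ 0# → y ≈ 0#
  xy≈0⇒y≈0 x≉0 xy≈0 = cancelˡ x≉0 (trans xy≈0 (sym (zeroʳ _)))

  xy≈0⇒x≈0⊎y≈0 : ∀ {x y} → x * y ≈ 0# → x ≈ 0# ⊎ y ≈ 0#
  xy≈0⇒x≈0⊎y≈0 {x} xy≈0 with x ≟ 0#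
  ... | yes x≈0 = inj₁ x≈0
  ... | no  x≉0 = inj₂ (xy≈0⇒y≈0 x≉0 xy≈0)

  *-≉0 : ∀ {x y} → x ≉ 0# → y ≉ 0# → x * y ≉ 0#
  *-≉0 x≉0 y≉0 xy≈0 = y≉0 (xy≈0⇒y≈0 x≉0 xy≈0)

  unit-≉0 : ∀ {x y} → x * y ≈ 1# → x ≉ 0#
  unit-≉0 {x} {y} xy≈1 x≈0 = 1≉0 (trans (sym xy≈1) (trans (*-congʳ x≈0) (zeroˡ y)))

  x≉y⇒x-y≉0 : ∀ {x y} → x ≉ y → x - y ≉ 0#
  x≉y⇒x-y≉0 x≉y x-y≈0 = x≉y (x-y≈0⇒x≈y x-y≈0)

  fromℕ-≉0 : ∀ n → .{{ℕ.NonZero n}} → fromℕ n ≉ 0#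
  fromℕ-≉0 (suc n) = char0 n

  fromℤ-≉0 : ∀ {i} → ¬ i ≡ + 0 → fromℤ i ≉ 0#
  fromℤ-≉0 {+ zero}   i≢0 = ⊥-elim (i≢0 _≡_.refl)
  fromℤ-≉0 {+ suc n}  i≢0 = char0 n
  fromℤ-≉0 { -[1+ n ]} i≢0 -n≈0 = char0 n (lincomb 1 (λ a → (:- one) ∙ :- a := # 0 ⇒ ⊢ a := # 0) (fromℕ (suc n)) -n≈0)

  fromℤ-injective : ∀ {i j} → fromℤ i ≈ fromℤ j → i ≡ j
  fromℤ-injective {i} {j} fi≈fj with i ℤ.- j ℤₚ.≟ + 0
  ... | yes i-j≡0 = ℤₚ.i-j≡0⇒i≡j i j i-j≡0
  ... | no  i-j≢0 = ⊥-elim (fromℤ-≉0 i-j≢0 (begin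
    fromℤ (i ℤ.- j)          ≈⟨ fromℤ-+ i (ℤ.- j) ⟩
    fromℤ i + fromℤ (ℤ.- j)  ≈⟨ +-cong fi≈fj (fromℤ-neg j) ⟩
    fromℤ j - fromℤ j        ≈⟨ -‿inverseʳ _ ⟩
    0#                       ∎))
    where open import Relation.Binary.Reasoning.Setoid setoid

-- Approximate places and their extension.

module Places {c ℓ} (K : AlgClosureℚ c ℓ) where
  open AlgClosureℚ K
  open LinearCombinations commRing
  open FieldProperties K

  Predicate : Set (lsuc (c ⊔ ℓ))
  Predicate = Carrier → Set (c ⊔ ℓ)

  record Place : Set (lsuc (c ⊔ ℓ)) where
    field
      O M    : Predicate
      O-resp : ∀ {x y} → x ≈ y → O x → O y
      M-resp : ∀ {x y} → x ≈ y → M x → M y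
      O-1    : O 1#
      O-neg  : ∀ {x} → O x → O (- x)
      O-+    : ∀ {x y} → O x → O y → O (x + y)
      O-*    : ∀ {x y} → O x → O y → O (x * y)
      M-0    : M 0#
      M-+    : ∀ {x y} → M x → M y → M (x + y)
      M-*    : ∀ {x y} → O x → M y → M (x * y)
      M⊆O    : ∀ {x} → M x → O x
      1∉M    : ¬ M 1#

    O-0 : O 0#
    O-0 = M⊆O M-0

    M-neg : ∀ {x} → M x → M (- x)
    M-neg {x} Mx = M-resp (lincomb 1 (λ x → ⊢ :- one :* x := :- x) x) (M-* (O-neg O-1) Mx)

    O-- : ∀ {x y} → O x → O y → O (x - y)
    O-- Ox Oy = O-+ Ox (O-neg Oy)

    M-- : ∀ {x y} → M x → M y → M (x - y)
    M-- Mx My = M-+ Mx (M-neg My)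

    O-fromℕ : ∀ n → O (fromℕ n)
    O-fromℕ zero    = O-0
    O-fromℕ (suc n) = O-+ O-1 (O-fromℕ n)

    -- The coset 1 + M of principal units: multiplicatively closed and disjoint from M, hence
    -- available as denominators even when O is not local.
    U : Predicate
    U u = M (u - 1#)

    U⊆O : ∀ {u} → U u → O u
    U⊆O {u} Uu = O-resp (lincomb 1 (λ u → ⊢ u :- one :+ one := u) u) (O-+ (M⊆O Uu) O-1)

    U-1 : U 1#
    U-1 = M-resp (sym (-‿inverseʳ 1#)) M-0

    U-* : ∀ {u v} → U u → U v → U (u * v)
    U-* {u} {v} Uu Uv = M-resp (lincomb 2 (λ u v → ⊢ v :* (u :- one) :+ (v :- one) := u :* v :- one) u v)
                          (M-+ (M-* (U⊆O Uv) Uu) Uv)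

    U-+M : ∀ {u i} → U u → M i → U (u + i)
    U-+M {u} {i} Uu Mi = M-resp (lincomb 2 (λ u i → ⊢ u :- one :+ i := u :+ i :- one) u i) (M-+ Uu Mi)

    U-disjoint : ∀ {u} → U u → ¬ M u
    U-disjoint {u} Uu Mu = 1∉M (M-resp (lincomb 1 (λ u → ⊢ u :- (u :- one) := one) u) (M-- Mu Uu))

    U⇒≉0 : ∀ {u} → U u → u ≉ 0#
    U⇒≉0 Uu u≈0 = U-disjoint Uu (M-resp (sym u≈0) M-0)

  -- The order of Chevalley's extension theorem, in which the maximal pairs are the valuation rings
  -- with their maximal ideals.
  record _⊑_ (V W : Place) : Set (c ⊔ ℓ) where
    private
      module V = Place V
      module W = Place W
    field
      O⊆ : ∀ {x} → V.O x → W.O x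
      M⊆ : ∀ {x} → V.M x → W.M x
  open _⊑_ public

  ⊑-refl : ∀ {W} → W ⊑ W
  ⊑-refl = record { O⊆ = λ p → p ; M⊆ = λ p → p }

  ⊑-trans : ∀ {V W X} → V ⊑ W → W ⊑ X → V ⊑ X
  ⊑-trans p q = record { O⊆ = O⊆ q ∘ O⊆ p ; M⊆ = M⊆ q ∘ M⊆ p }

  -- Values at `x` of polynomials with coefficients in `P`, in Horner form. Leaving `P` open yields
  -- the ring O[x] and its ideal M[x] from one definition.
  data Adjoin (P : Predicate) (x : Carrier) : Predicate where
    const  : ∀ {a s} → P a → s ≈ a → Adjoin P x s
    horner : ∀ {a r s} → P a → Adjoin P x r → s ≈ a + x * r → Adjoin P x s

  module _ {P : Predicate} {x : Carrier} where
    adjoin-resp : ∀ {r s} → r ≈ s → Adjoin P x r → Adjoin P x s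
    adjoin-resp r≈s (const Pa r≈a)     = const Pa (trans (sym r≈s) r≈a)
    adjoin-resp r≈s (horner Pa q r≈aq) = horner Pa q (trans (sym r≈s) r≈aq)

    adjoin-shift : P 0# → ∀ {r} → Adjoin P x r → Adjoin P x (x * r)
    adjoin-shift P0 {r} p = horner P0 p (sym (+-identityˡ _))

    module _ (P-+ : ∀ {a b} → P a → P b → P (a + b)) where
      adjoin-+ : ∀ {r s} → Adjoin P x r → Adjoin P x s → Adjoin P x (r + s)
      adjoin-+ (const Pa e) (const Pb f) = const (P-+ Pa Pb) (+-cong e f)
      adjoin-+ {r} {s} (const {a} Pa e) (horner {b} {s′} Pb q f) = horner (P-+ Pa Pb) q
        (lincomb 6 (λ r s a b t x → one ∙ r := a ⇒ one ∙ s := b :+ x :* t ⇒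
            ⊢ r :+ s := a :+ b :+ x :* t) r s a b s′ x e f)
      adjoin-+ {r} {s} (horner {a} {r′} Pa p e) (const {b} Pb f) = horner (P-+ Pa Pb) p
        (lincomb 6 (λ r s a b t x → one ∙ r := a :+ x :* t ⇒ one ∙ s := b ⇒
            ⊢ r :+ s := a :+ b :+ x :* t) r s a b r′ x e f)
      adjoin-+ {r} {s} (horner {a} {r′} Pa p e) (horner {b} {s′} Pb q f) = horner (P-+ Pa Pb) (adjoin-+ p q)
        (lincomb 7 (λ r s a b t v x → one ∙ r := a :+ x :* t ⇒ one ∙ s := b :+ x :* v ⇒
            ⊢ r :+ s := a :+ b :+ x :* (t :+ v)) r s a b r′ s′ x e f)

  adjoin-mono : ∀ {P Q x} → (∀ {a} → P a → Q a) → ∀ {s} → Adjoin P x s → Adjoin Q x s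
  adjoin-mono P⊆Q (const Pa e)    = const (P⊆Q Pa) e
  adjoin-mono P⊆Q (horner Pa q e) = horner (P⊆Q Pa) (adjoin-mono P⊆Q q) e

  module _ {P Q R : Predicate} (P*Q : ∀ {a b} → P a → Q b → R (a * b))
           (R-+ : ∀ {a b} → R a → R b → R (a + b)) (R-0 : R 0#) {x : Carrier} where
    adjoin-scale : ∀ {a s} → P a → Adjoin Q x s → Adjoin R x (a * s)
    adjoin-scale Pa (const Qb e) = const (P*Q Pa Qb) (*-congˡ e)
    adjoin-scale {a} {s} Pa (horner {b} {t} Qb q e) = horner (P*Q Pa Qb) (adjoin-scale Pa q)
      (lincomb 5 (λ a b s t x → a ∙ s := b :+ x :* t ⇒ ⊢ a :* s := a :* b :+ x :* (a :* t)) a b s t x e)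

    adjoin-* : ∀ {r s} → Adjoin P x r → Adjoin Q x s → Adjoin R x (r * s)
    adjoin-* (const Pa e) q = adjoin-resp (*-congʳ (sym e)) (adjoin-scale Pa q)
    adjoin-* {r} {s} (horner {a} {t} Pa p e) q =
      adjoin-resp (lincomb 5 (λ a r s t x → (:- s) ∙ r := a :+ x :* t ⇒
          ⊢ a :* s :+ x :* (t :* s) := r :* s) a r s t x e)
        (adjoin-+ R-+ (adjoin-scale Pa q) (adjoin-shift R-0 (adjoin-* p q)))

  module _ (W : Place) where
    open Place W

    data Span (P : Predicate) : List Carrier → Predicate where
      nil  : ∀ {s} → s ≈ 0# → Span P [] s
      cons : ∀ {a v vs r s} → P a → Span P vs r → s ≈ a * v + r → Span P (v ∷ vs) s

    span-resp : ∀ {P vs r s} → r ≈ s → Span P vs r → Span P vs s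
    span-resp r≈s (nil e)       = nil (trans (sym r≈s) e)
    span-resp r≈s (cons Pa p e) = cons Pa p (trans (sym r≈s) e)

    span-+ : ∀ {P} → (∀ {a b} → P a → P b → P (a + b)) →
             ∀ {vs r s} → Span P vs r → Span P vs s → Span P vs (r + s)
    span-+ P-+ (nil e) (nil f) = nil (trans (+-cong e f) (+-identityˡ 0#))
    span-+ P-+ {r = r} {s} (cons {a} {v} {_} {r′} Pa p e) (cons {b} {_} {_} {s′} Pb q f) =
      cons (P-+ Pa Pb) (span-+ P-+ p q)
        (lincomb 7 (λ r s a b v t w → one ∙ r := a :* v :+ t ⇒ one ∙ s := b :* v :+ w ⇒
            ⊢ r :+ s := (a :+ b) :* v :+ (t :+ w)) r s a b v r′ s′ e f)

    span-scale : ∀ {P Q R : Predicate} → (∀ {a b} → P a → Q b → R (a * b)) →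
                 ∀ {vs a s} → P a → Span Q vs s → Span R vs (a * s)
    span-scale P*Q {a = a} Pa (nil e) = nil (trans (*-congˡ e) (zeroʳ a))
    span-scale P*Q {a = a} {s} Pa (cons {b} {v} {_} {t} Qb p e) =
      cons (P*Q Pa Qb) (span-scale P*Q Pa p)
          (lincomb 5 (λ a b s t v → a ∙ s := b :* v :+ t ⇒ ⊢ a :* s := a :* b :* v :+ a :* t) a b s t v e)

    span-zeros : ∀ {P vs s} → All (_≈ 0#) vs → Span P vs s → s ≈ 0#
    span-zeros [] (nil e) = e
    span-zeros {s = s} (v≈0 ∷ vs≈0) (cons {a} {v} {_} {r} _ p e) =
      (lincomb 4 (λ a v r s → one ∙ s := a :* v :+ r ⇒ a ∙ v := # 0 ⇒ one ∙ r := # 0 ⇒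
          ⊢ s := # 0) a v r s) e v≈0 (span-zeros vs≈0 p)

    -- Elimination takes the place of a determinant. The first relation u v = i v + w reads (u - i)
    -- v = w with u - i a principal unit; multiplying the other relations by u - i removes v from
    -- them. Each vector has its own unit u because principal units are not yet invertible in O.
    nakayama : ∀ vs → All (λ v → ∃ λ u → U u × Span M vs (u * v)) vs → All (_≈ 0#) vs
    nakayama []       []                                       = []
    nakayama (v ∷ vs) ((u , Uu , cons {i} {r = w} Mi w∈ e) ∷ ps) = v≈0 ∷ vs≈0
      where
      U-u-i : U (u - i)
      U-u-i = U-+M Uu (M-neg Mi)

      eliminate : ∀ {v′} → (∃ λ u′ → U u′ × Span M (v ∷ vs) (u′ * v′)) → ∃ λ u′ → U u′ × Span M vs (u′ * v′)
      eliminate {v′} (u′ , Uu′ , cons {j} {r = w′} Mj w′∈ e′) =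
        (u - i) * u′ , U-* U-u-i Uu′ ,
        span-resp (lincomb 8 (λ u i v w x y z j → (:- j) ∙ u :* v := i :* v :+ w ⇒
            (:- u :+ i) ∙ x :* y := j :* v :+ z ⇒ ⊢ j :* w :+ (u :- i) :* z
            := (u :- i) :* x :* y) u i v w u′ v′ w′ j e e′)
          (span-+ M-+ (span-scale M-* (M⊆O Mj) w∈) (span-scale M-* (U⊆O U-u-i) w′∈))

      vs≈0 : All (_≈ 0#) vs
      vs≈0 = nakayama vs (All.map eliminate ps)

      v≈0 : v ≈ 0#
      v≈0 = xy≈0⇒y≈0 (U⇒≉0 U-u-i)
        (lincomb 4 (λ u i v w → one ∙ u :* v := i :* v :+ w ⇒ one ∙ w := # 0 ⇒
            ⊢ (u :- i) :* v := # 0) u i v w e (span-zeros vs≈0 w∈))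

    module _ (x : Carrier) where
      power : ℕ → Carrier
      power zero    = 1#
      power (suc n) = x * power n

      powers : ℕ → List Carrier
      powers zero    = []
      powers (suc n) = power n ∷ powers n

      span-shift : ∀ {P} → P 0# → ∀ n {s} → Span P (powers n) s → Span P (powers (suc n)) (x * s)
      span-shift P0 zero    {s} (nil e) = cons P0 (nil refl)
          (lincomb 2 (λ x s → x ∙ s := # 0 ⇒ ⊢ x :* s := # 0 :* one :+ # 0) x s e)
      span-shift P0 (suc n) {s} (cons {a} {r = r} Pa p e) = cons Pa (span-shift P0 n p)
        (lincomb 5 (λ x a s r y → x ∙ s := a :* y :+ r ⇒ ⊢ x :* s := a :* (x :* y) :+ x :* r) x a s r (power n) e)

      span-cons : ∀ {P} → P 0# → ∀ {v vs s} → Span P vs s → Span P (v ∷ vs) s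
      span-cons P0 {v} {s = s} p = cons P0 p (lincomb 2 (λ v s → ⊢ s := # 0 :* v :+ s) v s)

      -- Multiplied by the d-th power of x, a polynomial of degree d in y = 1/x becomes a polynomial
      -- of degree at most d in x.
      reversed : ∀ {y r} → x * y ≈ 1# → Adjoin O y r → ∃ λ d → Span O (powers (suc d)) (power d * r)
      reversed xy≈1 (const {a} {s} Oa e) = 0 , cons Oa (nil refl)
          (lincomb 2 (λ a s → one ∙ s := a ⇒ ⊢ one :* s := a :* one :+ # 0) a s e)
      reversed {y} xy≈1 (horner {a} {r} {s} Oa q e) with d , p ← reversed xy≈1 q =
        suc d , cons Oa p (lincomb 6 (λ a s x y r p → (r :* p) ∙ x :* y := one ⇒ (x :* p) ∙ s := a :+ y :* r ⇒
            ⊢ x :* p :* s := a :* (x :* p) :+ p :* r) a s x y r (power d) xy≈1 e)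

      span-const : ∀ {P} → P 0# → ∀ n {a} → P a → Span P (powers (suc n)) a
      span-const P0 zero    {a} Pa = cons Pa (nil refl) (lincomb 1 (λ a → ⊢ a := a :* one :+ # 0) a)
      span-const P0 (suc n)     Pa = span-cons P0 (span-const P0 n Pa)

      adjoin-power : ∀ {P} → P 0# → Adjoin P x 1# → ∀ n → Adjoin P x (power n)
      adjoin-power P0 p zero    = p
      adjoin-power P0 p (suc n) = adjoin-shift P0 (adjoin-power P0 p n)

      -- Each power of x lies in M·O[x], which is spanned by x^d,…,1 over M up to principal units,
      -- because u x^{d+1} is an O-combination of these; by Nakayama's lemma the power 1 vanishes.
      integral⇒1∉ : ∀ {u d} → U u → Span O (powers (suc d)) (u * power (suc d)) → ¬ Adjoin M x 1#
      integral⇒1∉ {u} {d} Uu p 1∈ = 1∉powers d (nakayama (powers (suc d)) (all-powers (suc d)))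
        where
        reduce : ∀ {r} → Adjoin M x r → ∃ λ v → U v × Span M (powers (suc d)) (v * r)
        reduce {r} (const {a} Ma e) = 1# , U-1 ,
          span-resp (trans (sym e) (sym (*-identityˡ r))) (span-const M-0 d Ma)
        reduce {r} (horner {a} {t} Ma q e) with v , Uv , p′ ← reduce q with span-shift M-0 (suc d) p′
        -- The shift may produce a multiple of the power d + 1 of x; after multiplication by u, the
        -- hypothesis `p` rewrites it in lower powers.
        ... | cons {b} {_} {_} {w} Mb w∈ f = u * v , U-* Uu Uv ,
          span-resp (lincomb 9 (λ a r t u v w b x y → (:- (u :* v)) ∙ r := a :+ x :* t ⇒
              (:- u) ∙ x :* (v :* t) := b :* y :+ w ⇒ ⊢ u :* v :* a :+ (b :* (u :* y) :+ u :* w)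
              := u :* v :* r) a r t u v w b x (power (suc d)) e f)
            (span-+ M-+ (span-const M-0 d (M-* (U⊆O (U-* Uu Uv)) Ma))
              (span-+ M-+ (span-scale M*O Mb p) (span-scale M-* (U⊆O Uu) w∈)))
          where
          M*O : ∀ {a b} → M a → O b → M (a * b)
          M*O Ma Ob = M-resp (*-comm _ _) (M-* Ob Ma)

        all-powers : ∀ n → All (λ v → ∃ λ u → U u × Span M (powers (suc d)) (u * v)) (powers n)
        all-powers zero    = []
        all-powers (suc n) = reduce (adjoin-power M-0 1∈ n) ∷ all-powers n

        1∉powers : ∀ n → ¬ All (_≈ 0#) (powers (suc n))
        1∉powers zero    (1≈0 ∷ []) = 1≉0 1≈0
        1∉powers (suc n) (_ ∷ ps)   = 1∉powers n ps

    adjoin : (x : Carrier) → ¬ Adjoin M x 1# → Place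
    adjoin x 1∉ = record
      { O = Adjoin O x
      ; M = Adjoin M x
      ; O-resp = adjoin-resp
      ; M-resp = adjoin-resp
      ; O-1 = const O-1 refl
      ; O-neg = λ {y} p → adjoin-resp
          (lincomb 1 (λ y → ⊢ :- one :* y := :- y) y) (adjoin-scale O-* O-+ O-0 (O-neg O-1) p)
      ; O-+ = adjoin-+ O-+
      ; O-* = adjoin-* O-* O-+ O-0
      ; M-0 = const M-0 refl
      ; M-+ = adjoin-+ M-+
      ; M-* = adjoin-* M-* M-+ M-0
      ; M⊆O = adjoin-mono M⊆O
      ; 1∉M = 1∉
      }

    -- The ideal M + y O[y] of O[y]. It contains y, since the inverse of an element that is not
    -- finite has to be infinitesimal.
    InverseIdeal : Carrier → Predicate
    InverseIdeal y s = ∃ λ i → ∃ λ r → M i × Adjoin O y r × s ≈ i + y * r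

    adjoin-inverse : (y : Carrier) → ¬ InverseIdeal y 1# → Place
    adjoin-inverse y 1∉ = record
      { O = Adjoin O y
      ; M = InverseIdeal y
      ; O-resp = adjoin-resp
      ; M-resp = λ { r≈s (i , r , Mi , p , e) → i , r , Mi , p , trans (sym r≈s) e }
      ; O-1 = const O-1 refl
      ; O-neg = λ {z} p → adjoin-resp
          (lincomb 1 (λ z → ⊢ :- one :* z := :- z) z) (adjoin-scale O-* O-+ O-0 (O-neg O-1) p)
      ; O-+ = adjoin-+ O-+
      ; O-* = O[y]-*
      ; M-0 = 0# , 0# , M-0 , const O-0 refl , (lincomb 1 (λ y → ⊢ # 0 := # 0 :+ y :* # 0) y)
      ; M-+ = λ { {s} {t} (i , r , Mi , p , e) (j , r′ , Mj , q , f) →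
          i + j , r + r′ , M-+ Mi Mj , adjoin-+ O-+ p q ,
          (lincomb 7 (λ s t i j r v y → one ∙ s := i :+ y :* r ⇒ one ∙ t := j :+ y :* v ⇒
              ⊢ s :+ t := i :+ j :+ y :* (r :+ v)) s t i j r r′ y) e f }
      ; M-* = λ { {_} {t} (const {a} {s} Oa e) (i , r , Mi , p , f) →
                  a * i , a * r , M-* Oa Mi , adjoin-scale O-* O-+ O-0 Oa p ,
                  (lincomb 6 (λ a i r s t y → t ∙ s := a ⇒ a ∙ t := i :+ y :* r ⇒
                      ⊢ s :* t := a :* i :+ y :* (a :* r)) a i r s t y) e f
                ; {_} {t} (horner {a} {b} {s} Oa q e) (i , r , Mi , p , f) →
                  a * i , b * i + (a + y * b) * r , M-* Oa Mi ,
                  adjoin-+ O-+ (O[y]-* q (const (M⊆O Mi) refl))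
                               (O[y]-* (horner Oa q refl) p) ,
                  (lincomb 7 (λ a b i r s t y → (r :* y :+ i) ∙ s := a :+ y :* b ⇒ s ∙ t := i :+ y :* r ⇒
                      ⊢ s :* t := a :* i :+ y :* (b :* i :+ (a :+ y :* b) :* r)) a b i r s t y) e f }
      ; M⊆O = λ { (i , r , Mi , p , e) → horner (M⊆O Mi) p e }
      ; 1∉M = 1∉
      }
      where
      O[y]-* : ∀ {r s} → Adjoin O y r → Adjoin O y s → Adjoin O y (r * s)
      O[y]-* = adjoin-* O-* O-+ O-0

    -- The dichotomy of valuation rings, in continuation-passing style.
    ask : (x : Carrier) →
          (∀ V → W ⊑ V → Place.O V x → ⊥) →
          (∀ V → W ⊑ V → ∀ y → x * y ≈ 1# → Place.M V y → ⊥) → ⊥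
    ask x integral infinite with x ≟ 0#
    ... | yes x≈0 = integral W ⊑-refl (O-resp (sym x≈0) O-0)
    ... | no  x≉0 with y , xy≈1 ← inverse x x≉0 =
      -- Both extensions cannot be improper: 1 = i + y r with i in M makes (1 - i) x^{d+1} a
      -- combination of lower powers of x, so x is integral up to a principal unit and 1 is not in
      -- M[x].
      1∉finite λ 1∈finite → 1∉infinite xy≈1 λ 1∈infinite → contradict xy≈1 1∈finite 1∈infinite
      where
      1∉finite : ¬ ¬ Adjoin M x 1#
      1∉finite 1∉ = integral (adjoin x 1∉)
        (record { O⊆ = λ p → const p refl ; M⊆ = λ p → const p refl })
        (horner O-0 (const O-1 refl) (lincomb 1 (λ x → ⊢ x := # 0 :+ x :* one) x))

      1∉infinite : ∀ {y} → x * y ≈ 1# → ¬ ¬ InverseIdeal y 1#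
      1∉infinite {y} xy≈1 1∉ = infinite (adjoin-inverse y 1∉)
        (record { O⊆ = λ p → const p refl
                ; M⊆ = λ {i} p → i , 0# , p , const O-0 refl , (lincomb 2 (λ i y → ⊢ i := i :+ y :* # 0) i y) })
        y xy≈1
        (0# , 1# , M-0 , const O-1 refl , (lincomb 1 (λ y → ⊢ y := # 0 :+ y :* one) y))

      contradict : ∀ {y} → x * y ≈ 1# → Adjoin M x 1# → ¬ InverseIdeal y 1#
      contradict {y} xy≈1 1∈ (i , r , Mi , p , e) with d , q ← reversed x xy≈1 p =
        integral⇒1∉ x (M-resp (lincomb 1 (λ i → ⊢ :- i := one :- i :- one) i) (M-neg Mi))
          (span-resp (sym (lincomb 5 (λ i r x y z → (x :* z) ∙ one := i :+ y :* r ⇒ (r :* z) ∙ x :* y := one ⇒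
              ⊢ (one :- i) :* (x :* z) := z :* r) i r x y (power x d) e xy≈1)) q)
          1∈

    -- Fractions with denominators in 1 + M. No comparison is decided here, so principal units
    -- become invertible without a double negation.
    localise : Place
    localise = record
      { O = Fraction O
      ; M = Fraction M
      ; O-resp = fraction-resp O-resp
      ; M-resp = fraction-resp M-resp
      ; O-1 = 1# , U-1 , O-* O-1 O-1
      ; O-neg = λ { {x} (u , Uu , p) → u , Uu , O-resp
          (lincomb 2 (λ u x → ⊢ :- (u :* x) := u :* (:- x)) u x) (O-neg p) }
      ; O-+ = fraction-+ O-resp O-+ O-*
      ; O-* = λ p q → fraction-* O-resp O-* p q
      ; M-0 = 1# , U-1 , M-resp (sym (zeroʳ 1#)) M-0
      ; M-+ = fraction-+ M-resp M-+ M-*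
      ; M-* = λ p q → fraction-* M-resp M-* p q
      ; M⊆O = λ { (u , Uu , p) → u , Uu , M⊆O p }
      ; 1∉M = λ { (u , Uu , p) → U-disjoint Uu (M-resp (*-identityʳ u) p) }
      }
      where
      Fraction : Predicate → Predicate
      Fraction P x = ∃ λ u → U u × P (u * x)

      fraction-resp : ∀ {P x y} → (∀ {a b} → a ≈ b → P a → P b) → x ≈ y → Fraction P x → Fraction P y
      fraction-resp P-resp x≈y (u , Uu , p) = u , Uu , P-resp (*-congˡ x≈y) p

      fraction-+ : ∀ {P x y} → (∀ {a b} → a ≈ b → P a → P b) → (∀ {a b} → P a → P b → P (a + b)) →
                   (∀ {a b} → O a → P b → P (a * b)) → Fraction P x → Fraction P y → Fraction P (x + y)
      fraction-+ {_} {x} {y} P-resp P-+ O*P (u , Uu , p) (v , Uv , q) = u * v , U-* Uu Uv ,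
        P-resp (lincomb 4 (λ u v x y → ⊢ v :* (u :* x) :+ u :* (v :* y)
            := u :* v :* (x :+ y)) u v x y) (P-+ (O*P (U⊆O Uv) p) (O*P (U⊆O Uu) q))

      fraction-* : ∀ {P x y} → (∀ {a b} → a ≈ b → P a → P b) → (∀ {a b} → O a → P b → P (a * b)) →
                   Fraction O x → Fraction P y → Fraction P (x * y)
      fraction-* {_} {x} {y} P-resp O*P (u , Uu , p) (v , Uv , q) = u * v , U-* Uu Uv ,
        P-resp (lincomb 4 (λ u v x y → ⊢ u :* x :* (v :* y) := u :* v :* (x :* y)) u v x y) (O*P p q)

    ⊑-localise : W ⊑ localise
    ⊑-localise = record { O⊆ = λ {x} p → 1# , U-1 , O-resp (sym (*-identityˡ x)) p
                        ; M⊆ = λ {x} p → 1# , U-1 , M-resp (sym (*-identityˡ x)) p }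

  Local : Place → Set (c ⊔ ℓ)
  Local W = ∀ {u} → U u → ∃ λ v → O v × u * v ≈ 1#
    where open Place W

  localise-local : ∀ W → Local (localise W)
  localise-local W {u} (w , Uw , p) = v , (w * u , Uwu , O-resp
      (lincomb 3 (λ u v w → (:- w) ∙ u :* v := one ⇒ ⊢ w := w :* u :* v) u v w uv≈1) (U⊆O Uw)) , uv≈1
    where
    open Place W
    Uwu : U (w * u)
    Uwu = M-resp (lincomb 2 (λ u w → ⊢ w :* (u :- one) :+ (w :- one) := w :* u :- one) u w) (M-+ p Uw)
    u≉0 : u ≉ 0#
    u≉0 u≈0 = U⇒≉0 Uwu (trans (*-congˡ u≈0) (zeroʳ w))
    v    = proj₁ (inverse u u≉0)
    uv≈1 = proj₂ (inverse u u≉0)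

open Places using (Place; Local)

-- The group law on y² = x³ + A x + B.

module GroupLaw {c ℓ} (K : AlgClosureℚ c ℓ) where
  open AlgClosureℚ K
  open LinearCombinations commRing
  open FieldProperties K

  module Short (A B : Carrier) (disc≉0 : fromℕ 4 * (A * A * A) + fromℕ 27 * (B * B) ≉ 0#) where

    2≉0 : fromℕ 2 ≉ 0#
    2≉0 = char0 1

    OnCubic : Carrier → Carrier → Set ℓ
    OnCubic x y = y * y ≈ x * x * x + A * x + B

    Opposite : (x₁ y₁ x₂ y₂ : Carrier) → Set ℓ
    Opposite x₁ y₁ x₂ y₂ = x₁ ≈ x₂ × y₁ + y₂ ≈ 0#

    -- m is the slope of the chord, or of the tangent when the two points coincide.
    record Slope (m x₁ y₁ x₂ y₂ : Carrier) : Set ℓ where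
      constructor slope
      field
        chord : m * (x₁ - x₂) ≈ y₁ - y₂
        conj  : m * (y₁ + y₂) ≈ x₁ * x₁ + x₁ * x₂ + x₂ * x₂ + A

    -- x³ + A x + B − (m x + n)² = (x − x₁)(x − x₂)(x − x₃), coefficient by coefficient.
    record Line (m n x₁ y₁ x₂ y₂ x₃ y₃ : Carrier) : Set ℓ where
      constructor line
      field
        l₁ : y₁ ≈ m * x₁ + n
        l₂ : y₂ ≈ m * x₂ + n
        l₃ : y₃ ≈ m * x₃ + n
        e₁ : x₁ + x₂ + x₃ ≈ m * m
        e₂ : x₁ * x₂ + x₁ * x₃ + x₂ * x₃ ≈ A - fromℕ 2 * m * n
        e₃ : x₁ * x₂ * x₃ ≈ n * n - B

    line-swap₁₂ : ∀ {m n x₁ y₁ x₂ y₂ x₃ y₃} → Line m n x₁ y₁ x₂ y₂ x₃ y₃ → Line m n x₂ y₂ x₁ y₁ x₃ y₃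
    line-swap₁₂ {m} {n} {x₁} {y₁} {x₂} {y₂} {x₃} (line l₁ l₂ l₃ e₁ e₂ e₃) = line l₂ l₁ l₃
      (lincomb 4 (λ x y z t → one ∙ x :+ y :+ z := t ⇒ ⊢ y :+ x :+ z := t) x₁ x₂ x₃ (m * m) e₁)
      (lincomb 4 (λ x y z t → one ∙ x :* y :+ x :* z :+ y :* z := t ⇒
          ⊢ y :* x :+ y :* z :+ x :* z := t) x₁ x₂ x₃ (A - fromℕ 2 * m * n) e₂)
      (lincomb 4 (λ x y z t → one ∙ x :* y :* z := t ⇒ ⊢ y :* x :* z := t) x₁ x₂ x₃ (n * n - B) e₃)

    line-swap₂₃ : ∀ {m n x₁ y₁ x₂ y₂ x₃ y₃} → Line m n x₁ y₁ x₂ y₂ x₃ y₃ → Line m n x₁ y₁ x₃ y₃ x₂ y₂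
    line-swap₂₃ {m} {n} {x₁} {y₁} {x₂} {y₂} {x₃} (line l₁ l₂ l₃ e₁ e₂ e₃) = line l₁ l₃ l₂
      (lincomb 4 (λ x y z t → one ∙ x :+ y :+ z := t ⇒ ⊢ x :+ z :+ y := t) x₁ x₂ x₃ (m * m) e₁)
      (lincomb 4 (λ x y z t → one ∙ x :* y :+ x :* z :+ y :* z := t ⇒
          ⊢ x :* z :+ x :* y :+ z :* y := t) x₁ x₂ x₃ (A - fromℕ 2 * m * n) e₂)
      (lincomb 4 (λ x y z t → one ∙ x :* y :* z := t ⇒ ⊢ x :* z :* y := t) x₁ x₂ x₃ (n * n - B) e₃)

    line-neg : ∀ {m n x₁ y₁ x₂ y₂ x₃ y₃} → Line m n x₁ y₁ x₂ y₂ x₃ y₃ →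
               Line (- m) (- n) x₁ (- y₁) x₂ (- y₂) x₃ (- y₃)
    line-neg {m} {n} {x₁} {y₁} {x₂} {y₂} {x₃} {y₃} (line l₁ l₂ l₃ e₁ e₂ e₃) = line
      (lincomb 4 (λ x y m n → (:- one) ∙ y := m :* x :+ n ⇒ ⊢ :- y := :- m :* x :+ :- n) x₁ y₁ m n l₁)
      (lincomb 4 (λ x y m n → (:- one) ∙ y := m :* x :+ n ⇒ ⊢ :- y := :- m :* x :+ :- n) x₂ y₂ m n l₂)
      (lincomb 4 (λ x y m n → (:- one) ∙ y := m :* x :+ n ⇒ ⊢ :- y := :- m :* x :+ :- n) x₃ y₃ m n l₃)
      (lincomb 2 (λ t m → one ∙ t := m :* m ⇒ ⊢ t := :- m :* (:- m)) (x₁ + x₂ + x₃) m e₁)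
      (lincomb 4 (λ t m n A → one ∙ t := A :- # 2 :* m :* n ⇒
          ⊢ t := A :- # 2 :* (:- m) :* (:- n)) (x₁ * x₂ + x₁ * x₃ + x₂ * x₃) m n A e₂)
      (lincomb 3 (λ t n B → one ∙ t := n :* n :- B ⇒ ⊢ t := :- n :* (:- n) :- B) (x₁ * x₂ * x₃) n B e₃)

    line-on : ∀ {m n x₁ y₁ x₂ y₂ x₃ y₃} → Line m n x₁ y₁ x₂ y₂ x₃ y₃ → OnCubic x₁ y₁
    line-on {m} {n} {x₁} {y₁} {x₂} {_} {x₃} (line l₁ _ _ e₁ e₂ e₃) =
      (lincomb 8 (λ m n x y z t A B → (y :+ m :* x :+ n) ∙ y := m :* x :+ n ⇒
          (:- x :* x) ∙ x :+ z :+ t := m :* m ⇒ x ∙ x :* z :+ x :* t :+ z :* t := A :- # 2 :* m :* n ⇒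
          (:- one) ∙ x :* z :* t := n :* n :- B ⇒ ⊢ y :* y := x :* x :* x :+ A :* x
          :+ B) m n x₁ y₁ x₂ x₃ A B) l₁ e₁ e₂ e₃

    line-slope : ∀ {m n x₁ y₁ x₂ y₂ x₃ y₃} → Line m n x₁ y₁ x₂ y₂ x₃ y₃ → Slope m x₁ y₁ x₂ y₂
    line-slope {m} {n} {x₁} {y₁} {x₂} {y₂} {x₃} (line l₁ l₂ _ e₁ e₂ _) = slope
      (lincomb 6 (λ m n x y z t → (:- one) ∙ y := m :* x :+ n ⇒ one ∙ t := m :* z :+ n ⇒
          ⊢ m :* (x :- z) := y :- t) m n x₁ y₁ x₂ y₂ l₁ l₂)
      (lincomb 8 (λ m n x y z t w A → m ∙ y := m :* x :+ n ⇒ m ∙ t := m :* z :+ n ⇒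
          (:- x :- z) ∙ x :+ z :+ w := m :* m ⇒ one ∙ x :* z :+ x :* w :+ z :* w := A :- # 2 :* m :* n ⇒
          ⊢ m :* (y :+ t) := x :* x :+ x :* z :+ z :* z :+ A) m n x₁ y₁ x₂ y₂ x₃ A l₁ l₂ e₁ e₂)

    slope-line : ∀ {m x₁ y₁ x₂ y₂} → OnCubic x₁ y₁ → Slope m x₁ y₁ x₂ y₂ →
                 let n  = y₁ - m * x₁
                     x₃ = m * m - x₁ - x₂
                 in Line m n x₁ y₁ x₂ y₂ x₃ (m * x₃ + n)
    slope-line {m} {x₁} {y₁} {x₂} {y₂} on (slope s₁ s₂) = line
      (lincomb 3 (λ m x y → ⊢ y := m :* x :+ (y :- m :* x)) m x₁ y₁)
      (lincomb 5 (λ m x y z t → one ∙ m :* (x :- z) := y :- t ⇒ ⊢ t := m :* z :+ (y :- m :* x)) m x₁ y₁ x₂ y₂ s₁)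
      refl
      (lincomb 3 (λ m x z → ⊢ x :+ z :+ (m :* m :- x :- z) := m :* m) m x₁ x₂)
      (lincomb 6 (λ m x y z t A → (:- m) ∙ m :* (x :- z) := y :- t ⇒
          one ∙ m :* (y :+ t) := x :* x :+ x :* z :+ z :* z :+ A ⇒
          ⊢ x :* z :+ x :* (m :* m :- x :- z) :+ z :* (m :* m :- x :- z)
          := A :- # 2 :* m :* (y :- m :* x)) m x₁ y₁ x₂ y₂ A s₁ s₂)
      (lincomb 7 (λ m x y z t A B → (:- one) ∙ y :* y := x :* x :* x :+ A :* x :+ B ⇒
          (:- (m :* x)) ∙ m :* (x :- z) := y :- t ⇒ x ∙ m :* (y :+ t) := x :* x :+ x :* z :+ z :* z :+ A ⇒
          ⊢ x :* z :* (m :* m :- x :- z) := (y :- m :* x) :* (y :- m :* x) :- B) m x₁ y₁ x₂ y₂ A B on s₁ s₂)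

    opposite? : ∀ x₁ y₁ x₂ y₂ → Dec (Opposite x₁ y₁ x₂ y₂)
    opposite? x₁ y₁ x₂ y₂ with x₁ ≟ x₂ | (y₁ + y₂) ≟ 0#
    ... | yes p | yes q = yes (p , q)
    ... | no ¬p | _     = no (¬p ∘ proj₁)
    ... | _     | no ¬q = no (¬q ∘ proj₂)

    -- The factorisation behind the two expressions of a slope, (y₁ - y₂)/(x₁ - x₂) and (x₁² + x₁x₂
    -- + x₂² + A)/(y₁ + y₂): they agree where both make sense.
    cubics-difference : ∀ {x₁ y₁ x₂ y₂} → OnCubic x₁ y₁ → OnCubic x₂ y₂ →
      (y₁ - y₂) * (y₁ + y₂) ≈ (x₁ - x₂) * (x₁ * x₁ + x₁ * x₂ + x₂ * x₂ + A)
    cubics-difference {x₁} {y₁} {x₂} {y₂} on₁ on₂ =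
      (lincomb 6 (λ x y z t A B → one ∙ y :* y := x :* x :* x :+ A :* x :+ B ⇒
          (:- one) ∙ t :* t := z :* z :* z :+ A :* z :+ B ⇒
          ⊢ (y :- t) :* (y :+ t) := (x :- z) :* (x :* x :+ x :* z :+ z :* z :+ A)) x₁ y₁ x₂ y₂ A B) on₁ on₂

    -- The denominators x₁ - x₂ and y₁ + y₂ vanish together only for opposite points. Whichever is
    -- non-zero defines the slope, and `cubics-difference` supplies the other condition; chord and
    -- tangent are thus treated alike.
    slope-exists : ∀ {x₁ y₁ x₂ y₂} → OnCubic x₁ y₁ → OnCubic x₂ y₂ → ¬ Opposite x₁ y₁ x₂ y₂ →
                   ∃ λ m → Slope m x₁ y₁ x₂ y₂
    slope-exists {x₁} {y₁} {x₂} {y₂} on₁ on₂ ¬opp with x₁ ≟ x₂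
    ... | no x₁≉x₂ with w , p ← inverse (x₁ - x₂) (x≉y⇒x-y≉0 x₁≉x₂) =
      (y₁ - y₂) * w , slope
        (lincomb 3 (λ d e w → e ∙ d :* w := one ⇒ ⊢ e :* w :* d := e) (x₁ - x₂) (y₁ - y₂) w p)
        (lincomb 5 (λ d e w s t → t ∙ d :* w := one ⇒ w ∙ e :* s := d :* t ⇒
            ⊢ e :* w :* s := t) (x₁ - x₂) (y₁ - y₂) w (y₁ + y₂) (x₁ * x₁ + x₁ * x₂ + x₂ * x₂ + A) p
            (cubics-difference on₁ on₂))
    ... | yes x₁≈x₂ with w , p ← inverse (y₁ + y₂) (λ q → ¬opp (x₁≈x₂ , q)) =
      t * w , slope
        (lincomb 6 (λ t w x z y u → (:- w) ∙ (y :- u) :* (y :+ u) := (x :- z) :* t ⇒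
            (y :- u) ∙ (y :+ u) :* w := one ⇒ ⊢ t :* w :* (x :- z) := y :- u) t w x₁ x₂ y₁ y₂ d p)
        (lincomb 3 (λ t s w → t ∙ s :* w := one ⇒ ⊢ t :* w :* s := t) t (y₁ + y₂) w p)
      where
      t = x₁ * x₁ + x₁ * x₂ + x₂ * x₂ + A
      d = cubics-difference on₁ on₂

    slope-unique : ∀ {m m′ x₁ y₁ x₂ y₂} → ¬ Opposite x₁ y₁ x₂ y₂ →
                   Slope m x₁ y₁ x₂ y₂ → Slope m′ x₁ y₁ x₂ y₂ → m ≈ m′
    slope-unique {m} {m′} {x₁} {y₁} {x₂} {y₂} ¬opp (slope s₁ s₂) (slope s₁′ s₂′) with x₁ ≟ x₂
    ... | no x₁≉x₂  = cancelˡ (x≉y⇒x-y≉0 x₁≉x₂)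
      (lincomb 4 (λ m k d e → one ∙ m :* d := e ⇒ (:- one) ∙ k :* d := e ⇒
          ⊢ d :* m := d :* k) m m′ (x₁ - x₂) (y₁ - y₂) s₁ s₁′)
    ... | yes x₁≈x₂ = cancelˡ (λ q → ¬opp (x₁≈x₂ , q))
      (lincomb 4 (λ m k d e → one ∙ m :* d := e ⇒ (:- one) ∙ k :* d := e ⇒
          ⊢ d :* m := d :* k) m m′ (y₁ + y₂) (x₁ * x₁ + x₁ * x₂ + x₂ * x₂ + A) s₂ s₂′)

    -- The multipliers are those of the Bézout identity that writes 4A³ + 27B² in terms of the cubic
    -- and its derivative.
    2-torsion-free : ∀ {x} → fromℕ 3 * (x * x) + A ≈ 0# → x * x * x + A * x + B ≉ 0#
    2-torsion-free {x} p q = disc≉0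
      (lincomb 3 (λ x A B → (# 6 :* x :^ 2 :* A :- # 9 :* x :* B :+ # 4 :* A :^ 2) ∙ # 3 :* (x :* x) :+ A
          := # 0 ⇒ (:- (# 18 :* x :* A) :+ # 27 :* B) ∙ x :* x :* x :+ A :* x :+ B := # 0 ⇒
          ⊢ # 4 :* (A :* A :* A) :+ # 27 :* (B :* B) := # 0) x A B p q)

    -- For opposite points `chord` would give 2 y₁ = 0 and `conj` would give 3 x₁² + A = 0: a
    -- singular point of the cubic.
    slope⇒¬opposite : ∀ {m x₁ y₁ x₂ y₂} → OnCubic x₁ y₁ → Slope m x₁ y₁ x₂ y₂ → ¬ Opposite x₁ y₁ x₂ y₂
    slope⇒¬opposite {m} {x₁} {y₁} {x₂} {y₂} on (slope s₁ s₂) (p , q) = 2-torsion-free {x₁}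
      (lincomb 6 (λ m x y z t A → (:- one) ∙ m :* (y :+ t) := x :* x :+ x :* z :+ z :* z :+ A ⇒
          (# 2 :* x :+ z) ∙ x := z ⇒ m ∙ y :+ t := # 0 ⇒ ⊢ # 3 :* (x :* x) :+ A := # 0) m x₁ y₁ x₂ y₂ A s₂ p q)
      (lincomb 4 (λ x y A B → (:- one) ∙ y :* y := x :* x :* x :+ A :* x :+ B ⇒ y ∙ y := # 0 ⇒
          ⊢ x :* x :* x :+ A :* x :+ B := # 0) x₁ y₁ A B on y₁≈0)
      where
      y₁≈0 : y₁ ≈ 0#
      y₁≈0 = xy≈0⇒y≈0 2≉0
        (lincomb 5 (λ m x y z t → (:- one) ∙ m :* (x :- z) := y :- t ⇒ m ∙ x := z ⇒ one ∙ y :+ t := # 0 ⇒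
            ⊢ # 2 :* y := # 0) m x₁ y₁ x₂ y₂ s₁ p q)

    -- With κ = m + m′ ≠ 0 and γ = 1/κ, the parabola y = m x + n + γ (x − x₁)(x − x₂) passes through
    -- P₁, P₂, P₃ and P₄; subtracting γ (x − x₁)(x − x₃) leaves the line through P₁ and P₃.
    parabola-slope : ∀ {γ m n m′ n′ x₁ y₁ x₂ y₂ x₃ y₃ x₄ y₄ u v} → γ * (m + m′) ≈ 1# →
      Line m n x₁ y₁ x₂ y₂ u v → Line m′ n′ x₃ y₃ x₄ y₄ u (- v) →
      Slope (m + γ * (x₃ - x₂)) x₁ y₁ x₃ y₃
    parabola-slope {γ} {m} {n} {m′} {n′} {x₁} {y₁} {x₂} {y₂} {x₃} {y₃} {x₄} {y₄} {u} {v} γκ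
                   (line l₁ l₂ l₃ e₁ e₂ e₃) (line l₁′ l₂′ l₃′ e₁′ e₂′ e₃′) = slope chord conj
      where
      -- The point P₃ lies on the parabola.
      vertex : m′ * x₃ + n′ - (m * x₃ + n) ≈ γ * ((x₃ - x₁) * (x₃ - x₂))
      vertex = lincomb 12 (λ γ m n k l a b c d u A y → (m :* c :+ m :* u :- k :* c :+ k :* u
          :+ # 2 :* n) ∙ γ :* (m :+ k) := one ⇒ (γ :* c :+ γ :* u) ∙ a :+ b :+ u := m :* m ⇒
          (:- γ) ∙ a :* b :+ a :* u :+ b :* u := A :- # 2 :* m :* n ⇒
          (:- (γ :* c) :- γ :* u) ∙ c :+ d :+ u := k :* k ⇒
          γ ∙ c :* d :+ c :* u :+ d :* u := A :- # 2 :* k :* l ⇒ (# 2 :* γ :* k :- one) ∙ y := m :* u :+ n ⇒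
          (# 2 :* γ :* k :- one) ∙ :- y := k :* u :+ l ⇒
          ⊢ k :* c :+ l :- (m :* c :+ n) := γ :* ((c :- a) :* (c :- b))) γ m n m′ n′ x₁ x₂ x₃ x₄ u A v γκ e₁ e₂
          e₁′ e₂′ l₃ l₃′
      chord : (m + γ * (x₃ - x₂)) * (x₁ - x₃) ≈ y₁ - y₃
      chord = lincomb 10 (λ γ m n k l a b c y z → (:- one) ∙ y := m :* a :+ n ⇒ one ∙ z := k :* c :+ l ⇒
          one ∙ k :* c :+ l :- (m :* c :+ n) := γ :* ((c :- a) :* (c :- b)) ⇒
          ⊢ (m :+ γ :* (c :- b)) :* (a :- c) := y :- z) γ m n m′ n′ x₁ x₂ x₃ y₁ y₃ l₁ l₁′ vertex
      conj : (m + γ * (x₃ - x₂)) * (y₁ + y₃) ≈ x₁ * x₁ + x₁ * x₃ + x₃ * x₃ + A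
      conj = lincomb 13 (λ γ m n k l a b c u A v y z → (:- (b :* c) :+ b :* u :+ c :^ 2 :- c :* u) ∙ γ :* (m
          :+ k) := one ⇒ (:- a :- c) ∙ a :+ b :+ u := m :* m ⇒
          one ∙ a :* b :+ a :* u :+ b :* u := A :- # 2 :* m :* n ⇒ (γ :* b :- γ :* c) ∙ v := m :* u :+ n ⇒
          (γ :* b :- γ :* c) ∙ :- v := k :* u :+ l ⇒ (:- (γ :* b) :+ γ :* c :+ m) ∙ y := m :* a :+ n ⇒
          (:- (γ :* b) :+ γ :* c :+ m) ∙ z := k :* c :+ l ⇒
          m ∙ k :* c :+ l :- (m :* c :+ n) := γ :* ((c :- a) :* (c :- b)) ⇒
          ⊢ (m :+ γ :* (c :- b)) :* (y :+ z) := a :* a :+ a :* c :+ c :* c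
          :+ A) γ m n m′ n′ x₁ x₂ x₃ u A v y₁ y₃ γκ e₁ e₂ l₃ l₃′ l₁ l₁′ vertex

    Point : Set c
    Point = Maybe (Carrier × Carrier)

    data _∼_ : Point → Point → Set (c ⊔ ℓ) where
      O∼O : nothing ∼ nothing
      aff : ∀ {x y x′ y′} → x ≈ x′ → y ≈ y′ → just (x , y) ∼ just (x′ , y′)

    infix 4 _∼_

    ∼-refl : ∀ {P} → P ∼ P
    ∼-refl {nothing} = O∼O
    ∼-refl {just _}  = aff refl refl

    ∼-sym : ∀ {P Q} → P ∼ Q → Q ∼ P
    ∼-sym O∼O       = O∼O
    ∼-sym (aff p q) = aff (sym p) (sym q)

    ∼-trans : ∀ {P Q R} → P ∼ Q → Q ∼ R → P ∼ R
    ∼-trans O∼O       O∼O         = O∼O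
    ∼-trans (aff p q) (aff p′ q′) = aff (trans p p′) (trans q q′)

    On : Point → Set ℓ
    On nothing        = ⊤
    On (just (x , y)) = OnCubic x y

    neg : Point → Point
    neg nothing        = nothing
    neg (just (x , y)) = just (x , - y)

    neg-on : ∀ P → On P → On (neg P)
    neg-on nothing        _  = tt
    neg-on (just (x , y)) on = trans (lincomb 1 (λ y → ⊢ :- y :* (:- y) := y :* y) y) on

    neg-involutive : ∀ P → neg (neg P) ∼ P
    neg-involutive nothing        = O∼O
    neg-involutive (just (x , y)) = aff refl (lincomb 1 (λ y → ⊢ :- (:- y) := y) y)

    neg-cong : ∀ {P Q} → P ∼ Q → neg P ∼ neg Q
    neg-cong O∼O       = O∼O
    neg-cong (aff p q) = aff p (-‿cong q)

    neg-flip : ∀ {P Q} → P ∼ neg Q → Q ∼ neg P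
    neg-flip {Q = Q} p = ∼-sym (∼-trans (neg-cong p) (neg-involutive Q))

    -- P + Q + R = O.
    data Sum₀ : Point → Point → Point → Set (c ⊔ ℓ) where
      on-line : ∀ {m n x₁ y₁ x₂ y₂ x₃ y₃} → Line m n x₁ y₁ x₂ y₂ x₃ y₃ →
                Sum₀ (just (x₁ , y₁)) (just (x₂ , y₂)) (just (x₃ , y₃))
      O₁      : ∀ {Q R} → Q ∼ neg R → Sum₀ nothing Q R
      O₂      : ∀ {P R} → P ∼ neg R → Sum₀ P nothing R
      O₃      : ∀ {P Q} → P ∼ neg Q → Sum₀ P Q nothing

    swap₁₂ : ∀ {P Q R} → Sum₀ P Q R → Sum₀ Q P R
    swap₁₂ (on-line l) = on-line (line-swap₁₂ l)
    swap₁₂ (O₁ p)      = O₂ p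
    swap₁₂ (O₂ p)      = O₁ p
    swap₁₂ (O₃ p)      = O₃ (neg-flip p)

    swap₂₃ : ∀ {P Q R} → Sum₀ P Q R → Sum₀ P R Q
    swap₂₃ (on-line l) = on-line (line-swap₂₃ l)
    swap₂₃ (O₁ p)      = O₁ (neg-flip p)
    swap₂₃ (O₂ p)      = O₃ p
    swap₂₃ (O₃ p)      = O₂ p

    Sum₀-neg : ∀ {P Q R} → Sum₀ P Q R → Sum₀ (neg P) (neg Q) (neg R)
    Sum₀-neg (on-line l) = on-line (line-neg l)
    Sum₀-neg (O₁ p)      = O₁ (neg-cong p)
    Sum₀-neg (O₂ p)      = O₂ (neg-cong p)
    Sum₀-neg (O₃ p)      = O₃ (neg-cong p)

    cong₁ : ∀ {P P′ Q R} → P ∼ P′ → Sum₀ P Q R → Sum₀ P′ Q R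
    cong₁ {just (x , y)} {just (x′ , y′)} (aff p q) (on-line {m} {n} {_} {_} {x₂} {y₂} {x₃} {y₃}
        (line l₁ l₂ l₃ e₁ e₂ e₃)) = on-line (line
      (lincomb 6 (λ m n x z y t → one ∙ y := m :* x :+ n ⇒ m ∙ x := z ⇒ (:- one) ∙ y := t ⇒
          ⊢ t := m :* z :+ n) m n x x′ y y′ l₁ p q) l₂ l₃
      (trans (+-congʳ (+-congʳ (sym p))) e₁)
      (trans (+-congʳ (+-cong (*-congʳ (sym p)) (*-congʳ (sym p)))) e₂)
      (trans (*-congʳ (*-congʳ (sym p))) e₃))
    cong₁ O∼O s      = s
    cong₁ p   (O₂ q) = O₂ (∼-trans (∼-sym p) q)
    cong₁ p   (O₃ q) = O₃ (∼-trans (∼-sym p) q)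

    cong₂ : ∀ {P Q Q′ R} → Q ∼ Q′ → Sum₀ P Q R → Sum₀ P Q′ R
    cong₂ p = swap₁₂ ∘ cong₁ p ∘ swap₁₂

    cong₃ : ∀ {P Q R R′} → R ∼ R′ → Sum₀ P Q R → Sum₀ P Q R′
    cong₃ p = swap₂₃ ∘ cong₂ p ∘ swap₂₃

    third-on : ∀ {P Q R} → On P → On Q → Sum₀ P Q R → On R
    third-on onP onQ (on-line l) = line-on (line-swap₁₂ (line-swap₂₃ l))
    third-on {_} {Q} onP onQ (O₁ {_} {nothing} p) = tt
    third-on {_} {just (x , y)} {just (x′ , y′)} onP onQ (O₁ (aff p q)) =
      (lincomb 6 (λ x y z t A B → (x :^ 2 :+ x :* z :+ z :^ 2 :+ A) ∙ x := z ⇒ (:- y :+ t) ∙ y := :- t ⇒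
          one ∙ y :* y := x :* x :* x :+ A :* x :+ B ⇒ ⊢ t :* t
          := z :* z :* z :+ A :* z :+ B) x y x′ y′ A B) p q onQ
    third-on {_} {_} {nothing} onP onQ (O₂ p) = tt
    third-on {just (x , y)} {_} {just (x′ , y′)} onP onQ (O₂ (aff p q)) =
      (lincomb 6 (λ x y z t A B → (x :^ 2 :+ x :* z :+ z :^ 2 :+ A) ∙ x := z ⇒ (:- y :+ t) ∙ y := :- t ⇒
          one ∙ y :* y := x :* x :* x :+ A :* x :+ B ⇒ ⊢ t :* t
          := z :* z :* z :+ A :* z :+ B) x y x′ y′ A B) p q onP
    third-on onP onQ (O₃ p) = tt

    opposite⇒∼ : ∀ {x₁ y₁ x₂ y₂} → Opposite x₁ y₁ x₂ y₂ → just (x₁ , y₁) ∼ neg (just (x₂ , y₂))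
    opposite⇒∼ {y₁ = y₁} {_} {y₂} (p , q) = aff p (lincomb 2 (λ a b → one ∙ a :+ b := # 0 ⇒ ⊢ a := :- b) y₁ y₂ q)

    ∼⇒opposite : ∀ {x₁ y₁ x₂ y₂} → just (x₁ , y₁) ∼ neg (just (x₂ , y₂)) → Opposite x₁ y₁ x₂ y₂
    ∼⇒opposite {y₁ = y₁} {_} {y₂} (aff p q) = p , (lincomb 2 (λ a b → one ∙ a := :- b ⇒ ⊢ a :+ b := # 0) y₁ y₂) q

    with-third-on : ∀ {P Q R} → On P → On Q → Sum₀ P Q R → ∃ λ R → On R × Sum₀ P Q R
    with-third-on onP onQ Σ₀ = _ , third-on onP onQ Σ₀ , Σ₀

    abstract
      third : ∀ P Q → On P → On Q → ∃ λ R → On R × Sum₀ P Q R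
      third nothing          Q                onP onQ = neg Q , neg-on Q onQ , O₁ (∼-sym (neg-involutive Q))
      third (just P)         nothing          onP onQ = neg (just P) , neg-on (just P) onP
          , O₂ (∼-sym (neg-involutive (just P)))
      third (just (x₁ , y₁)) (just (x₂ , y₂)) onP onQ with opposite? x₁ y₁ x₂ y₂
      ... | yes opp  = nothing , tt , O₃ (opposite⇒∼ opp)
      ... | no  ¬opp with m , s ← slope-exists onP onQ ¬opp = with-third-on onP onQ (on-line (slope-line onP s))

    -- A slope satisfying both conditions of `Slope` is determined by two points that are not
    -- opposite, even when they coincide; a line with a slope never joins opposite points.
    third-unique : ∀ {P Q R R′} → Sum₀ P Q R → Sum₀ P Q R′ → R ∼ R′
    third-unique (on-line {m} {n} {x₁} {y₁} {x₂} {y₂} {x₃} {y₃} l)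
        (on-line {m′} {n′} {x₃ = x₃′} {y₃ = y₃′} l′) = aff x₃≈x₃′ y₃≈y₃′
      where
      m≈m′ : m ≈ m′
      m≈m′ = slope-unique (slope⇒¬opposite (line-on l) (line-slope l)) (line-slope l) (line-slope l′)
      x₃≈x₃′ : x₃ ≈ x₃′
      x₃≈x₃′ = lincomb 6 (λ m k a b x z → (m :+ k) ∙ m := k ⇒ one ∙ a :+ b :+ x := m :* m ⇒
          (:- one) ∙ a :+ b :+ z := k :* k ⇒ ⊢ x := z) m m′ x₁ x₂ x₃ x₃′ m≈m′ (Line.e₁ l) (Line.e₁ l′)
      y₃≈y₃′ : y₃ ≈ y₃′
      y₃≈y₃′ = lincomb 10 (λ m k n l a b x z y t → (:- a :+ x) ∙ m := k ⇒ k ∙ x := z ⇒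
          (:- one) ∙ b := m :* a :+ n ⇒ one ∙ b := k :* a :+ l ⇒ one ∙ y := m :* x :+ n ⇒
          (:- one) ∙ t := k :* z :+ l ⇒ ⊢ y := t) m m′ n n′ x₁ y₁ x₃ x₃′ y₃ y₃′
                 m≈m′ x₃≈x₃′ (Line.l₁ l) (Line.l₁ l′) (Line.l₃ l) (Line.l₃ l′)
    third-unique (on-line l) (O₃ p)   = ⊥-elim (slope⇒¬opposite (line-on l) (line-slope l) (∼⇒opposite p))
    third-unique (O₃ p) (on-line l)   = ⊥-elim (slope⇒¬opposite (line-on l) (line-slope l) (∼⇒opposite p))
    third-unique (O₁ p)   (O₁ q)      = ∼-trans (neg-flip p) (∼-sym (neg-flip q))
    third-unique (O₁ p)   (O₂ q)      = ∼-trans (neg-flip p) (∼-sym (neg-flip q))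
    third-unique (O₁ p)   (O₃ q)      = ∼-trans (neg-flip p) (neg-cong (neg-flip q))
    third-unique (O₂ p)   (O₁ q)      = ∼-trans (neg-flip p) (∼-sym (neg-flip q))
    third-unique (O₂ p)   (O₂ q)      = ∼-trans (neg-flip p) (∼-sym (neg-flip q))
    third-unique (O₂ p)   (O₃ q)      = ∼-trans (neg-flip p) (neg-cong q)
    third-unique (O₃ p)   (O₁ q)      = ∼-sym (∼-trans (neg-flip q) (neg-cong (neg-flip p)))
    third-unique (O₃ p)   (O₂ q)      = ∼-sym (∼-trans (neg-flip q) (neg-cong p))
    third-unique (O₃ p)   (O₃ q)      = O∼O

    -- The hypotheses say that P₁ + P₂ + P₃ + P₄ = O, which here means that the four points lie on
    -- one parabola. This is symmetric in the points, so the third points of the lines P₁P₃ and P₂P₄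
    -- are again opposite. Their slopes r and s satisfy r + s = m + m′.
    exchange-generic : ∀ {m n m′ n′ x₁ y₁ x₂ y₂ x₃ y₃ x₄ y₄ u v U} → m + m′ ≉ 0# →
      Line m n x₁ y₁ x₂ y₂ u v → Line m′ n′ x₃ y₃ x₄ y₄ u (- v) →
      Sum₀ (just (x₁ , y₁)) (just (x₃ , y₃)) U → Sum₀ (neg U) (just (x₂ , y₂)) (just (x₄ , y₄))
    exchange-generic {m} {n} {m′} {n′} {x₁} {y₁} {x₂} {y₂} {x₃} {y₃} {x₄} {y₄} {u} {v} κ≉0 L L′ Σ₀
      with γ , κγ ← inverse (m + m′) κ≉0 =
      cong₁ (∼-trans (∼-sym (neg-involutive _)) (neg-cong (∼-trans -U₁∼U₀ U₀∼U))) (swap₁₂ (swap₂₃ (on-line L₂)))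
      where
      open Line L
      open Line L′ using () renaming (l₁ to l₁′; l₂ to l₂′; l₃ to l₃′; e₁ to e₁′; e₂ to e₂′)
      γκ : γ * (m + m′) ≈ 1#
      γκ = trans (*-comm _ _) κγ
      r s : Carrier
      r = m + γ * (x₃ - x₂)
      s = m + γ * (x₄ - x₁)
      L₁ = slope-line (line-on L) (parabola-slope γκ L L′)
      L₂ = slope-line (line-on (line-swap₁₂ L)) (parabola-slope γκ (line-swap₁₂ L) (line-swap₁₂ L′))
      r+s≈κ : m + m′ ≈ r + s
      r+s≈κ = lincomb 8 (λ γ m k a b c d u → (m :- k) ∙ γ :* (m :+ k) := one ⇒ γ ∙ a :+ b :+ u := m :* m ⇒
          (:- γ) ∙ c :+ d :+ u := k :* k ⇒ ⊢ m :+ k := m :+ γ :* (c :- b) :+ (m :+ γ :* (d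
          :- a))) γ m m′ x₁ x₂ x₃ x₄ u γκ e₁ e₁′
      X Y X′ Y′ : Carrier
      X  = r * r - x₁ - x₃
      Y  = r * X + (y₁ - r * x₁)
      X′ = s * s - x₂ - x₄
      Y′ = s * X′ + (y₂ - s * x₂)
      X′≈X : X′ ≈ X
      X′≈X = lincomb 10 (λ γ m k a b c d u s r → (# 2 :* b :- # 2 :* c) ∙ γ :* (m :+ k) := one ⇒
          one ∙ a :+ b :+ u := m :* m ⇒ (:- one) ∙ c :+ d :+ u := k :* k ⇒
          (:- m :- k :- s :+ r) ∙ m :+ k := r :+ s ⇒ (:- (# 2 :* m) :- # 2 :* k) ∙ r := m :+ γ :* (c :- b) ⇒
          ⊢ s :* s :- b :- d := r :* r :- a :- c) γ m m′ x₁ x₂ x₃ x₄ u s r γκ e₁ e₁′ r+s≈κ refl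
      Y′+Y≈0 : Y′ + Y ≈ 0#
      Y′+Y≈0 = xy≈0⇒y≈0 2≉0 (lincomb 18 (λ γ m n k l a b c d u v y z w r s X X′
          → (:- (# 4 :* m :* b) :+ # 4 :* m :* c :+ # 4 :* k :* b :- # 4 :* k :* c :- # 6 :* b :* r
          :- # 4 :* b :* s :- # 2 :* c :* s :+ # 6 :* u :* r :+ # 6 :* u :* s :+ # 6 :* z
          :+ # 6 :* w) ∙ γ :* (m :+ k) := one ⇒ (:- (# 4 :* γ :* b) :+ # 4 :* γ :* c :- # 4 :* k :- # 2 :* r
          :+ # 2 :* s) ∙ a :+ b :+ u := m :* m ⇒ (# 6 :* γ :* r :+ # 6 :* γ :* s :- # 8) ∙ v := m :* u :+ n ⇒
          (# 6 :* γ :* r :+ # 6 :* γ :* s :- # 8) ∙ :- v := k :* u :+ l ⇒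
          (:- (# 6 :* γ :* r) :- # 6 :* γ :* s :+ # 8) ∙ z := m :* b :+ n ⇒
          (:- (# 6 :* γ :* r) :- # 6 :* γ :* s :+ # 8) ∙ w := k :* c :+ l ⇒
          (:- (# 2)) ∙ (m :+ γ :* (c :- b)) :* (a :- c) := y :- w ⇒
          (# 4 :* γ :* b :- # 4 :* γ :* c :- # 4 :* m :+ # 4 :* r) ∙ c :+ d :+ u := k :* k ⇒
          (:- (# 6 :* γ :* z) :- # 6 :* γ :* w :- # 4 :* m :* k :- # 2 :* m :* r :+ # 4 :* k :* r
          :- # 2 :* r :^ 2 :+ # 4 :* a :+ # 8 :* b :+ # 4 :* c :- # 4 :* u) ∙ m :+ k := r :+ s ⇒
          (:- (# 2 :* m :* s) :+ # 6 :* k :* r :+ # 4 :* k :* s :+ # 2 :* a :+ # 4 :* b :- # 2 :* c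
          :- # 4 :* d) ∙ r := m :+ γ :* (c :- b) ⇒ (# 2 :* r :+ # 2 :* s) ∙ X := r :* r :- a :- c ⇒
          (# 2 :* s) ∙ X′ := X ⇒ ⊢ # 2 :* (s :* X′ :+ (z :- s :* b) :+ (r :* X :+ (y :- r :* a)))
          := # 0) γ m n m′ n′ x₁ x₂ x₃ x₄ u v y₁ y₂ y₃ r s X X′
        γκ e₁ l₃ l₃′ l₂ l₁′ (Slope.chord (parabola-slope γκ L L′)) e₁′ r+s≈κ refl refl X′≈X)
      -U₁∼U₀ : neg (just (X′ , Y′)) ∼ just (X , Y)
      -U₁∼U₀ = ∼-sym (opposite⇒∼ (sym X′≈X , trans (+-comm _ _) Y′+Y≈0))
      U₀∼U = third-unique (on-line L₁) Σ₀

    -- No parabola exists now: the second line passes through the opposite of (u, v) with slope -m,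
    -- so it is the reflection of the first. Hence P₃ is the opposite of P₁ or of P₂, and P₄ that of
    -- the other.
    exchange-degenerate : ∀ {m n m′ n′ x₁ y₁ x₂ y₂ x₃ y₃ x₄ y₄ u v U} → m + m′ ≈ 0# →
      Line m n x₁ y₁ x₂ y₂ u v → Line m′ n′ x₃ y₃ x₄ y₄ u (- v) →
      Sum₀ (just (x₁ , y₁)) (just (x₃ , y₃)) U → Sum₀ (neg U) (just (x₂ , y₂)) (just (x₄ , y₄))
    exchange-degenerate {m} {n} {m′} {n′} {x₁} {y₁} {x₂} {y₂} {x₃} {y₃} {x₄} {y₄} {u} {v} {U} κ≈0 L L′ Σ₀ =
      [ case₁ , case₂ ]′ (xy≈0⇒x≈0⊎y≈0 product≈0)
      where
      open Line L
      open Line L′ using () renaming (l₁ to l₁′; l₂ to l₂′; l₃ to l₃′; e₁ to e₁′; e₂ to e₂′)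
      product≈0 : (x₃ - x₁) * (x₃ - x₂) ≈ 0#
      product≈0 = lincomb 11 (λ m n k l a b c d u v A → (:- (m :* c) :- m :* u :+ k :* c :- k :* u
          :- # 2 :* n) ∙ m :+ k := # 0 ⇒ (:- c :- u) ∙ a :+ b :+ u := m :* m ⇒
          one ∙ a :* b :+ a :* u :+ b :* u := A :- # 2 :* m :* n ⇒ (c :+ u) ∙ c :+ d :+ u := k :* k ⇒
          (:- one) ∙ c :* d :+ c :* u :+ d :* u := A :- # 2 :* k :* l ⇒ (:- (# 2 :* k)) ∙ v := m :* u :+ n ⇒
          (:- (# 2 :* k)) ∙ :- v := k :* u :+ l ⇒ ⊢ (c :- a) :* (c :- b)
          := # 0) m n m′ n′ x₁ x₂ x₃ x₄ u v A κ≈0 e₁ e₂ e₁′ e₂′ l₃ l₃′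
      case₁ : x₃ - x₁ ≈ 0# → Sum₀ (neg U) (just (x₂ , y₂)) (just (x₄ , y₄))
      case₁ p = cong₁ (neg-cong (third-unique (O₃ (opposite⇒∼
          ( (lincomb 2 (λ a c → (:- one) ∙ c :- a := # 0 ⇒ ⊢ a := c) x₁ x₃) p
          , (lincomb 10 (λ m n k l a c u v y z → (:- m) ∙ c :- a := # 0 ⇒ (c :- u) ∙ m :+ k := # 0 ⇒
              (:- one) ∙ v := m :* u :+ n ⇒ (:- one) ∙ :- v := k :* u :+ l ⇒ one ∙ y := m :* a :+ n ⇒
              one ∙ z := k :* c :+ l ⇒ ⊢ y :+ z := # 0) m n m′ n′ x₁ x₃ u v y₁ y₃)
              p κ≈0 l₃ l₃′ l₁ l₁′))) Σ₀))
        (O₁ (opposite⇒∼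
          ( (lincomb 7 (λ m k a b c d u → one ∙ c :- a := # 0 ⇒ (m :- k) ∙ m :+ k := # 0 ⇒
              one ∙ a :+ b :+ u := m :* m ⇒ (:- one) ∙ c :+ d :+ u := k :* k ⇒
              ⊢ b := d) m m′ x₁ x₂ x₃ x₄ u) p κ≈0 e₁ e₁′
          , (lincomb 12 (λ m n k l a b c d u v y z → (:- k) ∙ c :- a := # 0 ⇒
              (:- (m :* k) :+ k :^ 2 :+ b :- u) ∙ m :+ k := # 0 ⇒ (:- k) ∙ a :+ b :+ u := m :* m ⇒
              k ∙ c :+ d :+ u := k :* k ⇒ (:- one) ∙ v := m :* u :+ n ⇒ (:- one) ∙ :- v := k :* u :+ l ⇒
              one ∙ y := m :* b :+ n ⇒ one ∙ z := k :* d :+ l ⇒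
              ⊢ y :+ z := # 0) m n m′ n′ x₁ x₂ x₃ x₄ u v y₂ y₄)
              p κ≈0 e₁ e₁′ l₃ l₃′ l₂ l₂′)))
      case₂ : x₃ - x₂ ≈ 0# → Sum₀ (neg U) (just (x₂ , y₂)) (just (x₄ , y₄))
      case₂ p = cong₂ (∼-trans (neg-cong R∼-Q) (neg-involutive _)) (cong₃ (∼-sym S∼-P) (swap₁₂ (swap₂₃ (swap₁₂
          (swap₂₃ (Sum₀-neg (swap₂₃ Σ₀)))))))
        where
        R∼-Q : just (x₃ , y₃) ∼ neg (just (x₂ , y₂))
        R∼-Q = opposite⇒∼
          ( (lincomb 2 (λ a c → one ∙ c :- a := # 0 ⇒ ⊢ c := a) x₂ x₃) p
          , (lincomb 10 (λ m n k l a c u v y z → (:- m) ∙ c :- a := # 0 ⇒ (c :- u) ∙ m :+ k := # 0 ⇒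
              (:- one) ∙ v := m :* u :+ n ⇒ (:- one) ∙ :- v := k :* u :+ l ⇒ one ∙ y := m :* a :+ n ⇒
              one ∙ z := k :* c :+ l ⇒ ⊢ z :+ y := # 0) m n m′ n′ x₂ x₃ u v y₂ y₃)
              p κ≈0 l₃ l₃′ l₂ l₁′)
        S∼-P : just (x₄ , y₄) ∼ neg (just (x₁ , y₁))
        S∼-P = opposite⇒∼
          ( (lincomb 7 (λ m k a b c d u → (:- one) ∙ c :- b := # 0 ⇒ (:- m :+ k) ∙ m :+ k := # 0 ⇒
              (:- one) ∙ a :+ b :+ u := m :* m ⇒ one ∙ c :+ d :+ u := k :* k ⇒
              ⊢ d := a) m m′ x₁ x₂ x₃ x₄ u) p κ≈0 e₁ e₁′
          , (lincomb 12 (λ m n k l a b c d u v y z → (:- k) ∙ c :- b := # 0 ⇒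
              (:- (m :* k) :+ k :^ 2 :+ a :- u) ∙ m :+ k := # 0 ⇒ (:- k) ∙ a :+ b :+ u := m :* m ⇒
              k ∙ c :+ d :+ u := k :* k ⇒ (:- one) ∙ v := m :* u :+ n ⇒ (:- one) ∙ :- v := k :* u :+ l ⇒
              one ∙ y := m :* a :+ n ⇒ one ∙ z := k :* d :+ l ⇒
              ⊢ z :+ y := # 0) m n m′ n′ x₁ x₂ x₃ x₄ u v y₁ y₄)
              p κ≈0 e₁ e₁′ l₃ l₃′ l₁ l₂′)

    -- Associativity in the form (P + Q) + R = (P + R) + Q.
    exchange : ∀ {P Q R S T U} → Sum₀ P Q T → Sum₀ (neg T) R S → Sum₀ P R U → Sum₀ (neg U) Q S
    exchange (on-line {m} L) (on-line {m′} L′) Σ₀ with (m + m′) ≟ 0#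
    ... | yes κ≈0 = exchange-degenerate κ≈0 L (line-swap₂₃ (line-swap₁₂ L′)) Σ₀
    ... | no  κ≉0 = exchange-generic κ≉0 L (line-swap₂₃ (line-swap₁₂ L′)) Σ₀
    exchange {P} (on-line L) (O₂ p) Σ₀ =
      cong₁ (∼-trans (∼-sym (neg-involutive P)) (neg-cong (third-unique (O₂ (∼-sym (neg-involutive P))) Σ₀)))
        (cong₃ (∼-trans (∼-sym (neg-involutive _)) (∼-trans (neg-cong p) (neg-involutive _))) (on-line L))
    exchange (on-line L) (O₃ p) Σ₀ =
      O₃ (neg-cong (third-unique Σ₀ (cong₂ (∼-trans (∼-sym (neg-involutive _)) (∼-sym (neg-flip p))) (swap₂₃
          (on-line L)))))
    exchange {R = R} (O₁ p) Σ′ Σ₀ =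
      cong₁ (neg-flip (∼-sym (third-unique (O₁ (∼-sym (neg-involutive R))) Σ₀))) (swap₁₂ (cong₁ (∼-sym p) Σ′))
    exchange (O₂ p) Σ′ Σ₀ = O₂ (neg-cong (third-unique Σ₀ (cong₁ (∼-sym p) Σ′)))
    exchange {P} {Q} {R} (O₃ p) Σ′ Σ₀ =
      cong₂ (∼-sym (neg-flip p)) (cong₃ (third-unique (O₁ (∼-sym (neg-involutive R))) Σ′) (Sum₀-neg (swap₁₂
          (swap₂₃ Σ₀))))

    _⊞_ : Σ Point On → Σ Point On → Σ Point On
    (P , onP) ⊞ (Q , onQ) = let R , onR , _ = third P Q onP onQ in neg R , neg-on R onR

    sum₀ : ∀ {P Q} → Sum₀ (proj₁ P) (proj₁ Q) (neg (proj₁ (P ⊞ Q)))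
    sum₀ {P , onP} {Q , onQ} = let R , _ , s = third P Q onP onQ in cong₃ (∼-sym (neg-involutive R)) s

    sum-unique : ∀ P Q {R} → Sum₀ (proj₁ P) (proj₁ Q) (neg R) → proj₁ (P ⊞ Q) ∼ R
    sum-unique P Q {R} s = ∼-trans (∼-sym (neg-involutive _))
      (∼-trans (neg-cong (third-unique (sum₀ {P} {Q}) s)) (neg-involutive R))

    group : AbelianGroup (c ⊔ ℓ) (c ⊔ ℓ)
    group = record
      { Carrier = Σ Point On
      ; _≈_ = λ P Q → proj₁ P ∼ proj₁ Q
      ; _∙_ = _⊞_
      ; ε = nothing , tt
      ; _⁻¹ = λ { (P , onP) → neg P , neg-on P onP }
      ; isAbelianGroup = record
        { isGroup = record
          { isMonoid = record
            { isSemigroup = record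
              { isMagma = record
                { isEquivalence = record { refl = ∼-refl ; sym = ∼-sym ; trans = ∼-trans }
                ; ∙-cong = λ {P} {P′} {Q} {Q′} p q →
                    sum-unique P Q (cong₁ (∼-sym p) (cong₂ (∼-sym q) (sum₀ {P′} {Q′})))
                }
              -- `exchange` in the form (Q + R) + P = (Q + P) + R, combined with commutativity.
              ; assoc = λ P Q R →
                  sum-unique (P ⊞ Q) R
                    (cong₁ (neg-involutive (proj₁ (P ⊞ Q)))
                      (exchange (sum₀ {Q} {R}) (cong₁ (∼-sym (neg-involutive _)) (swap₁₂ (sum₀ {P} {Q ⊞ R})))
                        (swap₁₂ (sum₀ {P} {Q}))))
              }
            ; identity = (λ { Q → sum-unique (nothing , tt) Q (O₁ (∼-sym (neg-involutive _))) })
                       , (λ { P → sum-unique P (nothing , tt) (O₂ (∼-sym (neg-involutive _))) })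
            }
          ; inverse = (λ P → sum-unique (neg (proj₁ P) , neg-on (proj₁ P) (proj₂ P)) P (O₃ ∼-refl))
                    , (λ P → sum-unique P (neg (proj₁ P) , neg-on (proj₁ P) (proj₂ P)) (O₃ (∼-sym
                        (neg-involutive _))))
          ; ⁻¹-cong = neg-cong
          }
        ; comm = λ P Q → sum-unique P Q (swap₁₂ (sum₀ {Q} {P}))
        }
      }

-- Divisibility at a place, and lines in the coordinates t = x/y, s = 1/y.

module KernelOfReduction {c ℓ} (K : AlgClosureℚ c ℓ) where
  open AlgClosureℚ K
  open LinearCombinations commRing
  open FieldProperties K

  module Divides (W : Place K) where
    open Place W

    M-coprime : ∀ {a b} → Coprime a b → M (fromℕ a) → M (fromℕ b) → ⊥
    M-coprime {a} {b} coprime Ma Mb = bezout (coprime-Bézout coprime)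
      where
      certificate : ∀ x y {a b} → M (fromℕ a) → M (fromℕ b) → 1 ℕ.+ y ℕ.* b ≡ x ℕ.* a → ⊥
      certificate x y {a} {b} Ma Mb eq = 1∉M (M-resp
        (lincomb 4 (λ x y a b → (:- one) ∙ one :+ y :* b := x :* a ⇒
            ⊢ x :* a :- y :* b := one) (fromℕ x) (fromℕ y) (fromℕ a) (fromℕ b) (trans (+-congˡ (sym
            (fromℕ-* y b))) (trans (reflexive (≡.cong fromℕ eq)) (fromℕ-* x a))))
        (M-- (M-* (O-fromℕ x) Ma) (M-* (O-fromℕ y) Mb)))
      bezout : Bézout.Identity 1 a b → ⊥
      bezout (Bézout.+- x y eq) = certificate x y Ma Mb eq
      bezout (Bézout.-+ x y eq) = certificate y x Mb Ma eq

    infix 4 _∣_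
    _∣_ : Carrier → Carrier → Set (c ⊔ ℓ)
    π ∣ x = ∃ λ a → O a × x ≈ π * a

    module _ {π : Carrier} where
      ∣-resp : ∀ {x y} → x ≈ y → π ∣ x → π ∣ y
      ∣-resp x≈y (a , Oa , e) = a , Oa , trans (sym x≈y) e

      ∣-0 : π ∣ 0#
      ∣-0 = 0# , O-0 , sym (zeroʳ π)

      ∣-+ : ∀ {x y} → π ∣ x → π ∣ y → π ∣ x + y
      ∣-+ {x} {y} (a , Oa , e) (b , Ob , f) = a + b , O-+ Oa Ob ,
        (lincomb 5 (λ x y π a b → one ∙ x := π :* a ⇒ one ∙ y := π :* b ⇒ ⊢ x :+ y := π :* (a :+ b)) x y π a b) e f

      ∣-* : ∀ {x y} → O x → π ∣ y → π ∣ x * y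
      ∣-* {x} {y} Ox (a , Oa , e) = x * a , O-* Ox Oa ,
          (lincomb 4 (λ x y π a → x ∙ y := π :* a ⇒ ⊢ x :* y := π :* (x :* a)) x y π a) e

      ∣-neg : ∀ {x} → π ∣ x → π ∣ - x
      ∣-neg {x} (a , Oa , e) = - a , O-neg Oa ,
          (lincomb 3 (λ x π a → (:- one) ∙ x := π :* a ⇒ ⊢ :- x := π :* (:- a)) x π a) e

      ∣-- : ∀ {x y} → π ∣ x → π ∣ y → π ∣ x - y
      ∣-- p q = ∣-+ p (∣-neg q)

      ∣-self : π ∣ π
      ∣-self = 1# , O-1 , sym (*-identityʳ π)

      ∣⇒M : ∀ {x} → M π → π ∣ x → M x
      ∣⇒M {x} Mπ (a , Oa , e) = M-resp
          (lincomb 3 (λ x π a → (:- one) ∙ x := π :* a ⇒ ⊢ a :* π := x) x π a e) (M-* Oa Mπ)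

    ∣-** : ∀ {π ρ x y} → π ∣ x → ρ ∣ y → π * ρ ∣ x * y
    ∣-** {π} {ρ} {x} {y} (a , Oa , e) (b , Ob , f) = a * b , O-* Oa Ob ,
      (lincomb 6 (λ x y π ρ a b → (ρ :* b) ∙ x := π :* a ⇒ x ∙ y := ρ :* b ⇒
          ⊢ x :* y := π :* ρ :* (a :* b)) x y π ρ a b) e f

    ∣-weaken : ∀ {π ρ x} → O ρ → π * ρ ∣ x → π ∣ x
    ∣-weaken {π} {ρ} {x} Oρ (a , Oa , e) = ρ * a , O-* Oρ Oa ,
        (lincomb 4 (λ x π ρ a → one ∙ x := π :* ρ :* a ⇒ ⊢ x := π :* (ρ :* a)) x π ρ a) e

  -- Subtracting the two equations s = t³ + A t s² + B s³ and collecting multiples of s₁ - s₂ and of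
  -- t₁ - t₂ gives the slope as a quotient whose denominator is close to 1 near O.
  chord-slope : ∀ t₁ s₁ t₂ s₂ w A B →
    s₁ ≈ t₁ * t₁ * t₁ + A * t₁ * s₁ * s₁ + B * s₁ * s₁ * s₁ →
    s₂ ≈ t₂ * t₂ * t₂ + A * t₂ * s₂ * s₂ + B * s₂ * s₂ * s₂ →
    (1# - A * t₁ * (s₁ + s₂) - B * (s₁ * s₁ + s₁ * s₂ + s₂ * s₂)) * w ≈ 1# →
    s₁ - s₂ ≈ (t₁ * t₁ + t₁ * t₂ + t₂ * t₂ + A * s₂ * s₂) * w * (t₁ - t₂)
  chord-slope a b c d w A B =
    (lincomb 7 (λ a b c d w A B → w ∙ b := a :* a :* a :+ A :* a :* b :* b :+ B :* b :* b :* b ⇒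
        (:- w) ∙ d := c :* c :* c :+ A :* c :* d :* d :+ B :* d :* d :* d ⇒
        (:- (b :- d)) ∙ (one :- A :* a :* (b :+ d) :- B :* (b :* b :+ b :* d :+ d :* d)) :* w := one ⇒
        ⊢ b :- d := (a :* a :+ a :* c :+ c :* c :+ A :* d :* d) :* w :* (a :- c)) a b c d w A B)

  -- The line y = m x + n is m t + n s = 1 in the new coordinates, of slope -m/n. That this equals
  -- the quotient of `chord-slope` is stated without denominators and deduced from the root
  -- relations, so that tangents are included.
  line-chord : ∀ x₁ y₁ t₁ s₁ x₂ y₂ t₂ s₂ x₃ m n A B →
    y₁ ≈ m * x₁ + n → y₂ ≈ m * x₂ + n → x₁ + x₂ + x₃ ≈ m * m →
    x₁ * x₂ + x₁ * x₃ + x₂ * x₃ ≈ A - fromℕ 2 * m * n → x₁ * x₂ * x₃ ≈ n * n - B →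
    s₁ * y₁ ≈ 1# → x₁ ≈ t₁ * y₁ → s₂ * y₂ ≈ 1# → x₂ ≈ t₂ * y₂ →
    (n * (t₁ * t₁ + t₁ * t₂ + t₂ * t₂ + A * s₂ * s₂) +
      m * (1# - A * t₁ * (s₁ + s₂) - B * (s₁ * s₁ + s₁ * s₂ + s₂ * s₂))) * (y₁ * y₁ * y₂ * y₂) ≈ 0#
  line-chord a y t s b w q p z m n A B l₁ l₂ e₁ e₂ e₃ f₁ g₁ f₂ g₂ =
    (lincomb 12 (λ a b m n A B y w s t p q → (m :* A :* y :* w :^ 2 :* s :+ m :* A :* y :* w :^ 2 :* p
        :- n :* y :* w :^ 2 :* t :- n :* y :* w :^ 2 :* q :- a :* n :* w :^ 2) ∙ a := t :* y ⇒
        (:- (n :* y :^ 2 :* w :* q) :- a :* n :* y :* w :- b :* n :* y :^ 2) ∙ b := q :* w ⇒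
        (:- (m :* B :* y :* w :^ 2 :* s) :- m :* B :* y :* w :^ 2 :* p :- a :* m :* A :* w :^ 2
        :- m :* B :* w :^ 2) ∙ s :* y := one ⇒ (:- (m :* B :* y :^ 2 :* w :* p) :+ n :* A :* y :^ 2 :* w :* p
        :- a :* m :* A :* y :* w :- m :* B :* y :^ 2 :- m :* B :* y :* w :+ n :* A :* y :^ 2) ∙ p :* w := one ⇒
        one ∙ n :* (a :* a :* w :* w :+ a :* b :* y :* w :+ b :* b :* y :* y :+ A :* y :* y)
        :+ m :* (y :* y :* w :* w :- A :* a :* (y :* w :+ w :* w) :- B :* (y :* y :+ y :* w :+ w :* w)) := # 0 ⇒
        ⊢ (n :* (t :* t :+ t :* q :+ q :* q :+ A :* p :* p) :+ m :* (one :- A :* t :* (s :+ p)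
        :- B :* (s :* s :+ s :* p :+ p :* p))) :* (y :* y :* w :* w) := # 0) a b m n A B y w s t p q)
      g₁ g₂ f₁ f₂
      (lincomb 9 (λ a b z m n A B y w → (a :* n :* w :^ 2 :+ b :* n :* y :^ 2 :+ b :* n :* y :* w
          :- b :* y :^ 2 :* w) ∙ a :+ b :+ z := m :* m ⇒
          (b :* m :* y :* w :- n :* y :^ 2 :- n :* w :^ 2 :+ y :^ 2 :* w) ∙ a :* b :+ a :* z :+ b :* z
          := A :- # 2 :* m :* n ⇒ (:- (m :* y :^ 2) :- m :* y :* w :- m :* w :^ 2) ∙ a :* b :* z
          := n :* n :- B ⇒ (b :^ 2 :* y :* w :- b :* z :* w :^ 2 :- m :* n :* w :^ 2 :+ A :* y :* w
          :+ A :* w :^ 2) ∙ y := m :* a :+ n ⇒ (:- (a :* z :* y :^ 2) :+ b :* z :* y :* w :- m :* n :* y :^ 2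
          :+ m :* n :* y :* w :+ m :* y :^ 2 :* w :- A :* y :* w) ∙ w := m :* b :+ n ⇒
          ⊢ n :* (a :* a :* w :* w :+ a :* b :* y :* w :+ b :* b :* y :* y :+ A :* y :* y)
          :+ m :* (y :* y :* w :* w :- A :* a :* (y :* w :+ w :* w) :- B :* (y :* y :+ y :* w :+ w :* w))
          := # 0) a b z m n A B y w
         e₁ e₂ e₃ l₁ l₂)

  -- The product of the m xᵢ + n is -m³ times x³ + A x + B - (m x + n)² at x = -n/m, where the
  -- square vanishes.
  line-product : ∀ x₁ y₁ x₂ y₂ x₃ y₃ m n A B →
    y₁ ≈ m * x₁ + n → y₂ ≈ m * x₂ + n → y₃ ≈ m * x₃ + n → x₁ + x₂ + x₃ ≈ m * m →
    x₁ * x₂ + x₁ * x₃ + x₂ * x₃ ≈ A - fromℕ 2 * m * n → x₁ * x₂ * x₃ ≈ n * n - B →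
    y₁ * y₂ * y₃ ≈ n * n * n + A * n * m * m - B * m * m * m
  line-product a y b w z u m n A B l₁ l₂ l₃ e₁ e₂ e₃ =
    (lincomb 10 (λ a b z m n A B y w u → (:- (a :* b :* n) :- a :* z :* n :- b :* z :* y :- m :* B
        :+ n :* A) ∙ a :+ b :+ z := m :* m ⇒ (a :* n :+ b :* n :+ z :* n) ∙ a :* b :+ a :* z :+ b :* z
        := A :- # 2 :* m :* n ⇒ (b :* m :+ z :* m :- n :+ y) ∙ a :* b :* z := n :* n :- B ⇒
        (b :^ 2 :* z :+ b :* z :^ 2 :+ b :* m :* n :+ z :* m :* n :+ # 2 :* n :^ 2 :- B) ∙ y := m :* a :+ n ⇒
        (z :* m :* y :+ n :* y) ∙ w := m :* b :+ n ⇒ (y :* w) ∙ u := m :* z :+ n ⇒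
        ⊢ y :* w :* u := n :* n :* n :+ A :* n :* m :* m :- B :* m :* m :* m) a b z m n A B y w u) e₁ e₂ e₃ l₁
        l₂ l₃

  -- The identity of `line-product` differentiated in m with the xᵢ fixed; the square vanishes to
  -- second order and contributes nothing. Divided by y₁y₂y₃, the left side is t₁ + t₂ + t₃.
  line-sum : ∀ x₁ y₁ x₂ y₂ x₃ y₃ m n A B →
    y₁ ≈ m * x₁ + n → y₂ ≈ m * x₂ + n → y₃ ≈ m * x₃ + n → x₁ + x₂ + x₃ ≈ m * m →
    x₁ * x₂ + x₁ * x₃ + x₂ * x₃ ≈ A - fromℕ 2 * m * n → x₁ * x₂ * x₃ ≈ n * n - B →
    x₁ * y₂ * y₃ + x₂ * y₁ * y₃ + x₃ * y₁ * y₂ ≈ fromℕ 2 * m * n * A - fromℕ 3 * m * m * B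
  line-sum a y b w z u m n A B l₁ l₂ l₃ e₁ e₂ e₃ =
    (lincomb 10 (λ a b z m n A B y w u → (b :* u :+ z :* w) ∙ y := m :* a :+ n ⇒
        (a :* u :+ z :* (m :* a :+ n)) ∙ w := m :* b :+ n ⇒
        (a :* (m :* b :+ n) :+ b :* (m :* a :+ n)) ∙ u := m :* z :+ n ⇒ (n :^ 2) ∙ a :+ b :+ z := m :* m ⇒
        (# 2 :* m :* n) ∙ a :* b :+ a :* z :+ b :* z := A :- # 2 :* m :* n ⇒
        (# 3 :* m :^ 2) ∙ a :* b :* z := n :* n :- B ⇒
        ⊢ a :* w :* u :+ b :* y :* u :+ z :* y :* w := # 2 :* m :* n :* A
        :- # 3 :* m :* m :* B) a b z m n A B y w u) l₁ l₂ l₃ e₁ e₂ e₃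

  -- Suppose p = q² b. If q = r p, cancelling p leaves 1 = r b q in M; otherwise p and q are coprime
  -- and both in M. A single factor q would not exclude p = q.
  prime∤square : ∀ (W : Place K) {p q} → Prime p → Place.M W (fromℕ q) → ¬ Divides._∣_ W (fromℕ q * fromℕ q) (fromℕ p)
  prime∤square W {p} {q} p-prime Mq (b , Ob , e) with p ℕ∣.∣? q
  ... | yes (ℕ∣.divides r q≡rp) = 1∉M (M-resp
    (cancelˡ p≉0 (lincomb 4 (λ p q r b → (:- one) ∙ p := q :* q :* b ⇒ (:- (q :* b)) ∙ q := r :* p ⇒
        ⊢ p :* (r :* b :* q) := p :* one) (fromℕ p) (fromℕ q) (fromℕ r) b
       e (trans (reflexive (≡.cong fromℕ q≡rp)) (fromℕ-* r p))))
    (M-* (O-* (O-fromℕ r) Ob) Mq))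
    where
    open Place W
    p≉0 : fromℕ p ≉ 0#
    p≉0 = fromℕ-≉0 p {{prime⇒nonZero p-prime}}
  ... | no p∤q = Divides.M-coprime W {p} {q} coprime
    (M-resp (lincomb 3 (λ p q b → (:- one) ∙ p := q :* q :* b ⇒
        ⊢ b :* q :* q := p) (fromℕ p) (fromℕ q) b e) (M-* (O-* Ob (M⊆O Mq)) Mq)) Mq
    where
    open Place W
    coprime : Coprime p q
    coprime (d∣p , d∣q) with prime⇒irreducible p-prime d∣p
    ... | inj₁ d≡1    = d≡1
    ... | inj₂ ≡.refl = ⊥-elim (p∤q d∣q)

  module Charts (A B : Carrier) (disc≉0 : fromℕ 4 * (A * A * A) + fromℕ 27 * (B * B) ≉ 0#) where
    open GroupLaw.Short K A B disc≉0

    -- t = x/y and s = 1/y.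
    data Chart : Point → Carrier → Carrier → Set (c ⊔ ℓ) where
      chart-O : ∀ {t s} → t ≈ 0# → s ≈ 0# → Chart nothing t s
      chart   : ∀ {x y t s} → s * y ≈ 1# → x ≈ t * y → Chart (just (x , y)) t s

    chart-cong : ∀ {P Q t s} → P ∼ Q → Chart P t s → Chart Q t s
    chart-cong O∼O       ch          = ch
    chart-cong (aff p q) (chart e f) = chart (trans (*-congˡ (sym q)) e) (trans (sym p) (trans f (*-congˡ q)))

    chart-neg : ∀ {P t s} → Chart P t s → Chart (neg P) (- t) (- s)
    chart-neg {t = t} {s} (chart-O e f) = chart-O
        (lincomb 1 (λ t → (:- one) ∙ t := # 0 ⇒ ⊢ :- t := # 0) t e)
        (lincomb 1 (λ s → (:- one) ∙ s := # 0 ⇒ ⊢ :- s := # 0) s f)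
    chart-neg {t = t} {s} (chart {x} {y} e f) = chart
        (lincomb 2 (λ s y → one ∙ s :* y := one ⇒ ⊢ :- s :* (:- y) := one) s y e)
        (lincomb 3 (λ x y t → one ∙ x := t :* y ⇒ ⊢ x := :- t :* (:- y)) x y t f)

    chart-unique : ∀ {P t s t′ s′} → Chart P t s → Chart P t′ s′ → t ≈ t′ × s ≈ s′
    chart-unique (chart-O e f) (chart-O e′ f′) = trans e (sym e′) , trans f (sym f′)
    chart-unique {t = t} {s} {t′} {s′} (chart {x} {y} e f) (chart e′ f′) =
      (lincomb 5 (λ x y t u v → (:- t :+ u) ∙ v :* y := one ⇒ (:- v) ∙ x := t :* y ⇒ v ∙ x := u :* y ⇒
          ⊢ t := u) x y t t′ s′) e′ f f′ ,
      (lincomb 3 (λ y s v → v ∙ s :* y := one ⇒ (:- s) ∙ v :* y := one ⇒ ⊢ s := v) y s s′) e e′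

    chart-equation : ∀ {P t s} → On P → Chart P t s → s ≈ t * t * t + A * t * s * s + B * s * s * s
    chart-equation {t = t} {s} on (chart-O e f) =
      (lincomb 4 (λ t s A B → (:- (s :^ 2 :* A) :- t :^ 2) ∙ t := # 0 ⇒ (:- (s :^ 2 :* B) :+ one) ∙ s := # 0 ⇒
          ⊢ s := t :* t :* t :+ A :* t :* s :* s :+ B :* s :* s :* s) t s A B) e f
    chart-equation {t = t} {s} on (chart {x} {y} e f) =
      (lincomb 6 (λ x y s t A B → (x :^ 2 :* s :^ 2 :* t :+ x :* s :* t :^ 2 :+ s :^ 2 :* t :* A
          :- y :* s :^ 2 :+ t :^ 3 :- s) ∙ s :* y := one ⇒
          (x :^ 2 :* s :^ 3 :+ x :* s :^ 2 :* t :+ s :^ 3 :* A :+ s :* t :^ 2) ∙ x := t :* y ⇒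
          (s :^ 3) ∙ y :* y := x :* x :* x :+ A :* x :+ B ⇒
          ⊢ s := t :* t :* t :+ A :* t :* s :* s :+ B :* s :* s :* s) x y s t A B) e f on

    open AbelianGroup group using () renaming (monoid to point-monoid)
    open import Algebra.Properties.Monoid.Mult point-monoid public using () renaming
        (_×_ to _·_; ×-assocˡ to ·-assocˡ; ×-congˡ to ·-congˡ)

    infix 4 _≃_
    _≃_ : Σ Point On → Σ Point On → Set (c ⊔ ℓ)
    P ≃ Q = proj₁ P ∼ proj₁ Q

    ε : Σ Point On
    ε = nothing , tt

    ≃ε? : ∀ P → Dec (P ≃ ε)
    ≃ε? (nothing , _) = yes O∼O
    ≃ε? (just _ , _)  = no λ ()

    -- Primes are removed from the annihilating product one at a time; the first remaining product
    -- that no longer kills P gives a multiple whose order is the prime just removed.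
    prime-order-multiple : ∀ ps → All Prime ps → ∀ P → ¬ P ≃ ε → product ps · P ≃ ε →
                           ∃ λ p → ∃ λ k → Prime p × ¬ k · P ≃ ε × p · (k · P) ≃ ε
    prime-order-multiple []       []               P P≄ε e =
      ⊥-elim (P≄ε (∼-trans (∼-sym (sum-unique P ε (O₂ (∼-sym (neg-involutive _))))) e))
    prime-order-multiple (p ∷ ps) (p-prime ∷ primes) P P≄ε e with ≃ε? (product ps · P)
    ... | yes e′   = prime-order-multiple ps primes P P≄ε e′
    ... | no  k·P≄ε = p , product ps , p-prime , k·P≄ε , ∼-trans (·-assocˡ P p (product ps)) e

  -- The addition law near O, to third order.

  module NearO (A B : Carrier) (disc≉0 : fromℕ 4 * (A * A * A) + fromℕ 27 * (B * B) ≉ 0#)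
               (W : Place K) (local : Local K W) (OA : Place.O W A) (OB : Place.O W B) where
    open GroupLaw.Short K A B disc≉0
    open Charts A B disc≉0
    open Place W
    open Divides W

    -- τ is the sum of the t-coordinates of the other two intersections with the line.
    record OnSecant (P : Point) (α β τ C : Carrier) : Set (c ⊔ ℓ) where
      constructor onSecant
      field
        {t s}     : Carrier
        ch        : Chart P t s
        on-secant : s ≈ α * t + β
        sum       : τ + t ≈ - (β * C)

    -- α = N/D is the slope of the chord after cancellation of t₁ − t₂, hence also that of the tangent.
    record Secant (t₁ s₁ t₂ s₂ : Carrier) : Set (c ⊔ ℓ) where
      N : Carrier
      N = t₁ * t₁ + t₁ * t₂ + t₂ * t₂ + A * s₂ * s₂

      D : Carrier
      D = 1# - A * t₁ * (s₁ + s₂) - B * (s₁ * s₁ + s₁ * s₂ + s₂ * s₂)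

      field
        {D⁻¹ α β V⁻¹} : Carrier
        O-D⁻¹         : O D⁻¹
        DD⁻¹          : D * D⁻¹ ≈ 1#
        α≈            : α ≈ N * D⁻¹
        β≈            : β ≈ s₁ - α * t₁
        slope-t       : s₁ - s₂ ≈ α * (t₁ - t₂)
        O-α           : O α
        O-V⁻¹         : O V⁻¹

      -- Substituting s = α t + β into the equation of the cubic gives V t³ + β (2Aα + 3Bα²) t² +
      -- ... = 0. So V is the leading coefficient, and -β C below is the sum of the three roots.
      V : Carrier
      V = 1# + A * α * α + B * α * α * α

      field
        VV⁻¹ : V * V⁻¹ ≈ 1#

      C : Carrier
      C = (fromℕ 2 * A * α + fromℕ 3 * B * α * α) * V⁻¹

      O-C : O C
      O-C = O-* (O-+ (O-* (O-* (O-fromℕ 2) OA) O-α) (O-* (O-* (O-* (O-fromℕ 3) OB) O-α) O-α)) O-V⁻¹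

      on-secant₁ : s₁ ≈ α * t₁ + β
      on-secant₁ = lincomb 4 (λ s t α β → (:- one) ∙ β := s :- α :* t ⇒ ⊢ s := α :* t :+ β) s₁ t₁ α β β≈

      on-secant₂ : s₂ ≈ α * t₂ + β
      on-secant₂ = lincomb 6 (λ a b c d α β → (:- one) ∙ b :- d := α :* (a :- c) ⇒ (:- one) ∙ β := b :- α :* a ⇒
          ⊢ d := α :* c :+ β) t₁ s₁ t₂ s₂ α β slope-t β≈

    -- D is a principal unit and N lies in M, so α = N/D lies in M and V is a principal unit as
    -- well; locality inverts D and V.
    secant : ∀ {P₁ P₂ t₁ s₁ t₂ s₂} → On P₁ → On P₂ → Chart P₁ t₁ s₁ → Chart P₂ t₂ s₂ →
             M t₁ → M s₁ → M t₂ → M s₂ → Secant t₁ s₁ t₂ s₂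
    secant {t₁ = t₁} {s₁} {t₂} {s₂} on₁ on₂ ch₁ ch₂ Mt₁ Ms₁ Mt₂ Ms₂ = invert (
      local {1# - A * t₁ * (s₁ + s₂) - B * (s₁ * s₁ + s₁ * s₂ + s₂ * s₂)}
        (M-resp (lincomb 5 (λ A B a b d → ⊢ :- (A :* a :* (b :+ d)) :- B :* (b :* b :+ b :* d :+ d :* d)
            := one :- A :* a :* (b :+ d) :- B :* (b :* b :+ b :* d :+ d :* d) :- one) A B t₁ s₁ s₂)
          (M-- (M-neg (M-* (O-* OA (M⊆O Mt₁)) (M-+ Ms₁ Ms₂)))
               (M-* OB (M-+ (M-+ (M-* (M⊆O Ms₁) Ms₁) (M-* (M⊆O Ms₁) Ms₂)) (M-* (M⊆O Ms₂) Ms₂))))))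
      where
      M-N : M (t₁ * t₁ + t₁ * t₂ + t₂ * t₂ + A * s₂ * s₂)
      M-N = M-+ (M-+ (M-+ (M-* (M⊆O Mt₁) Mt₁) (M-* (M⊆O Mt₁) Mt₂)) (M-* (M⊆O Mt₂) Mt₂)) (M-* (O-* OA (M⊆O Ms₂)) Ms₂)
      U-V : ∀ {α} → M α → U (1# + A * α * α + B * α * α * α)
      U-V {α} Mα = M-resp (lincomb 3 (λ A B α → ⊢ A :* α :* α :+ B :* α :* α :* α
          := one :+ A :* α :* α :+ B :* α :* α :* α :- one) A B α)
        (M-+ (M-* (O-* OA (M⊆O Mα)) Mα) (M-* (O-* (O-* OB (M⊆O Mα)) (M⊆O Mα)) Mα))
      module _ {w} (Ow : O w) (Dw : (1# - A * t₁ * (s₁ + s₂) - B * (s₁ * s₁ + s₁ * s₂ + s₂ * s₂)) * w ≈ 1#) where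
        build : ∀ {α} → α ≈ (t₁ * t₁ + t₁ * t₂ + t₂ * t₂ + A * s₂ * s₂) * w →
                (∃ λ v → O v × (1# + A * α * α + B * α * α * α) * v ≈ 1#) → Secant t₁ s₁ t₂ s₂
        build {α} α≈ (v , Ov , Vv) = record
          { O-D⁻¹ = Ow
          ; DD⁻¹ = Dw
          ; α≈ = α≈
          ; β≈ = refl
          ; slope-t = trans (chord-slope t₁ s₁ t₂ s₂ w A B (chart-equation on₁ ch₁)
              (chart-equation on₂ ch₂) Dw) (*-congʳ (sym α≈))
          ; O-α = O-resp (sym α≈) (O-* (M⊆O M-N) Ow)
          ; O-V⁻¹ = Ov
          ; VV⁻¹ = Vv
          }
      invert : (∃ λ w → O w × (1# - A * t₁ * (s₁ + s₂) - B * (s₁ * s₁ + s₁ * s₂ + s₂ * s₂)) * w ≈ 1#)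
          → Secant t₁ s₁ t₂ s₂
      invert (w , Ow , Dw) = build Ow Dw refl (local (U-V (M-resp (*-comm _ _) (M-* Ow M-N))))

    module _ {t₁ s₁ t₂ s₂} (S : Secant t₁ s₁ t₂ s₂) where
      open Secant S

      -- When one of the three points is O, the secant passes through t = s = 0, so β = 0 and the
      -- t-coordinates add up to 0.
      third-degenerate : ∀ {P₃ t₃ s₃} → β ≈ 0# → Chart P₃ t₃ s₃ → s₃ ≈ α * t₃ → t₁ + t₂ + t₃ ≈ 0#
          → OnSecant P₃ α β (t₁ + t₂) C
      third-degenerate {_} {t₃} {s₃} β≈0 ch₃ e f = onSecant ch₃
        (lincomb 4 (λ s t α β → (:- one) ∙ β := # 0 ⇒ one ∙ s := α :* t ⇒ ⊢ s := α :* t :+ β) s₃ t₃ α β β≈0 e)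
        (lincomb 3 (λ t β C → C ∙ β := # 0 ⇒ one ∙ t := # 0 ⇒ ⊢ t := :- (β :* C)) (t₁ + t₂ + t₃) β C β≈0 f)

      module Affine {x₁ y₁ x₂ y₂ x₃ y₃ m n} (L : Line m n x₁ y₁ x₂ y₂ x₃ y₃)
                    (f₁ : s₁ * y₁ ≈ 1#) (g₁ : x₁ ≈ t₁ * y₁) (f₂ : s₂ * y₂ ≈ 1#) (g₂ : x₂ ≈ t₂ * y₂) where
        open Line L

        y₁≉0 : y₁ ≉ 0#
        y₁≉0 = unit-≉0 (trans (*-comm _ _) f₁)

        y₂≉0 : y₂ ≉ 0#
        y₂≉0 = unit-≉0 (trans (*-comm _ _) f₂)

        nN≈-mD : n * N ≈ - m * D
        nN≈-mD = lincomb 4 (λ m n a b → one ∙ n :* a :+ m :* b := # 0 ⇒ ⊢ n :* a := :- m :* b) m n N D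
          (xy≈0⇒y≈0 (*-≉0 (*-≉0 (*-≉0 y₁≉0 y₁≉0) y₂≉0) y₂≉0)
            (trans (*-comm _ _) (line-chord x₁ y₁ t₁ s₁ x₂ y₂ t₂ s₂ x₃ m n A B l₁ l₂ e₁ e₂ e₃ f₁ g₁ f₂ g₂)))

        nα≈-m : n * α ≈ - m
        nα≈-m = lincomb 6 (λ m n a b w α → w ∙ n :* a := :- m :* b ⇒ (:- m) ∙ b :* w := one ⇒ n ∙ α := a :* w ⇒
            ⊢ n :* α := :- m) m n N D D⁻¹ α nN≈-mD DD⁻¹ α≈

        mt+ns : m * t₁ + n * s₁ ≈ 1#
        mt+ns = lincomb 6 (λ m n t s x y → (:- (m :* t) :+ one) ∙ s :* y := one ⇒ (:- (m :* s)) ∙ x := t :* y ⇒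
            (:- s) ∙ y := m :* x :+ n ⇒ ⊢ m :* t :+ n :* s := one) m n t₁ s₁ x₁ y₁ f₁ g₁ l₁

        nβ≈1 : n * β ≈ 1#
        nβ≈1 = lincomb 6 (λ m n t s α β → one ∙ m :* t :+ n :* s := one ⇒ (:- t) ∙ n :* α := :- m ⇒
            n ∙ β := s :- α :* t ⇒ ⊢ n :* β := one) m n t₁ s₁ α β mt+ns nα≈-m β≈

        n≉0 : n ≉ 0#
        n≉0 = unit-≉0 nβ≈1

        product≈ : y₁ * y₂ * y₃ ≈ n * n * n * V
        product≈ = lincomb 6 (λ p m n α A B → one ∙ p := n :* n :* n :+ A :* n :* m :* m :- B :* m :* m :* m ⇒
            (:- (n :^ 2 :* α :^ 2 :* B) :+ m :* n :* α :* B :- n :^ 2 :* α :* A :- m :^ 2 :* B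
            :+ m :* n :* A) ∙ n :* α := :- m ⇒ ⊢ p := n :* n :* n :* (one :+ A :* α :* α
            :+ B :* α :* α :* α)) (y₁ * y₂ * y₃) m n α A B
          (line-product x₁ y₁ x₂ y₂ x₃ y₃ m n A B l₁ l₂ l₃ e₁ e₂ e₃) nα≈-m

        y₃≉0 : y₃ ≉ 0#
        -- As y₁y₂y₃ = n³V is non-zero, the third point is visible in the chart.
        y₃≉0 y₃≈0 = *-≉0 (*-≉0 (*-≉0 n≉0 n≉0) n≉0) (unit-≉0 VV⁻¹)
          (lincomb 3 (λ p y q → (:- one) ∙ p :* y := q ⇒ p ∙ y := # 0 ⇒
              ⊢ q := # 0) (y₁ * y₂) y₃ (n * n * n * V) product≈ y₃≈0)

        s₃ : Carrier
        s₃ = proj₁ (inverse y₃ y₃≉0)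

        t₃ : Carrier
        t₃ = x₃ * s₃

        f₃ : s₃ * y₃ ≈ 1#
        f₃ = trans (*-comm _ _) (proj₂ (inverse y₃ y₃≉0))

        g₃ : x₃ ≈ t₃ * y₃
        g₃ = lincomb 3 (λ x y s → (:- x) ∙ s :* y := one ⇒ ⊢ x := x :* s :* y) x₃ y₃ s₃ f₃

        third-affine : OnSecant (just (x₃ , y₃)) α β (t₁ + t₂) C
        third-affine = onSecant (chart f₃ g₃)
          (lincomb 8 (λ m n s t x y α β → (:- (m :* t :* β) :+ β) ∙ s :* y := one ⇒
              (:- (m :* s :* β)) ∙ x := t :* y ⇒ (:- (s :* β)) ∙ y := m :* x :+ n ⇒
              (:- (t :* β)) ∙ n :* α := :- m ⇒ (t :* α :- s) ∙ n :* β := one ⇒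
              ⊢ s := α :* t :+ β) m n s₃ t₃ x₃ y₃ α β f₃ g₃ l₃ nα≈-m nβ≈1)
          (cancelˡ (*-≉0 (*-≉0 (*-≉0 n≉0 n≉0) n≉0) (unit-≉0 VV⁻¹)) scaled)
          where
          fractions : (t₁ + t₂ + t₃) * (y₁ * y₂ * y₃) ≈ fromℕ 2 * m * n * A - fromℕ 3 * m * m * B
          fractions = lincomb 10 (λ a b d y z w t u v p → (:- (z :* w)) ∙ a := t :* y ⇒
              (:- (y :* w)) ∙ b := u :* z ⇒ (:- (y :* z)) ∙ d := v :* w ⇒
              one ∙ a :* z :* w :+ b :* y :* w :+ d :* y :* z := p ⇒
              ⊢ (t :+ u :+ v) :* (y :* z :* w) := p) x₁ x₂ x₃ y₁ y₂ y₃ t₁ t₂ t₃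
              (fromℕ 2 * m * n * A - fromℕ 3 * m * m * B) g₁ g₂ g₃ (line-sum x₁ y₁ x₂ y₂ x₃ y₃ m n A B l₁ l₂ l₃
              e₁ e₂ e₃)
          scaled : n * n * n * V * (t₁ + t₂ + t₃) ≈ n * n * n * V * - (β * C)
          scaled = lincomb 10 (λ m n α β A B t p V w → (:- t) ∙ p := n :* n :* n :* V ⇒
              (n :* β :* V :* w) ∙ t :* p := # 2 :* m :* n :* A :- # 3 :* m :* m :* B ⇒
              (# 3 :* n :^ 2 :* α :* β :* B :* V :* w :- # 3 :* m :* n :* β :* B :* V :* w
              :+ # 2 :* n :^ 2 :* β :* A :* V :* w) ∙ n :* α := :- m ⇒ (:- (t :* p :* V :* w)) ∙ n :* β := one ⇒
              (:- (t :* p)) ∙ V :* w := one ⇒ ⊢ n :* n :* n :* V :* t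
              := n :* n :* n :* V :* (:- (β :* ((# 2 :* A :* α :+ # 3 :* B :* α :* α) :* w)))) m n α β A B
              (t₁ + t₂ + t₃) (y₁ * y₂ * y₃) V V⁻¹
            product≈ fractions nα≈-m nβ≈1 VV⁻¹

    third-chart : ∀ {P₁ P₂ P₃ t₁ s₁ t₂ s₂} (S : Secant t₁ s₁ t₂ s₂) → Chart P₁ t₁ s₁ → Chart P₂ t₂ s₂
        → Sum₀ P₁ P₂ P₃ →
      let open Secant S in OnSecant P₃ α β (t₁ + t₂) C
    third-chart S (chart f₁ g₁) (chart f₂ g₂) (on-line L) = Affine.third-affine S L f₁ g₁ f₂ g₂
    third-chart {t₁ = t₁} {s₁} {t₂} {s₂} S (chart-O e f) ch₂ (O₁ p) =
      third-degenerate S (lincomb 4 (λ t s α β → (:- α) ∙ t := # 0 ⇒ one ∙ s := # 0 ⇒ one ∙ β := s :- α :* t ⇒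
          ⊢ β := # 0) t₁ s₁ α β e f β≈)
        (chart-cong (∼-sym (neg-flip p)) (chart-neg ch₂))
        (lincomb 5 (λ a b c d α → α ∙ a := # 0 ⇒ (:- one) ∙ b := # 0 ⇒ one ∙ b :- d := α :* (a :- c) ⇒
            ⊢ :- d := α :* (:- c)) t₁ s₁ t₂ s₂ α e f slope-t)
        (lincomb 2 (λ a c → one ∙ a := # 0 ⇒ ⊢ a :+ c :+ :- c := # 0) t₁ t₂ e)
      where open Secant S
    third-chart {t₁ = t₁} {s₁} {t₂} {s₂} S ch₁ (chart-O e f) (O₂ p) =
      third-degenerate S (lincomb 6 (λ a b c d α β → (:- α) ∙ c := # 0 ⇒ one ∙ d := # 0 ⇒
          one ∙ b :- d := α :* (a :- c) ⇒ one ∙ β := b :- α :* a ⇒ ⊢ β := # 0) t₁ s₁ t₂ s₂ α β e f slope-t β≈)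
        (chart-cong (∼-sym (neg-flip p)) (chart-neg ch₁))
        (lincomb 5 (λ a b c d α → α ∙ c := # 0 ⇒ (:- one) ∙ d := # 0 ⇒ (:- one) ∙ b :- d := α :* (a :- c) ⇒
            ⊢ :- b := α :* (:- a)) t₁ s₁ t₂ s₂ α e f slope-t)
        (lincomb 2 (λ a c → one ∙ c := # 0 ⇒ ⊢ a :+ c :+ :- a := # 0) t₁ t₂ e)
      where open Secant S
    third-chart {t₁ = t₁} {s₁} {t₂} {s₂} S ch₁ ch₂ (O₃ p) =
      third-degenerate S
        (xy≈0⇒y≈0 2≉0 (lincomb 6 (λ a b c d α β → (:- α) ∙ a := :- c ⇒ one ∙ b := :- d ⇒
            one ∙ b :- d := α :* (a :- c) ⇒ (# 2) ∙ β := b :- α :* a ⇒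
            ⊢ # 2 :* β := # 0) t₁ s₁ t₂ s₂ α β e f slope-t β≈))
        (chart-O refl refl)
        (sym (zeroʳ α))
        (lincomb 2 (λ a c → one ∙ a := :- c ⇒ ⊢ a :+ c :+ # 0 := # 0) t₁ t₂ e)
      where
      open Secant S
      e = proj₁ (chart-unique (chart-cong p ch₁) (chart-neg ch₂))
      f = proj₂ (chart-unique (chart-cong p ch₁) (chart-neg ch₂))

    -- Congruence to O modulo π, expressed in the local coordinates: a level of the filtration of
    -- the kernel of reduction.
    Deep : Carrier → Point → Set (c ⊔ ℓ)
    Deep π P = ∃ λ t → ∃ λ s → Chart P t s × π ∣ t × π ∣ s

    deep-neg : ∀ {π P} → Deep π P → Deep π (neg P)
    deep-neg (t , s , ch , t∣ , s∣) = - t , - s , chart-neg ch , ∣-neg t∣ , ∣-neg s∣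

    deep-cong : ∀ {π P Q} → P ∼ Q → Deep π P → Deep π Q
    deep-cong P∼Q (t , s , ch , t∣ , s∣) = t , s , chart-cong P∼Q ch , t∣ , s∣

    ∣³-s : ∀ {π t s} → O π → π ∣ t → π ∣ s → s ≈ t * t * t + A * t * s * s + B * s * s * s → π * π * π ∣ s
    ∣³-s {π} {t} {s} Oπ (a , Oa , e) (b , Ob , f) eq =
      a * a * a + A * a * b * b + B * b * b * b ,
      O-+ (O-+ (O-* (O-* Oa Oa) Oa) (O-* (O-* (O-* OA Oa) Ob) Ob)) (O-* (O-* (O-* OB Ob) Ob) Ob) ,
      (lincomb 7 (λ π t s a b A B → one ∙ s := t :* t :* t :+ A :* t :* s :* s :+ B :* s :* s :* s ⇒
          (π :^ 2 :* b :^ 2 :* A :+ π :^ 2 :* a :^ 2 :+ π :* t :* a :+ t :^ 2) ∙ t := π :* a ⇒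
          (π :^ 2 :* b :^ 2 :* B :+ π :* t :* b :* A :+ π :* s :* b :* B :+ t :* s :* A :+ s :^ 2 :* B) ∙ s
          := π :* b ⇒ ⊢ s := π :* π :* π :* (a :* a :* a :+ A :* a :* b :* b
          :+ B :* b :* b :* b)) π t s a b A B) eq e f

    -- N is quadratic in the coordinates, so π² divides α. Since s is cubic in the coordinates, π³
    -- divides s₁ and hence β = s₁ - α t₁. The sum of the three t-coordinates is -β C.
    deep-third : ∀ {π P₁ P₂ P₃ t₁ s₁ t₂ s₂} → M π → On P₁ → On P₂ → Chart P₁ t₁ s₁ → Chart P₂ t₂ s₂ →
      π ∣ t₁ → π ∣ s₁ → π ∣ t₂ → π ∣ s₂ → Sum₀ P₁ P₂ P₃ →
      ∃ λ t₃ → ∃ λ s₃ → Chart P₃ t₃ s₃ × π ∣ t₃ × π ∣ s₃ × π * π * π ∣ t₁ + t₂ + t₃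
    deep-third {π} {t₁ = t₁} {s₁} {t₂} {s₂} Mπ on₁ on₂ ch₁ ch₂ t₁∣ s₁∣ t₂∣ s₂∣ Σ₀ =
      t , s , ch , t∣ , ∣-resp (sym on-secant) (∣-+ (∣-* O-α t∣) π∣β) , ∣-resp (sym sum) π³∣βC
      where
      Oπ = M⊆O Mπ
      S = secant on₁ on₂ ch₁ ch₂ (∣⇒M Mπ t₁∣) (∣⇒M Mπ s₁∣) (∣⇒M Mπ t₂∣) (∣⇒M Mπ s₂∣)
      open Secant S
      open OnSecant (third-chart S ch₁ ch₂ Σ₀)
      π²∣N : π * π ∣ N
      π²∣N = ∣-+ (∣-+ (∣-+ (∣-** t₁∣ t₁∣) (∣-** t₁∣ t₂∣)) (∣-** t₂∣ t₂∣)) (∣-** (∣-* OA s₂∣) s₂∣)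
      π²∣α : π * π ∣ α
      π²∣α = ∣-resp (trans (*-comm _ _) (sym α≈)) (∣-* O-D⁻¹ π²∣N)
      π³∣β : π * π * π ∣ β
      π³∣β = ∣-resp (sym β≈) (∣-- (∣³-s Oπ t₁∣ s₁∣ (chart-equation on₁ ch₁)) (∣-** π²∣α t₁∣))
      π∣β : π ∣ β
      π∣β = ∣-weaken Oπ (∣-weaken Oπ π³∣β)
      π³∣βC : π * π * π ∣ - (β * C)
      π³∣βC = ∣-neg (∣-resp (*-comm _ _) (∣-* O-C π³∣β))
      t∣ : π ∣ t
      t∣ = ∣-resp (lincomb 3 (λ a c t → ⊢ a :+ c :+ t :- (a :+ c) := t) t₁ t₂ t)
             (∣-- (∣-resp (sym sum) (∣-weaken Oπ (∣-weaken Oπ π³∣βC))) (∣-+ t₁∣ t₂∣))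

    -- The secant runs through (t₁, s₁) and (-t₂, -s₂); adding the two incidences gives 2β = (s₁ -
    -- s₂) - α (t₁ - t₂). So π divides β, and with it the third t-coordinate -β C - (t₁ - t₂).
    near-difference : ∀ {π P₁ P₂ P₃ t₁ s₁ t₂ s₂ h} → M π → O h → fromℕ 2 * h ≈ 1# → On P₁ → On P₂
        → Chart P₁ t₁ s₁ → Chart P₂ t₂ s₂ →
      M t₁ → M s₁ → M t₂ → M s₂ → π ∣ t₁ - t₂ → π ∣ s₁ - s₂ → Sum₀ P₁ (neg P₂) P₃ → Deep π P₃
    near-difference {π} {P₂ = P₂} {t₁ = t₁} {s₁} {t₂} {s₂} {h} Mπ Oh 2h≈1 on₁ on₂ ch₁ ch₂ Mt₁ Ms₁ Mt₂ Ms₂ t∣ s∣ Σ₀ =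
      t , s , ch , t₃∣ , ∣-resp (sym on-secant) (∣-+ (∣-* O-α t₃∣) π∣β)
      where
      on₂′ = neg-on P₂ on₂
      ch₂′ = chart-neg ch₂
      S = secant on₁ on₂′ ch₁ ch₂′ Mt₁ Ms₁ (M-neg Mt₂) (M-neg Ms₂)
      open Secant S
      open OnSecant (third-chart S ch₁ ch₂′ Σ₀)
      π∣β : π ∣ β
      π∣β = ∣-resp (lincomb 7 (λ h a b d e α β → β ∙ # 2 :* h := one ⇒ h ∙ b := α :* a :+ β ⇒
          h ∙ :- e := α :* (:- d) :+ β ⇒ ⊢ h :* (b :- e :- α :* (a :- d))
          := β) h t₁ s₁ t₂ s₂ α β 2h≈1 on-secant₁ on-secant₂)
        (∣-* Oh (∣-- s∣ (∣-* O-α t∣)))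
      t₃∣ : π ∣ t
      t₃∣ = ∣-resp (lincomb 4 (λ a d t p → (:- one) ∙ a :+ :- d :+ t := :- p ⇒
          ⊢ :- p :- (a :- d) := t) t₁ t₂ t (β * C) sum)
             (∣-- (∣-neg (∣-resp (*-comm _ _) (∣-* O-C π∣β))) t∣)

    deep-sum : ∀ {π} → M π → ∀ P Q → Deep π (proj₁ P) → Deep π (proj₁ Q) → Deep π (proj₁ (P ⊞ Q))
    deep-sum Mπ P Q (_ , _ , ch₁ , t₁∣ , s₁∣) (_ , _ , ch₂ , t₂∣ , s₂∣) =
      let t₃ , s₃ , ch₃ , t₃∣ , s₃∣ , _ = deep-third Mπ (proj₂ P) (proj₂ Q) ch₁ ch₂ t₁∣ s₁∣ t₂∣ s₂∣ (sum₀ {P} {Q})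
      in deep-cong (neg-involutive _) (deep-neg (t₃ , s₃ , ch₃ , t₃∣ , s₃∣))

    deep-multiple : ∀ {π} P → M π → Deep π (proj₁ P) → ∀ k → Deep π (proj₁ (k · P))
    deep-multiple P Mπ deep zero    = 0# , 0# , chart-O refl refl , ∣-0 , ∣-0
    deep-multiple P Mπ deep (suc k) = deep-sum Mπ P (k · P) deep (deep-multiple P Mπ deep k)

    -- To third order in t, the t-coordinate is additive.
    MultipleChart : Carrier → ℕ → Point → Set (c ⊔ ℓ)
    MultipleChart t k Q = ∃ λ t′ → ∃ λ s′ → Chart Q t′ s′ × t ∣ t′ × t ∣ s′ × t * t * t ∣ t′ - fromℕ k * t

    multiple-chart-suc : ∀ {t s} → M t → t ∣ s → ∀ P → Chart (proj₁ P) t s → ∀ k Q →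
      MultipleChart t k (proj₁ Q) → MultipleChart t (suc k) (proj₁ (P ⊞ Q))
    multiple-chart-suc {t} Mt t∣s P ch k Q (t₂ , s₂ , ch₂ , t₂∣ , s₂∣ , t³∣) =
      let t₃ , s₃ , ch₃ , t₃∣ , s₃∣ , t³∣′ = deep-third Mt (proj₂ P) (proj₂ Q) ch ch₂ ∣-self t∣s t₂∣ s₂∣ (sum₀ {P} {Q})
      in - t₃ , - s₃ , chart-cong (neg-involutive _) (chart-neg ch₃) , ∣-neg t₃∣ , ∣-neg s₃∣ ,
         ∣-resp (lincomb 4 (λ t u v k → ⊢ u :- k :* t :- (t :+ u :+ v)
             := :- v :- (one :+ k) :* t) t t₂ t₃ (fromℕ k)) (∣-- t³∣ t³∣′)

    multiple-chart : ∀ {t s} → M t → t ∣ s → ∀ P → Chart (proj₁ P) t s → ∀ k → MultipleChart t k (proj₁ (k · P))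
    multiple-chart {t} Mt t∣s P ch zero    = 0# , 0# , chart-O refl refl , ∣-0 , ∣-0 , ∣-resp
        (lincomb 1 (λ t → ⊢ # 0 := # 0 :- # 0 :* t) t) ∣-0
    multiple-chart {t} Mt t∣s P ch (suc k) = multiple-chart-suc Mt t∣s P ch k (k · P) (multiple-chart Mt t∣s P ch k)

    -- The t-coordinate of p T is 0 and agrees with p t up to a multiple of t³. Cancelling t ≠ 0
    -- shows that t² divides p, and q divides t.
    prime-order⇒square∣ : ∀ {q} p T → M q → Deep q (proj₁ T) → ¬ T ≃ ε → p · T ≃ ε → q * q ∣ fromℕ p
    prime-order⇒square∣ p (nothing , _) _ _ T≄ε _ = ⊥-elim (T≄ε O∼O)
    prime-order⇒square∣ {q} p T@(just (x , y) , on) Mq (t , s , ch@(chart f g) , t∣@(a , Oa , t≈qa) , s∣) T≄ε p·T≃ε =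
      finish (local U-unit)
      where
      Mt : M t
      Mt = ∣⇒M Mq t∣
      Ms : M s
      Ms = ∣⇒M Mq s∣
      Ot : O t
      Ot = M⊆O Mt
      U-unit : U (1# - A * t * s - B * s * s)
      U-unit = M-resp (lincomb 4 (λ A B t s → ⊢ :- (A :* t :* s) :- B :* s :* s
          := one :- A :* t :* s :- B :* s :* s :- one) A B t s)
        (M-- (M-neg (M-* (O-* OA (M⊆O Mt)) Ms)) (M-* (O-* OB (M⊆O Ms)) Ms))
      conclude : t ≉ 0# → MultipleChart t p (proj₁ (p · T)) → q * q ∣ fromℕ p
      conclude t≉0 (t′ , s′ , ch′ , _ , _ , (r , Or , e′)) = - (a * a * r) , O-neg (O-* (O-* Oa Oa) Or) ,
        cancelˡ t≉0 (lincomb 6 (λ t u p r q a → one ∙ u := # 0 ⇒ (:- one) ∙ u :- p :* t := t :* t :* t :* r ⇒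
            (:- (t :* r :* q :* a) :- t :^ 2 :* r) ∙ t := q :* a ⇒
            ⊢ t :* p := t :* (q :* q :* (:- (a :* a :* r)))) t t′ (fromℕ p) r q a (proj₁ (chart-unique
            (chart-cong p·T≃ε ch′) (chart-O {s = 0#} refl refl))) e′ t≈qa)
      finish : (∃ λ v → O v × (1# - A * t * s - B * s * s) * v ≈ 1#) → q * q ∣ fromℕ p
      -- The equation s (1 - A t s - B s²) = t³ has a principal unit on the left; inverting it shows
      -- that t divides s, as `multiple-chart` requires, and that t = 0 would force s = 0.
      finish (v , Ov , e) = conclude t≉0 (multiple-chart Mt (t * t * v , O-* (O-* Ot Ot) Ov , s≈t³v) T ch p)
        where
        s≈t³v : s ≈ t * (t * t * v)
        s≈t³v = lincomb 5 (λ t s v A B → v ∙ s := t :* t :* t :+ A :* t :* s :* s :+ B :* s :* s :* s ⇒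
            (:- s) ∙ (one :- A :* t :* s :- B :* s :* s) :* v := one ⇒
            ⊢ s := t :* (t :* t :* v)) t s v A B (chart-equation {just (x , y)} on ch) e
        t≉0 : t ≉ 0#
        t≉0 t≈0 = 1≉0 (lincomb 4 (λ t s y v → (:- one) ∙ s :* y := one ⇒ y ∙ s := t :* (t :* t :* v) ⇒
            (t :^ 2 :* y :* v) ∙ t := # 0 ⇒ ⊢ one := # 0) t s y v f s≈t³v t≈0)

    deep-torsion-free : ∀ {q} → M (fromℕ q) → ∀ P → Deep (fromℕ q) (proj₁ P) → ∀ n → suc n · P ≃ ε → P ≃ ε
    deep-torsion-free {q} Mq P deep n e = by-cases (≃ε? P)
      where
      open PrimeFactorisation (factorise (suc n))
      contradict : (∃ λ p → ∃ λ k → Prime p × ¬ k · P ≃ ε × p · (k · P) ≃ ε) → P ≃ ε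
      contradict (p , k , p-prime , k·P≄ε , p·k·P≃ε) = ⊥-elim (prime∤square W {p} {q} p-prime Mq
        (prime-order⇒square∣ p (k · P) Mq (deep-multiple P Mq deep k) k·P≄ε p·k·P≃ε))
      by-cases : Dec (P ≃ ε) → P ≃ ε
      by-cases (yes P≃ε) = P≃ε
      by-cases (no P≄ε)  = contradict (prime-order-multiple factors factorsPrime P P≄ε
                             (∼-trans (·-congˡ {P} (≡.sym isFactorisation)) e))

    module _ {e h : Carrier} (Oe : O e) (disc*e : (fromℕ 4 * (A * A * A) + fromℕ 27 * (B * B)) * e ≈ 1#)
             (Oh : O h) (2h≈1 : fromℕ 2 * h ≈ 1#) where

      module Integral {π x₁ y₁ x₂ y₂ : Carrier} (Mπ : M π) (on₁ : OnCubic x₁ y₁)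
               (Ox₁ : O x₁) (Oy₁ : O y₁) (Ox₂ : O x₂)
               (x∣ : π ∣ x₁ - x₂) (y∣ : π ∣ y₁ - y₂) where

        -- `p` and `r` are the multipliers of `2-torsion-free` at x₁. Applied to the two equations
        -- for the slope m of the line through (x₁, y₁) and (x₂, -y₂), they yield m a + b = 1 with a
        -- and b divisible by π.
        p r a b : Carrier
        p = fromℕ 6 * A * x₁ * x₁ - fromℕ 9 * B * x₁ + fromℕ 4 * A * A
        r = fromℕ 27 * B - fromℕ 18 * A * x₁
        a = (y₁ - y₂) * p * e + (x₁ - x₂) * (r * e * h * y₁)
        b = (x₁ - x₂) * (fromℕ 2 * x₁ + x₂) * p * e + (y₁ - y₂) * (r * e * h * y₁)

        Op : O p
        Op = O-+ (O-- (O-* (O-* (O-* (O-fromℕ 6) OA) Ox₁) Ox₁) (O-* (O-* (O-fromℕ 9) OB) Ox₁)) (O-* (O-*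
            (O-fromℕ 4) OA) OA)

        Oreh : O (r * e * h * y₁)
        Oreh = O-* (O-* (O-* (O-- (O-* (O-fromℕ 27) OB) (O-* (O-* (O-fromℕ 18) OA) Ox₁)) Oe) Oh) Oy₁

        ∣a : π ∣ a
        ∣a = ∣-resp (lincomb 5 (λ s t p e u → ⊢ p :* e :* t :+ u :* s
            := t :* p :* e :+ s :* u) (x₁ - x₂) (y₁ - y₂) p e (r * e * h * y₁))
               (∣-+ (∣-* (O-* Op Oe) y∣) (∣-* Oreh x∣))

        ∣b : π ∣ b
        ∣b = ∣-resp (lincomb 6 (λ s t p e u v → ⊢ v :* p :* e :* s :+ u :* t
            := s :* v :* p :* e :+ t :* u) (x₁ - x₂) (y₁ - y₂) p e (r * e * h * y₁) (fromℕ 2 * x₁ + x₂))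
               (∣-+ (∣-* (O-* (O-* (O-+ (O-* (O-fromℕ 2) Ox₁) Ox₂) Op) Oe) x∣) (∣-* Oreh y∣))

        -- The point (x₁, y₁) is regular modulo M because the discriminant is a unit.
        regular : ∀ {m} → m * (x₁ - x₂) ≈ y₁ + y₂ → m * (y₁ - y₂) ≈ x₁ * x₁ + x₁ * x₂ + x₂ * x₂ + A → m * a + b ≈ 1#
        regular {m} chord conj = lincomb 9 (λ m x y z w A B e h → one ∙ (# 4 :* (A :* A :* A)
            :+ # 27 :* (B :* B)) :* e := one ⇒ ((# 27 :* B :- # 18 :* A :* x) :* e :* y :* y) ∙ # 2 :* h
            := one ⇒ ((# 27 :* B :- # 18 :* A :* x) :* e) ∙ y :* y := x :* x :* x :+ A :* x :+ B ⇒
            ((# 27 :* B :- # 18 :* A :* x) :* e :* h :* y) ∙ m :* (x :- z) := y :+ w ⇒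
            ((# 6 :* A :* x :* x :- # 9 :* B :* x :+ # 4 :* A :* A) :* e) ∙ m :* (y :- w)
            := x :* x :+ x :* z :+ z :* z :+ A ⇒ ⊢ m :* ((y :- w) :* (# 6 :* A :* x :* x :- # 9 :* B :* x
            :+ # 4 :* A :* A) :* e :+ (x :- z) :* ((# 27 :* B :- # 18 :* A :* x) :* e :* h :* y)) :+ ((x
            :- z) :* (# 2 :* x :+ z) :* (# 6 :* A :* x :* x :- # 9 :* B :* x :+ # 4 :* A :* A) :* e :+ (y
            :- w) :* ((# 27 :* B :- # 18 :* A :* x) :* e :* h :* y)) := one) m x₁ y₁ x₂ y₂ A B e h
          disc*e 2h≈1 on₁ chord conj

        -- From m a = 1 - b, a principal unit, the inverse slope is a/(1 - b), divisible by π: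
        -- modulo π the line is vertical.
        scale : ∀ {m} → m * a + b ≈ 1# → ∃ λ η → π ∣ η × m * η ≈ 1#
        scale {m} ma+b≈1 = invert (local {1# - b} (M-resp
            (lincomb 1 (λ b → ⊢ :- b := one :- b :- one) b) (M-neg (∣⇒M Mπ ∣b))))
          where
          invert : (∃ λ w → O w × (1# - b) * w ≈ 1#) → ∃ λ η → π ∣ η × m * η ≈ 1#
          invert (w , Ow , e) = w * a , ∣-* Ow ∣a ,
              (lincomb 4 (λ m a b w → w ∙ m :* a :+ b := one ⇒ one ∙ (one :- b) :* w := one ⇒
              ⊢ m :* (w :* a) := one) m a b w ma+b≈1 e)

        third-deep : ∀ {m n x₃ y₃} → Line m n x₁ y₁ x₂ (- y₂) x₃ y₃ → Deep π (just (x₃ , y₃))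
        third-deep {m} {n} {x₃} {y₃} L = deep (scale (regular
          (lincomb 5 (λ m x z y w → one ∙ m :* (x :- z) := y :- :- w ⇒
              ⊢ m :* (x :- z) := y :+ w) m x₁ x₂ y₁ y₂ (Slope.chord (line-slope L)))
          (lincomb 4 (λ m f y w → one ∙ m :* (y :+ :- w) := f ⇒
              ⊢ m :* (y :- w) := f) m (x₁ * x₁ + x₁ * x₂ + x₂ * x₂ + A) y₁ y₂ (Slope.conj (line-slope L)))))
          where
          open Line L
          deep : (∃ λ η → π ∣ η × m * η ≈ 1#) → Deep π (just (x₃ , y₃))
          deep (η , π∣η , mη≈1) = finish (local U-v)
            where
            Mη : M η
            Mη = ∣⇒M Mπ π∣η
            Oη : O η
            Oη = M⊆O Mη
            -- These are η² x₃ and η³ y₃ for η = 1/m, so that t₃ = η u/v and s₃ = η³/v.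
            u v : Carrier
            u = 1# - η * η * (x₁ + x₂)
            v = 1# - η * η * (fromℕ 2 * x₁ + x₂) + η * η * η * y₁
            Ou : O u
            Ou = O-- O-1 (O-* (O-* Oη Oη) (O-+ Ox₁ Ox₂))
            U-v : U v
            U-v = M-resp (lincomb 4 (λ η x z y → ⊢ :- (η :* (# 2 :* x :+ z) :* η) :+ η :* η :* y :* η
                := one :- η :* η :* (# 2 :* x :+ z) :+ η :* η :* η :* y :- one) η x₁ x₂ y₁)
              (M-+ (M-neg (M-* (O-* Oη (O-+ (O-* (O-fromℕ 2) Ox₁) Ox₂)) Mη)) (M-* (O-* (O-* Oη Oη) Oy₁) Mη))
            η³y₃≈v : η * η * η * y₃ ≈ v
            η³y₃≈v = lincomb 8 (λ η m n x z t y w → (η :^ 3) ∙ w := m :* t :+ n ⇒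
                (:- (η :^ 3)) ∙ y := m :* x :+ n ⇒ (η :^ 2) ∙ x :+ z :+ t := m :* m ⇒
                (:- (η :^ 2 :* x) :+ η :^ 2 :* t :+ η :* m :+ one) ∙ m :* η := one ⇒
                ⊢ η :* η :* η :* w := one :- η :* η :* (# 2 :* x :+ z) :+ η :* η :* η :* y) η m n x₁ x₂ x₃ y₁ y₃
                l₃ l₁ e₁ mη≈1
            finish : (∃ λ w → O w × v * w ≈ 1#) → Deep π (just (x₃ , y₃))
            finish (w , Ow , vw≈1) = η * (u * w) , η * (η * η * w) ,
              chart (lincomb 4 (λ η v w y → w ∙ η :* η :* η :* y := v ⇒ one ∙ v :* w := one ⇒
                  ⊢ η :* (η :* η :* w) :* y := one) η v w y₃ η³y₃≈v vw≈1)
                    (lincomb 8 (λ η m v w x z t y → (:- (m :^ 2 :* w) :+ w :* x :+ w :* z) ∙ η :* η :* η :* y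
                        := v ⇒ (:- (m :^ 2) :+ x :+ z) ∙ v :* w := one ⇒ one ∙ x :+ z :+ t := m :* m ⇒
                        (η :^ 2 :* m :* w :* y :+ η :* w :* y) ∙ m :* η := one ⇒
                        ⊢ t := η :* ((one :- η :* η :* (x :+ z)) :* w) :* y) η m v w x₁ x₂ x₃ y₃ η³y₃≈v vw≈1 e₁
                        mη≈1) ,
              ∣-resp (*-comm _ _) (∣-* (O-* Ou Ow) π∣η) , ∣-resp (*-comm _ _) (∣-* (O-* (O-* Oη Oη) Ow) π∣η)

      integral-difference : ∀ {π x₁ y₁ x₂ y₂ P₃} → M π → OnCubic x₁ y₁ → O x₁ → O y₁ → O x₂ →
        π ∣ x₁ - x₂ → π ∣ y₁ - y₂ → ¬ just (x₁ , y₁) ∼ just (x₂ , y₂) →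
        Sum₀ (just (x₁ , y₁)) (neg (just (x₂ , y₂))) P₃ → Deep π P₃
      integral-difference Mπ on₁ Ox₁ Oy₁ Ox₂ x∣ y∣ P≄Q (on-line L) = Integral.third-deep Mπ on₁ Ox₁ Oy₁ Ox₂ x∣ y∣ L
      integral-difference Mπ on₁ Ox₁ Oy₁ Ox₂ x∣ y∣ P≄Q (O₃ p)      = ⊥-elim (P≄Q (∼-trans p (neg-involutive _)))

-- Torsion points that lie on one line modulo q⁶.

module FourTorsionPoints {c ℓ} (K : AlgClosureℚ c ℓ) where
  open AlgClosureℚ K
  open LinearCombinations commRing
  open FieldProperties K
  open Places K using (_⊑_; O⊆; M⊆; ⊑-refl; ⊑-trans; ask; localise; ⊑-localise; localise-local)
  open KernelOfReduction K

  module _ {g ℓ′} (G : AbelianGroup g ℓ′) where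
    private module G = AbelianGroup G
    open import Algebra.Properties.CommutativeMonoid.Mult G.commutativeMonoid renaming (_×_ to _·_)
    open import Relation.Binary.Reasoning.Setoid G.setoid

    ·-ε : ∀ n → n · G.ε G.≈ G.ε
    ·-ε zero    = G.refl
    ·-ε (suc n) = G.trans (G.identityˡ _) (·-ε n)

    ·-inverse : ∀ n {x} → n · x G.≈ G.ε → n · (x G.⁻¹) G.≈ G.ε
    ·-inverse n {x} e = begin
      n · (x G.⁻¹)                ≈⟨ G.identityʳ _ ⟨
      n · (x G.⁻¹) G.∙ G.ε        ≈⟨ G.∙-congˡ e ⟨
      n · (x G.⁻¹) G.∙ n · x      ≈⟨ ×-distrib-+ (x G.⁻¹) x n ⟨
      n · (x G.⁻¹ G.∙ x)          ≈⟨ ×-congʳ n (G.inverseˡ x) ⟩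
      n · G.ε                     ≈⟨ ·-ε n ⟩
      G.ε                         ∎

    torsion-difference : ∀ m n {x y} → m · x G.≈ G.ε → n · y G.≈ G.ε → (m ℕ.* n) · (x G.∙ y G.⁻¹) G.≈ G.ε
    torsion-difference m n {x} {y} e f = begin
      (m ℕ.* n) · (x G.∙ y G.⁻¹)                    ≈⟨ ×-distrib-+ x (y G.⁻¹) (m ℕ.* n) ⟩
      (m ℕ.* n) · x G.∙ (m ℕ.* n) · (y G.⁻¹)        ≈⟨ G.∙-cong (×-congˡ (ℕₚ.*-comm m n)) G.refl ⟩
      (n ℕ.* m) · x G.∙ (m ℕ.* n) · (y G.⁻¹)        ≈⟨ G.∙-cong (×-assocˡ x n m) (×-assocˡ (y G.⁻¹) m n) ⟨
      n · (m · x) G.∙ m · (n · (y G.⁻¹))            ≈⟨ G.∙-cong (×-congʳ n e) (×-congʳ m (·-inverse n f)) ⟩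
      n · G.ε G.∙ m · G.ε                           ≈⟨ G.∙-cong (·-ε n) (·-ε m) ⟩
      G.ε G.∙ G.ε                                   ≈⟨ G.identityˡ G.ε ⟩
      G.ε                                           ∎

  ∣-⊑ : ∀ {V W π x} → V ⊑ W → Divides._∣_ V π x → Divides._∣_ W π x
  ∣-⊑ V⊑W (a , Oa , e) = a , O⊆ V⊑W Oa , e

  product# : List Carrier → Carrier
  product# = List.foldr _*_ 1#

  differences : ∀ {x} {X : Set x} → (X → Carrier) → List X → List Carrier
  differences f []       = []
  differences f (x ∷ xs) = List.map (λ y → f x - f y) xs ++ differences f xs

  -- If κ divides the values of a cubic polynomial, it divides the divided differences times the
  -- Vandermonde product. The products are nested, with a final `1#`, to agree with `product#` of
  -- `differences`; likewise for three and four points.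
  divided-difference₂ : ∀ g₀ g₁ g₂ g₃ κ v₁ v₂ γ₁ γ₂ →
    g₀ + g₁ * v₁ + g₂ * (v₁ * v₁) + g₃ * (v₁ * v₁ * v₁) ≈ κ * γ₁ →
    g₀ + g₁ * v₂ + g₂ * (v₂ * v₂) + g₃ * (v₂ * v₂ * v₂) ≈ κ * γ₂ →
    (g₁ + g₂ * (v₁ + v₂) + g₃ * (v₁ * v₁ + v₁ * v₂ + v₂ * v₂)) * ((v₁ - v₂) * 1#) ≈ κ * (γ₁ - γ₂)
  divided-difference₂ a b c d k x y r s =
    (lincomb 9 (λ a b c d k x y r s → one ∙ a :+ b :* x :+ c :* (x :* x) :+ d :* (x :* x :* x) := k :* r ⇒
        (:- one) ∙ a :+ b :* y :+ c :* (y :* y) :+ d :* (y :* y :* y) := k :* s ⇒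
        ⊢ (b :+ c :* (x :+ y) :+ d :* (x :* x :+ x :* y :+ y :* y)) :* ((x :- y) :* one)
        := k :* (r :- s)) a b c d k x y r s)

  divided-difference₃ : ∀ g₀ g₁ g₂ g₃ κ v₁ v₂ v₃ γ₁ γ₂ γ₃ →
    g₀ + g₁ * v₁ + g₂ * (v₁ * v₁) + g₃ * (v₁ * v₁ * v₁) ≈ κ * γ₁ →
    g₀ + g₁ * v₂ + g₂ * (v₂ * v₂) + g₃ * (v₂ * v₂ * v₂) ≈ κ * γ₂ →
    g₀ + g₁ * v₃ + g₂ * (v₃ * v₃) + g₃ * (v₃ * v₃ * v₃) ≈ κ * γ₃ →
    (g₂ + g₃ * (v₁ + v₂ + v₃)) * ((v₁ - v₂) * ((v₁ - v₃) * ((v₂ - v₃) * 1#))) ≈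
    κ * (γ₁ * (v₂ - v₃) - γ₂ * (v₁ - v₃) + γ₃ * (v₁ - v₂))
  divided-difference₃ a b c d k x y z r s t =
    (lincomb 11 (λ a b c d k x y z r s t → (y :- z) ∙ a :+ b :* x :+ c :* (x :* x) :+ d :* (x :* x :* x)
        := k :* r ⇒ (:- (x :- z)) ∙ a :+ b :* y :+ c :* (y :* y) :+ d :* (y :* y :* y) := k :* s ⇒
        (x :- y) ∙ a :+ b :* z :+ c :* (z :* z) :+ d :* (z :* z :* z) := k :* t ⇒
        ⊢ (c :+ d :* (x :+ y :+ z)) :* ((x :- y) :* ((x :- z) :* ((y :- z) :* one)))
        := k :* (r :* (y :- z) :- s :* (x :- z) :+ t :* (x :- y))) a b c d k x y z r s t)

  divided-difference₄ : ∀ g₀ g₁ g₂ g₃ κ v₁ v₂ v₃ v₄ γ₁ γ₂ γ₃ γ₄ →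
    g₀ + g₁ * v₁ + g₂ * (v₁ * v₁) + g₃ * (v₁ * v₁ * v₁) ≈ κ * γ₁ →
    g₀ + g₁ * v₂ + g₂ * (v₂ * v₂) + g₃ * (v₂ * v₂ * v₂) ≈ κ * γ₂ →
    g₀ + g₁ * v₃ + g₂ * (v₃ * v₃) + g₃ * (v₃ * v₃ * v₃) ≈ κ * γ₃ →
    g₀ + g₁ * v₄ + g₂ * (v₄ * v₄) + g₃ * (v₄ * v₄ * v₄) ≈ κ * γ₄ →
    g₃ * ((v₁ - v₂) * ((v₁ - v₃) * ((v₁ - v₄) * ((v₂ - v₃) * ((v₂ - v₄) * ((v₃ - v₄) * 1#)))))) ≈
    κ * (γ₁ * ((v₂ - v₃) * (v₂ - v₄) * (v₃ - v₄)) - γ₂ * ((v₁ - v₃) * (v₁ - v₄) * (v₃ - v₄)) +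
         γ₃ * ((v₁ - v₂) * (v₁ - v₄) * (v₂ - v₄)) - γ₄ * ((v₁ - v₂) * (v₁ - v₃) * (v₂ - v₃)))
  divided-difference₄ a b c d k x y z w r s t u =
    (lincomb 13 (λ a b c d k x y z w r s t u → ((y :- z) :* (y :- w) :* (z :- w)) ∙ a :+ b :* x
        :+ c :* (x :* x) :+ d :* (x :* x :* x) := k :* r ⇒
        (:- ((x :- z) :* (x :- w) :* (z :- w))) ∙ a :+ b :* y :+ c :* (y :* y) :+ d :* (y :* y :* y) := k :* s ⇒
        ((x :- y) :* (x :- w) :* (y :- w)) ∙ a :+ b :* z :+ c :* (z :* z) :+ d :* (z :* z :* z) := k :* t ⇒
        (:- ((x :- y) :* (x :- z) :* (y :- z))) ∙ a :+ b :* w :+ c :* (w :* w) :+ d :* (w :* w :* w) := k :* u ⇒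
        ⊢ d :* ((x :- y) :* ((x :- z) :* ((x :- w) :* ((y :- z) :* ((y :- w) :* ((z :- w) :* one))))))
        := k :* (r :* ((y :- z) :* (y :- w) :* (z :- w)) :- s :* ((x :- z) :* (x :- w) :* (z :- w))
        :+ t :* ((x :- y) :* (x :- w) :* (y :- w)) :- u :* ((x :- y) :* (x :- z) :* (y
        :- z)))) a b c d k x y z w r s t u)

  module Apart (q : ℕ) .{{_ : ℕ.NonZero q}} where

    -- The valuation of `d` is strictly smaller than that of q: the positive form of q not dividing
    -- `d`.
    Far : Place K → Carrier → Set (c ⊔ ℓ)
    Far W d = ∃ λ g → Place.M W g × d * g ≈ fromℕ q

    far-⊑ : ∀ {V W d} → V ⊑ W → Far V d → Far W d
    far-⊑ V⊑W (g , Mg , e) = g , M⊆ V⊑W Mg , e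

    q≉0 : fromℕ q ≉ 0#
    q≉0 = fromℕ-≉0 q

    -- The dichotomy of `ask` for the quotient d/q.
    far-or-divisible : ∀ W d → (∀ V → W ⊑ V → Far V d → ⊥) → (∀ V → W ⊑ V → Divides._∣_ V (fromℕ q) d → ⊥) → ⊥
    far-or-divisible W d far divisible with w , qw≈1 ← inverse (fromℕ q) q≉0 = ask W (d * w)
      (λ V W⊑V Odw → divisible V W⊑V (d * w , Odw ,
          (lincomb 3 (λ d q w → (:- d) ∙ q :* w := one ⇒ ⊢ d := q :* (d :* w)) d (fromℕ q) w qw≈1)))
      (λ V W⊑V y dwy≈1 My → far V W⊑V (y , My ,
          (lincomb 4 (λ d q w y → (:- (d :* y)) ∙ q :* w := one ⇒ q ∙ d :* w :* y := one ⇒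
          ⊢ d :* y := q) d (fromℕ q) w y qw≈1 dwy≈1)))

    all-far : ∀ W ds → All (λ d → ∀ V → W ⊑ V → ¬ Divides._∣_ V (fromℕ q) d) ds →
              (∀ V → W ⊑ V → All (Far V) ds → ⊥) → ⊥
    all-far W []       []       k = k W ⊑-refl []
    all-far W (d ∷ ds) (p ∷ ps) k = all-far W ds ps λ V W⊑V fars → far-or-divisible V d
      (λ V′ V⊑V′ far → k V′ (⊑-trans W⊑V V⊑V′) (far ∷ All.map (far-⊑ V⊑V′) fars))
      (λ V′ V⊑V′ q∣d → p V′ (⊑-trans W⊑V V⊑V′) q∣d)

    q^ : ℕ → Carrier
    q^ zero    = 1#
    q^ (suc n) = fromℕ q * q^ n

    q^-≉0 : ∀ n → q^ n ≉ 0#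
    q^-≉0 zero    = 1≉0
    q^-≉0 (suc n) = *-≉0 q≉0 (q^-≉0 n)

    q^-+ : ∀ m n → q^ (m ℕ.+ n) ≈ q^ m * q^ n
    q^-+ zero    n = sym (*-identityˡ _)
    q^-+ (suc m) n = trans (*-congˡ (q^-+ m n)) (sym (*-assoc _ _ _))

    -- The list is non-empty because the cofactor of an empty product is 1, which is not in M.
    far-product : ∀ {W d ds} → All (Far W) (d ∷ ds) → ∃ λ g → Place.M W g × product# (d ∷ ds) * g
        ≈ q^ (length (d ∷ ds))
    far-product {W} {d} ((g , Mg , e) ∷ []) = g , Mg ,
        (lincomb 3 (λ d g q → one ∙ d :* g := q ⇒ ⊢ d :* one :* g := q :* one) d g (fromℕ q) e)
    far-product {W} {d} {d′ ∷ ds} ((g , Mg , e) ∷ fars@(_ ∷ _)) with g′ , Mg′ , e′ ← far-product {W} fars =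
      g * g′ , M-* (M⊆O Mg) Mg′ ,
      (lincomb 6 (λ d g q p h r → (p :* h) ∙ d :* g := q ⇒ q ∙ p :* h := r ⇒
          ⊢ d :* p :* (g :* h) := q :* r) d g (fromℕ q) (product# (d′ ∷ ds)) g′ (q^ (length (d′ ∷ ds))) e e′)
      where open Place W

    -- Multiplying by the cofactor g in M of the product and cancelling a power of q leaves u = q^m
    -- z g, a principal unit in M. Here m is the surplus of the exponent 6 over the number of pairs:
    -- 0 for four points, 3 for three, 5 for two.
    far-contradiction : ∀ W {d ds u z} m → All (Far W) (d ∷ ds) → Place.U W u → Place.O W z →
      u * product# (d ∷ ds) ≈ q^ (m ℕ.+ length (d ∷ ds)) * z → ⊥
    far-contradiction W {d} {ds} {u} {z} m fars Uu Oz e with g , Mg , f ← far-product {W} fars =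
      U-disjoint Uu (M-resp (cancelˡ (q^-≉0 (length (d ∷ ds)))
        (lincomb 7 (λ u p g z r s t → u ∙ p :* g := r ⇒ (:- g) ∙ u :* p := t :* z ⇒
            (:- (g :* z)) ∙ t := s :* r ⇒ ⊢ r :* (s :* z :* g) := r :* u) u (product# (d
            ∷ ds)) g z (q^ (length (d ∷ ds))) (q^ m) (q^ (m ℕ.+ length (d ∷ ds))) f e (q^-+ m (length (d
            ∷ ds)))))
        (M-* (O-* (O-q^ m) Oz) Mg))
      where
      open Place W
      O-q^ : ∀ n → O (q^ n)
      O-q^ zero    = O-1
      O-q^ (suc n) = O-* (O-fromℕ q) (O-q^ n)

    separated-values : ∀ {x} {X : Set x} W (f : X → Carrier) xs →
      AllPairs (λ x y → ∀ V → W ⊑ V → ¬ Divides._∣_ V (fromℕ q) (f x - f y)) xs →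
      (∀ V → W ⊑ V → All (Far V) (differences f xs) → ⊥) → ⊥
    separated-values W f xs apart = all-far W (differences f xs) (pairs xs apart)
      where
      pairs : ∀ xs → AllPairs (λ x y → ∀ V → W ⊑ V → ¬ Divides._∣_ V (fromℕ q) (f x - f y)) xs →
              All (λ d → ∀ V → W ⊑ V → ¬ Divides._∣_ V (fromℕ q) d) (differences f xs)
      pairs []       []       = []
      pairs (x ∷ xs) (p ∷ ps) = Allₚ.++⁺ (Allₚ.map⁺ p) (pairs xs ps)

  module Core (A B : Carrier) (disc≉0 : fromℕ 4 * (A * A * A) + fromℕ 27 * (B * B) ≉ 0#) where
    open GroupLaw.Short K A B disc≉0
    open Charts A B disc≉0

    Torsion : Σ Point On → Set (c ⊔ ℓ)
    Torsion P = ∃ λ n → suc n · P ≃ ε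

    record GoodPlace (q : ℕ) (W : Place K) : Set (c ⊔ ℓ) where
      open Place W
      field
        OA   : O A
        OB   : O B
        {disc⁻¹ ½} : Carrier
        O-disc⁻¹ : O disc⁻¹
        O-½  : O ½
        disc*disc⁻¹≈1 : (fromℕ 4 * (A * A * A) + fromℕ 27 * (B * B)) * disc⁻¹ ≈ 1#
        2*½≈1 : fromℕ 2 * ½ ≈ 1#
        Mq   : M (fromℕ q)

    good-⊑ : ∀ {q V W} → V ⊑ W → GoodPlace q V → GoodPlace q W
    good-⊑ V⊑W good = record
      { OA = O⊆ V⊑W OA ; OB = O⊆ V⊑W OB ; O-disc⁻¹ = O⊆ V⊑W O-disc⁻¹ ; O-½ = O⊆ V⊑W O-½
      ; disc*disc⁻¹≈1 = disc*disc⁻¹≈1 ; 2*½≈1 = 2*½≈1 ; Mq = M⊆ V⊑W Mq }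
      where open GoodPlace good

    module _ {q : ℕ} where

      deep-difference : ∀ {W} (good : GoodPlace q W) (local : Local K W) →
        let open NearO A B disc≉0 W local (GoodPlace.OA good) (GoodPlace.OB good) in
        ∀ P Q → Torsion P → Torsion Q → (∀ {R} → Sum₀ (proj₁ P) (neg (proj₁ Q)) R → Deep (fromℕ q) R) → P ≃ Q
      deep-difference {W} good local P Q (m , e) (n , f) deep =
        -- The exponent n + m (n + 1) has successor (m + 1)(n + 1), which annihilates the difference
        -- of the two torsion points.
        x∙y⁻¹≈ε⇒x≈y P Q (deep-torsion-free {q} Mq (P ⊞ Q⁻¹) (deep-cong (neg-involutive _) (deep-neg (deep
            (sum₀ {P} {Q⁻¹})))) (n ℕ.+ m ℕ.* suc n)
          (torsion-difference group (suc m) (suc n) {P} {Q} e f))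
        where
        open GoodPlace good
        open NearO A B disc≉0 W local OA OB
        open import Algebra.Properties.Group (AbelianGroup.group group) using (x∙y⁻¹≈ε⇒x≈y)
        Q⁻¹ : Σ Point On
        Q⁻¹ = neg (proj₁ Q) , neg-on (proj₁ Q) (proj₂ Q)

      -- Passing to the localisation supplies the inverses of principal units needed near O and
      -- preserves the congruences.
      integral-apart : ∀ {W x₁ y₁ x₂ y₂} → GoodPlace q W → let open Place W in let open Divides W in
        (on₁ : OnCubic x₁ y₁) (on₂ : OnCubic x₂ y₂) → Torsion (just (x₁ , y₁) , on₁) → Torsion (just (x₂ , y₂)
            , on₂) →
        ¬ just (x₁ , y₁) ∼ just (x₂ , y₂) → O x₁ → O y₁ → O x₂ → fromℕ q ∣ x₁ - x₂ → fromℕ q ∣ y₁ - y₂ → ⊥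
      integral-apart {W} {x₁} {y₁} {x₂} {y₂} good on₁ on₂ tors₁ tors₂ P≄Q Ox₁ Oy₁ Ox₂ x∣ y∣ = P≄Q
        (deep-difference good′ (localise-local W) (just (x₁ , y₁) , on₁) (just (x₂ , y₂) , on₂) tors₁ tors₂
          (integral-difference O-disc⁻¹ disc*disc⁻¹≈1 O-½ 2*½≈1 Mq on₁ (O⊆ ⊑l Ox₁) (O⊆ ⊑l Oy₁) (O⊆ ⊑l Ox₂)
              (∣-⊑ ⊑l x∣) (∣-⊑ ⊑l y∣) P≄Q))
        where
        ⊑l = ⊑-localise W
        good′ = good-⊑ ⊑l good
        open GoodPlace good′
        open NearO A B disc≉0 (localise W) (localise-local W) OA OB

      near-apart : ∀ {W P Q t₁ s₁ t₂ s₂} → GoodPlace q W → let open Place W in let open Divides W in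
        Torsion P → Torsion Q → ¬ P ≃ Q → Chart (proj₁ P) t₁ s₁ → Chart (proj₁ Q) t₂ s₂ →
        M t₁ → M s₁ → M t₂ → M s₂ → fromℕ q ∣ t₁ - t₂ → fromℕ q ∣ s₁ - s₂ → ⊥
      near-apart {W} {P} {Q} good tors₁ tors₂ P≄Q ch₁ ch₂ Mt₁ Ms₁ Mt₂ Ms₂ t∣ s∣ = P≄Q
        (deep-difference good′ (localise-local W) P Q tors₁ tors₂
          (near-difference Mq O-½ 2*½≈1 (proj₂ P) (proj₂ Q) ch₁ ch₂ (M⊆ ⊑l Mt₁) (M⊆ ⊑l Ms₁) (M⊆ ⊑l Mt₂)
              (M⊆ ⊑l Ms₂) (∣-⊑ ⊑l t∣) (∣-⊑ ⊑l s∣)))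
        where
        ⊑l = ⊑-localise W
        good′ = good-⊑ ⊑l good
        open GoodPlace good′
        open NearO A B disc≉0 (localise W) (localise-local W) OA OB

    module FourPoints (q : ℕ) .{{_ : ℕ.NonZero q}} (α β γ : Carrier) where
      open Apart q

      κ : Carrier
      κ = q^ 6

      κ-multiple : ∀ {W z} → Place.O W z → Divides._∣_ W (fromℕ q) (κ * z)
      κ-multiple {W} {z} Oz = q^ 5 * z , O-* (O-q^ 5) Oz , *-assoc _ _ _
        where
        open Place W
        O-q^ : ∀ n → O (q^ n)
        O-q^ zero    = O-1
        O-q^ (suc n) = O-* (O-fromℕ q) (O-q^ n)

      record IntegralPoint (W : Place K) : Set (c ⊔ ℓ) where
        open Place W
        field
          x y δ   : Carrier
          on      : OnCubic x y
          torsion : Torsion (just (x , y) , on)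
          Ox      : O x
          Oy      : O y
          Oδ      : O δ
          relation : α * x + β * y ≈ γ + κ * δ

      -- The relation is that of `IntegralPoint` multiplied by s = 1/y, so the line reads α t + β =
      -- γ s modulo κ.
      record NearPoint (W : Place K) : Set (c ⊔ ℓ) where
        open Place W
        field
          point   : Σ Point On
          t s δ   : Carrier
          torsion : Torsion point
          ch      : Chart (proj₁ point) t s
          Mt      : M t
          Ms      : M s
          Oδ      : O δ
          relation : α * t + β ≈ γ * s + κ * (δ * s)

      IntegralDistinct : ∀ {W} → IntegralPoint W → IntegralPoint W → Set (c ⊔ ℓ)
      IntegralDistinct p p′ = ¬ just (P.x , P.y) ∼ just (P′.x , P′.y)
        where
        module P = IntegralPoint p
        module P′ = IntegralPoint p′

      NearDistinct : ∀ {W} → NearPoint W → NearPoint W → Set (c ⊔ ℓ)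
      NearDistinct p p′ = ¬ NearPoint.point p ≃ NearPoint.point p′

      module _ {W : Place K} (good : GoodPlace q W) (Oα : Place.O W α) (Oγ : Place.O W γ) where
        open Place W
        open Divides W
        open GoodPlace good

        O-dd₄ : ∀ {v₁ v₂ v₃ v₄ η₁ η₂ η₃ η₄} → O v₁ → O v₂ → O v₃ → O v₄ → O η₁ → O η₂ → O η₃ → O η₄ →
          O (η₁ * ((v₂ - v₃) * (v₂ - v₄) * (v₃ - v₄)) - η₂ * ((v₁ - v₃) * (v₁ - v₄) * (v₃ - v₄)) +
             η₃ * ((v₁ - v₂) * (v₁ - v₄) * (v₂ - v₄)) - η₄ * ((v₁ - v₂) * (v₁ - v₃) * (v₂ - v₃)))
        O-dd₄ p₁ p₂ p₃ p₄ r₁ r₂ r₃ r₄ =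
          O-- (O-+ (O-- (O-* r₁ (triple p₂ p₃ p₄)) (O-* r₂ (triple p₁ p₃ p₄))) (O-* r₃ (triple p₁ p₂ p₄)))
              (O-* r₄ (triple p₁ p₂ p₃))
          where
          triple : ∀ {x y z} → O x → O y → O z → O ((x - y) * (x - z) * (y - z))
          triple Ox Oy Oz = O-* (O-* (O-- Ox Oy) (O-- Ox Oz)) (O-- Oy Oz)

        -- On the line y = (γ − α x)/β the cubic in x is monic.
        no-integral-β : ∀ {β⁻¹} → O β⁻¹ → β * β⁻¹ ≈ 1# → (p₁ p₂ p₃ p₄ : IntegralPoint W) →
          AllPairs IntegralDistinct (p₁ ∷ p₂ ∷ p₃ ∷ p₄ ∷ []) → ⊥
        no-integral-β {β⁻¹} Oβ⁻¹ ββ⁻¹ p₁ p₂ p₃ p₄ distinct =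
          separated-values W IntegralPoint.x (p₁ ∷ p₂ ∷ p₃ ∷ p₄ ∷ []) (AllPairs.map
              (λ {p} {p′} → apart p p′) distinct) λ V W⊑V fars →
            far-contradiction V 0 fars (Place.U-1 V)
              (O⊆ W⊑V (O-dd₄ (P.Ox p₁) (P.Ox p₂) (P.Ox p₃) (P.Ox p₄) (O-η p₁) (O-η p₂) (O-η p₃) (O-η p₄)))
              (divided-difference₄ _ _ _ _ κ _ _ _ _ _ _ _ _ (g≈ p₁) (g≈ p₂) (g≈ p₃) (g≈ p₄))
          where
          module P (p : IntegralPoint W) = IntegralPoint p
          apart : ∀ p p′ → IntegralDistinct p p′ → ∀ V → W ⊑ V → ¬ Divides._∣_ V (fromℕ q) (P.x p - P.x p′)
          apart p p′ P≄P′ V W⊑V q∣x = integral-apart (good-⊑ W⊑V good) (P.on p) (P.on p′) (P.torsion p)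
              (P.torsion p′) P≄P′
            (O⊆ W⊑V (P.Ox p)) (O⊆ W⊑V (P.Oy p)) (O⊆ W⊑V (P.Ox p′)) q∣x
            (V∣.∣-resp (lincomb 11 (λ α β γ κ b x y d z w e → (:- b) ∙ α :* x :+ β :* y := γ :+ κ :* d ⇒
                b ∙ α :* z :+ β :* w := γ :+ κ :* e ⇒ (y :- w) ∙ β :* b := one ⇒
                ⊢ b :* (κ :* (d :- e) :- α :* (x :- z)) := y :- w) α β γ κ β⁻¹ (P.x p) (P.y p) (P.δ p) (P.x p′)
                (P.y p′) (P.δ p′) (P.relation p) (P.relation p′) ββ⁻¹)
              (V∣.∣-* (O⊆ W⊑V Oβ⁻¹) (V∣.∣-- (κ-multiple {V} (V.O-- (O⊆ W⊑V (P.Oδ p)) (O⊆ W⊑V (P.Oδ p′))))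
                  (V∣.∣-* (O⊆ W⊑V Oα) q∣x))))
            where
            module V = Place V
            module V∣ = Divides V
          -- κ η is y² - (β⁻¹ (γ - α x))², the error of replacing y by its value on the exact line.
          -- The later definitions of `η` arise in the same way.
          η : IntegralPoint W → Carrier
          η p = β⁻¹ * P.δ p * (P.y p + β⁻¹ * (γ - α * P.x p))
          O-η : ∀ p → O (η p)
          O-η p = O-* (O-* Oβ⁻¹ (P.Oδ p)) (O-+ (P.Oy p) (O-* Oβ⁻¹ (O-- Oγ (O-* Oα (P.Ox p)))))
          g≈ : ∀ p → (B - β⁻¹ * γ * (β⁻¹ * γ)) + (A + fromℕ 2 * (β⁻¹ * γ) * (β⁻¹ * α)) * P.x p
                     + (- (β⁻¹ * α * (β⁻¹ * α))) * (P.x p * P.x p) + 1# * (P.x p * P.x p * P.x p) ≈ κ * η p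
          g≈ p = lincomb 10 (λ α β γ κ b x y d A B → (:- (α :* b :^ 2 :* x) :+ β :* b :^ 2 :* y
              :+ γ :* b :^ 2) ∙ α :* x :+ β :* y := γ :+ κ :* d ⇒
              (:- (β :* b :* y :^ 2) :+ κ :* b :* y :* d :- y :^ 2) ∙ β :* b := one ⇒
              (:- one) ∙ y :* y := x :* x :* x :+ A :* x :+ B ⇒
              ⊢ B :- b :* γ :* (b :* γ) :+ (A :+ # 2 :* (b :* γ) :* (b :* α)) :* x :+
              :- (b :* α :* (b :* α)) :* (x :* x) :+ one :* (x :* x :* x)
              := κ :* (b :* d :* (y :+ b :* (γ :- α :* x)))) α β γ κ β⁻¹ (P.x p) (P.y p) (P.δ p) A B
              (P.relation p) ββ⁻¹ (P.on p)

        -- On the line x = (γ − β y)/α the quadratic divided difference is a principal unit.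
        no-integral-α : M β → ∀ {α⁻¹} → O α⁻¹ → α * α⁻¹ ≈ 1# → (p₁ p₂ p₃ : IntegralPoint W) →
          AllPairs IntegralDistinct (p₁ ∷ p₂ ∷ p₃ ∷ []) → ⊥
        no-integral-α Mβ {α⁻¹} Oα⁻¹ αα⁻¹ p₁ p₂ p₃ distinct =
          separated-values W IntegralPoint.y (p₁ ∷ p₂ ∷ p₃ ∷ []) (AllPairs.map
              (λ {p} {p′} → apart p p′) distinct) λ V W⊑V fars →
            far-contradiction V 3 fars (M⊆ W⊑V U-u)
              (O⊆ W⊑V (O-+ (O-- (O-* (O-η p₁) (O-- (P.Oy p₂) (P.Oy p₃))) (O-* (O-η p₂) (O-- (P.Oy p₁)
                  (P.Oy p₃)))) (O-* (O-η p₃) (O-- (P.Oy p₁) (P.Oy p₂)))))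
              (divided-difference₃ _ _ _ _ κ _ _ _ _ _ _ (g≈ p₁) (g≈ p₂) (g≈ p₃))
          where
          module P (p : IntegralPoint W) = IntegralPoint p
          a b : Carrier
          a = α⁻¹ * γ
          b = α⁻¹ * β
          Oa : O a
          Oa = O-* Oα⁻¹ Oγ
          Mb : M b
          Mb = M-* Oα⁻¹ Mβ
          Ob : O b
          Ob = M⊆O Mb
          apart : ∀ p p′ → IntegralDistinct p p′ → ∀ V → W ⊑ V → ¬ Divides._∣_ V (fromℕ q) (P.y p - P.y p′)
          apart p p′ P≄P′ V W⊑V q∣y = integral-apart (good-⊑ W⊑V good) (P.on p) (P.on p′) (P.torsion p)
              (P.torsion p′) P≄P′
            (O⊆ W⊑V (P.Ox p)) (O⊆ W⊑V (P.Oy p)) (O⊆ W⊑V (P.Ox p′))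
            (V∣.∣-resp (lincomb 11 (λ α β γ κ b x y d z w e → (:- b) ∙ α :* x :+ β :* y := γ :+ κ :* d ⇒
                b ∙ α :* z :+ β :* w := γ :+ κ :* e ⇒ (x :- z) ∙ α :* b := one ⇒
                ⊢ b :* (κ :* (d :- e) :- β :* (y :- w)) := x :- z) α β γ κ α⁻¹ (P.x p) (P.y p) (P.δ p) (P.x p′)
                (P.y p′) (P.δ p′) (P.relation p) (P.relation p′) αα⁻¹)
              (V∣.∣-* (O⊆ W⊑V Oα⁻¹) (V∣.∣-- (κ-multiple {V} (V.O-- (O⊆ W⊑V (P.Oδ p)) (O⊆ W⊑V (P.Oδ p′))))
                  (V∣.∣-* (O⊆ W⊑V (M⊆O Mβ)) q∣y))))
            q∣y
            where
            module V = Place V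
            module V∣ = Divides V
          -- With X the value of x on the exact line, κ η is (x³ + A x) - (X³ + A X), where x - X =
          -- κ α⁻¹ δ.
          η : IntegralPoint W → Carrier
          η p = let X = a - b * P.y p in α⁻¹ * P.δ p * (P.x p * P.x p + P.x p * X + X * X + A)
          O-η : ∀ p → O (η p)
          O-η p = O-* (O-* Oα⁻¹ (P.Oδ p)) (O-+ (O-+ (O-+ (O-* (P.Ox p) (P.Ox p)) (O-* (P.Ox p) OX)) (O-* OX OX)) OA)
            where OX = O-- Oa (O-* Ob (P.Oy p))
          g≈ : ∀ p → (- (a * a * a) - A * a - B) + (fromℕ 3 * a * a * b + A * b) * P.y p
                     + (1# - fromℕ 3 * a * b * b) * (P.y p * P.y p) + b * b * b * (P.y p * P.y p * P.y p) ≈ κ * η p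
          g≈ p = lincomb 9 (λ κ i x y d A B a b → (y :^ 2 :* b :^ 2 :- x :* y :* b :- # 2 :* y :* a :* b
              :+ x :^ 2 :+ x :* a :+ a :^ 2 :+ A) ∙ x := a :- b :* y :+ κ :* (i :* d) ⇒
              one ∙ y :* y := x :* x :* x :+ A :* x :+ B ⇒ ⊢ :- (a :* a :* a) :- A :* a :- B
              :+ (# 3 :* a :* a :* b :+ A :* b) :* y :+ (one :- # 3 :* a :* b :* b) :* (y :* y)
              :+ b :* b :* b :* (y :* y :* y) := κ :* (i :* d :* (x :* x :+ x :* (a :- b :* y) :+ (a
              :- b :* y) :* (a :- b :* y) :+ A))) κ α⁻¹ (P.x p) (P.y p) (P.δ p) A B a b
              (lincomb 8 (λ α β γ κ i x y d → i ∙ α :* x :+ β :* y := γ :+ κ :* d ⇒ (:- x) ∙ α :* i := one ⇒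
              ⊢ x := i :* γ :- i :* β :* y :+ κ :* (i :* d)) α β γ κ α⁻¹ (P.x p) (P.y p) (P.δ p)
              (P.relation p) αα⁻¹) (P.on p)
          U-u : U ((1# - fromℕ 3 * a * b * b) + b * b * b * (P.y p₁ + P.y p₂ + P.y p₃))
          U-u = M-resp (lincomb 3 (λ a b s → ⊢ (b :* b :* s :- # 3 :* a :* b) :* b
              := one :- # 3 :* a :* b :* b :+ b :* b :* b :* s :- one) a b (P.y p₁ + P.y p₂ + P.y p₃))
            (M-* (O-- (O-* (O-* Ob Ob) (O-+ (O-+ (P.Oy p₁) (P.Oy p₂)) (P.Oy p₃))) (O-* (O-* (O-fromℕ 3) Oa) Ob)) Mb)

        -- A line with a point close to t = s = 0 has an infinitesimal constant term.
        near⇒Mβ : NearPoint W → M β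
        near⇒Mβ p = M-resp (lincomb 7 (λ α β γ κ t s d → (:- one) ∙ α :* t :+ β := γ :* s :+ κ :* (d :* s) ⇒
            ⊢ γ :* s :+ κ :* d :* s :- α :* t := β) α β γ κ (P.t) (P.s) (P.δ) (P.relation))
          (M-- (M-+ (M-* Oγ P.Ms) (M-* (O-* Oκ P.Oδ) P.Ms)) (M-* Oα P.Mt))
          where
          module P = NearPoint p
          Oκ : O κ
          Oκ = let a , Oa , e = κ-multiple {W} O-1 in O-resp (trans (sym e) (*-identityʳ κ)) (O-* (O-fromℕ q) Oa)

        -- The tangent at O is s = 0, and a line with α a unit is transversal to it. On t = (γ s -
        -- β)/α the first divided difference in s is a principal unit, so two points are already too
        -- many.
        no-near-α : ∀ {α⁻¹} → O α⁻¹ → α * α⁻¹ ≈ 1# → (p₁ p₂ : NearPoint W) → AllPairs NearDistinct (p₁ ∷ p₂ ∷ []) → ⊥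
        no-near-α {α⁻¹} Oα⁻¹ αα⁻¹ p₁ p₂ distinct =
          separated-values W NearPoint.s (p₁ ∷ p₂ ∷ []) (AllPairs.map
              (λ {p} {p′} → apart p p′) distinct) λ V W⊑V fars →
            far-contradiction V 5 fars (M⊆ W⊑V U-u) (O⊆ W⊑V (O-- (O-η p₁) (O-η p₂)))
              (divided-difference₂ _ _ _ _ κ _ _ _ _ (g≈ p₁) (g≈ p₂))
          where
          module P (p : NearPoint W) = NearPoint p
          a b : Carrier
          a = α⁻¹ * γ
          b = α⁻¹ * β
          Oa : O a
          Oa = O-* Oα⁻¹ Oγ
          Mb : M b
          Mb = M-* Oα⁻¹ (near⇒Mβ p₁)
          Ob : O b
          Ob = M⊆O Mb
          Os : ∀ p → O (P.s p)
          Os p = M⊆O (P.Ms p)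
          apart : ∀ p p′ → NearDistinct p p′ → ∀ V → W ⊑ V → ¬ Divides._∣_ V (fromℕ q) (P.s p - P.s p′)
          apart p p′ P≄P′ V W⊑V q∣s = near-apart (good-⊑ W⊑V good) (P.torsion p) (P.torsion p′) P≄P′ (P.ch p)
              (P.ch p′)
            (M⊆ W⊑V (P.Mt p)) (M⊆ W⊑V (P.Ms p)) (M⊆ W⊑V (P.Mt p′)) (M⊆ W⊑V (P.Ms p′))
            (V∣.∣-resp (lincomb 11 (λ α β γ κ b x y d z w e → (:- b) ∙ α :* x :+ β := γ :* y :+ κ :* (d :* y) ⇒
                b ∙ α :* z :+ β := γ :* w :+ κ :* (e :* w) ⇒ (x :- z) ∙ α :* b := one ⇒
                ⊢ b :* (κ :* (d :* y :- e :* w) :+ γ :* (y :- w)) := x :- z) α β γ κ α⁻¹ (P.t p) (P.s p)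
                (P.δ p) (P.t p′) (P.s p′) (P.δ p′) (P.relation p) (P.relation p′) αα⁻¹)
              (V∣.∣-* (O⊆ W⊑V Oα⁻¹) (V∣.∣-+ (κ-multiple {V} (O⊆ W⊑V (O-- (O-* (P.Oδ p) (Os p)) (O-* (P.Oδ p′)
                  (Os p′))))) (V∣.∣-* (O⊆ W⊑V Oγ) q∣s))))
            q∣s
            where
            module V∣ = Divides V
          η : NearPoint W → Carrier
          η p = let X = a * P.s p - b in α⁻¹ * P.δ p * P.s p * (P.t p * P.t p + P.t p * X + X * X + A * P.s p * P.s p)
          O-η : ∀ p → O (η p)
          O-η p = O-* (O-* (O-* Oα⁻¹ (P.Oδ p)) (Os p)) (O-+ (O-+ (O-+ (O-* Ot Ot) (O-* Ot OX)) (O-* OX OX))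
              (O-* (O-* OA (Os p)) (Os p)))
            where
            Ot = M⊆O (P.Mt p)
            OX = O-- (O-* Oa (Os p)) Ob
          g≈ : ∀ p → b * b * b + (1# - fromℕ 3 * a * b * b) * P.s p + (fromℕ 3 * a * a * b + A * b) * (P.s p * P.s p)
                     + (- (a * a * a) - A * a - B) * (P.s p * P.s p * P.s p) ≈ κ * η p
          g≈ p = lincomb 9 (λ κ i x y d A B a b → (:- (x :* x :+ x :* (a :* y :- b) :+ (a :* y
              :- b) :* (a :* y :- b) :+ A :* y :* y)) ∙ a :* y :- b :+ κ :* (i :* d :* y) := x ⇒
              one ∙ y := x :* x :* x :+ A :* x :* y :* y :+ B :* y :* y :* y ⇒
              ⊢ b :* b :* b :+ (one :- # 3 :* a :* b :* b) :* y :+ (# 3 :* a :* a :* b :+ A :* b) :* (y :* y)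
              :+ (:- (a :* a :* a) :- A :* a :- B) :* (y :* y :* y)
              := κ :* (i :* d :* y :* (x :* x :+ x :* (a :* y :- b) :+ (a :* y :- b) :* (a :* y :- b)
              :+ A :* y :* y))) κ α⁻¹ (P.t p) (P.s p) (P.δ p) A B a b
              (lincomb 8 (λ α β γ κ i x y d → (:- i) ∙ α :* x :+ β := γ :* y :+ κ :* (d :* y) ⇒
              x ∙ α :* i := one ⇒ ⊢ i :* γ :* y :- i :* β :+ κ :* (i :* d :* y)
              := x) α β γ κ α⁻¹ (P.t p) (P.s p) (P.δ p) (P.relation p) αα⁻¹)
              (chart-equation (proj₂ (P.point p)) (P.ch p))
          U-u : U ((1# - fromℕ 3 * a * b * b) + (fromℕ 3 * a * a * b + A * b) * (P.s p₁ + P.s p₂)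
                   + (- (a * a * a) - A * a - B) * (P.s p₁ * P.s p₁ + P.s p₁ * P.s p₂ + P.s p₂ * P.s p₂))
          U-u = M-resp (lincomb 6 (λ a b y z A B → ⊢ ((# 3 :* a :* a :+ A) :* (y :+ z) :- # 3 :* a :* b) :* b
              :+ ((:- (a :* a :* a) :- A :* a :- B) :* (y :+ z) :* y :+ (:- (a :* a :* a) :- A :* a
              :- B) :* z :* z) := one :- # 3 :* a :* b :* b :+ (# 3 :* a :* a :* b :+ A :* b) :* (y :+ z)
              :+ (:- (a :* a :* a) :- A :* a :- B) :* (y :* y :+ y :* z :+ z :* z)
              :- one) a b (P.s p₁) (P.s p₂) A B)
            (M-+ (M-* (O-- (O-* (O-+ (O-* (O-* (O-fromℕ 3) Oa) Oa) OA) Os₁₂) (O-* (O-* (O-fromℕ 3) Oa) Ob)) Mb)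
                 (M-+ (M-* (O-* Oc Os₁₂) (P.Ms p₁)) (M-* (O-* Oc (Os p₂)) (P.Ms p₂))))
            where
            Os₁₂ = O-+ (Os p₁) (Os p₂)
            Oc = O-- (O-- (O-neg (O-* (O-* Oa Oa) Oa)) (O-* OA Oa)) OB

        -- The line s = (α t + β)/γ is close to the inflectional tangent s = 0, which meets the
        -- cubic three times at O. The cubic in t has the principal unit 1 + A a² + B a³ as leading
        -- coefficient, so four points are needed.
        no-near-γ : M α → ∀ {γ⁻¹} → O γ⁻¹ → γ * γ⁻¹ ≈ 1# → (p₁ p₂ p₃ p₄ : NearPoint W) →
          AllPairs NearDistinct (p₁ ∷ p₂ ∷ p₃ ∷ p₄ ∷ []) → ⊥
        no-near-γ Mα {γ⁻¹} Oγ⁻¹ γγ⁻¹ p₁ p₂ p₃ p₄ distinct =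
          separated-values W NearPoint.t (p₁ ∷ p₂ ∷ p₃ ∷ p₄ ∷ []) (AllPairs.map
              (λ {p} {p′} → apart p p′) distinct) λ V W⊑V fars →
            far-contradiction V 0 fars (M⊆ W⊑V U-u)
              (O⊆ W⊑V (O-dd₄ (Ot p₁) (Ot p₂) (Ot p₃) (Ot p₄) (O-η p₁) (O-η p₂) (O-η p₃) (O-η p₄)))
              (divided-difference₄ _ _ _ _ κ _ _ _ _ _ _ _ _ (g≈ p₁) (g≈ p₂) (g≈ p₃) (g≈ p₄))
          where
          module P (p : NearPoint W) = NearPoint p
          a b : Carrier
          a = γ⁻¹ * α
          b = γ⁻¹ * β
          Ma : M a
          Ma = M-* Oγ⁻¹ Mα
          Oa : O a
          Oa = M⊆O Ma
          Ob : O b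
          Ob = M⊆O (M-* Oγ⁻¹ (near⇒Mβ p₁))
          Ot : ∀ p → O (P.t p)
          Ot p = M⊆O (P.Mt p)
          Oδs : ∀ p → O (P.δ p * P.s p)
          Oδs p = O-* (P.Oδ p) (M⊆O (P.Ms p))
          apart : ∀ p p′ → NearDistinct p p′ → ∀ V → W ⊑ V → ¬ Divides._∣_ V (fromℕ q) (P.t p - P.t p′)
          apart p p′ P≄P′ V W⊑V q∣t = near-apart (good-⊑ W⊑V good) (P.torsion p) (P.torsion p′) P≄P′ (P.ch p)
              (P.ch p′)
            (M⊆ W⊑V (P.Mt p)) (M⊆ W⊑V (P.Ms p)) (M⊆ W⊑V (P.Mt p′)) (M⊆ W⊑V (P.Ms p′)) q∣t
            (V∣.∣-resp (lincomb 11 (λ α β γ κ b x y d z w e → b ∙ α :* x :+ β := γ :* y :+ κ :* (d :* y) ⇒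
                (:- b) ∙ α :* z :+ β := γ :* w :+ κ :* (e :* w) ⇒ (y :- w) ∙ γ :* b := one ⇒
                ⊢ b :* (α :* (x :- z) :- κ :* (d :* y :- e :* w)) := y :- w) α β γ κ γ⁻¹ (P.t p) (P.s p)
                (P.δ p) (P.t p′) (P.s p′) (P.δ p′) (P.relation p) (P.relation p′) γγ⁻¹)
              (V∣.∣-* (O⊆ W⊑V Oγ⁻¹) (V∣.∣-- (V∣.∣-* (O⊆ W⊑V Oα) q∣t) (κ-multiple {V} (O⊆ W⊑V (O-- (Oδs p)
                  (Oδs p′)))))))
            where
            module V∣ = Divides V
          η : NearPoint W → Carrier
          η p = let S = a * P.t p + b in γ⁻¹ * (P.δ p * P.s p) * (A * P.t p * (S + P.s p) + B * (S * S + S * P.s p + P.s p * P.s p) - 1#)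
          O-η : ∀ p → O (η p)
          O-η p = O-* (O-* Oγ⁻¹ (Oδs p)) (O-- (O-+ (O-* (O-* OA (Ot p)) (O-+ OS Os)) (O-* OB (O-+ (O-+
              (O-* OS OS) (O-* OS Os)) (O-* Os Os)))) O-1)
            where
            Os = M⊆O (P.Ms p)
            OS = O-+ (O-* Oa (Ot p)) Ob
          g≈ : ∀ p → (B * b * b * b - b) + (A * b * b + fromℕ 3 * B * a * b * b - a) * P.t p
                     + (fromℕ 2 * A * a * b + fromℕ 3 * B * a * a * b) * (P.t p * P.t p)
                     + (1# + A * a * a + B * a * a * a) * (P.t p * P.t p * P.t p) ≈ κ * η p
          g≈ p = lincomb 9 (λ κ i x y d A B a b → (A :* x :* (a :* x :+ b :+ y) :+ B :* ((a :* x
              :+ b) :* (a :* x :+ b) :+ (a :* x :+ b) :* y :+ y :* y) :- one) ∙ a :* x :+ b :- y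
              := κ :* (i :* (d :* y)) ⇒ (:- one) ∙ y := x :* x :* x :+ A :* x :* y :* y :+ B :* y :* y :* y ⇒
              ⊢ B :* b :* b :* b :- b :+ (A :* b :* b :+ # 3 :* B :* a :* b :* b :- a) :* x
              :+ (# 2 :* A :* a :* b :+ # 3 :* B :* a :* a :* b) :* (x :* x) :+ (one :+ A :* a :* a
              :+ B :* a :* a :* a) :* (x :* x :* x) := κ :* (i :* (d :* y) :* (A :* x :* (a :* x :+ b :+ y)
              :+ B :* ((a :* x :+ b) :* (a :* x :+ b) :+ (a :* x :+ b) :* y :+ y :* y)
              :- one))) κ γ⁻¹ (P.t p) (P.s p) (P.δ p) A B a b
              (lincomb 8 (λ α β γ κ i x y d → i ∙ α :* x :+ β := γ :* y :+ κ :* (d :* y) ⇒ y ∙ γ :* i := one ⇒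
              ⊢ i :* α :* x :+ i :* β :- y := κ :* (i :* (d :* y))) α β γ κ γ⁻¹ (P.t p) (P.s p) (P.δ p)
              (P.relation p) γγ⁻¹)
              (chart-equation (proj₂ (P.point p)) (P.ch p))
          U-u : U (1# + A * a * a + B * a * a * a)
          U-u = M-resp (lincomb 3 (λ A B a → ⊢ A :* a :* a :+ B :* a :* a :* a
              := one :+ A :* a :* a :+ B :* a :* a :* a :- one) A B a)
            (M-+ (M-* (O-* OA Oa) Ma) (M-* (O-* (O-* OB Oa) Oa) Ma))

-- From a long progression to seven points on a line.

module Progressions {c ℓ} (K : AlgClosureℚ c ℓ) where
  open AlgClosureℚ K
  open LinearCombinations commRing
  open FieldProperties K
  open Places K using (_⊑_; O⊆; M⊆; ⊑-refl; ⊑-trans; ask)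
  open KernelOfReduction K
  open FourTorsionPoints K

  -- The dichotomy of `ask` for 1/x, which distinguishes units among integral elements.
  unit-or-M : ∀ W x → (∀ V → W ⊑ V → (∃ λ y → Place.O V y × x * y ≈ 1#) → ⊥) → (∀ V → W ⊑ V → Place.M V x → ⊥) → ⊥
  unit-or-M W x unit small with x ≟ 0#
  ... | yes x≈0 = small W ⊑-refl (Place.M-resp W (sym x≈0) (Place.M-0 W))
  ... | no  x≉0 with y , xy≈1 ← inverse x x≉0 = ask W y
    (λ V W⊑V Oy → unit V W⊑V (y , Oy , xy≈1))
    (λ V W⊑V z yz≈1 Mz → small V W⊑V (Place.M-resp V
        (lincomb 3 (λ x y z → (:- z) ∙ x :* y := one ⇒ x ∙ y :* z := one ⇒ ⊢ z := x) x y z xy≈1 yz≈1) Mz))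

  Dominates : Place K → Carrier → Carrier → Set (c ⊔ ℓ)
  Dominates W μ x = ∃ λ r → Place.O W r × x ≈ μ * r

  -- An element of largest absolute value: a new x is compared with the current maximum μ by asking
  -- about x/μ, and replaces it when the quotient is not finite.
  maximum : ∀ W xs → (∀ V → W ⊑ V → All (_≈ 0#) xs ⊎ (∃ λ μ → μ ≉ 0# × All (Dominates V μ) xs × Any (_≈ μ) xs)
      → ⊥) → ⊥
  maximum W []       k = k W ⊑-refl (inj₁ [])
  maximum W (x ∷ xs) k = maximum W xs extend
    where
    extend : ∀ V → W ⊑ V → All (_≈ 0#) xs ⊎ (∃ λ μ → μ ≉ 0# × All (Dominates V μ) xs × Any (_≈ μ) xs) → ⊥
    extend V W⊑V (inj₁ zeros) with x ≟ 0#
    ... | yes x≈0 = k V W⊑V (inj₁ (x≈0 ∷ zeros))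
    ... | no  x≉0 = k V W⊑V (inj₂ (x , x≉0 , (1# , Place.O-1 V , sym (*-identityʳ x))
        ∷ All.map zero-dominated zeros , here refl))
      where
      zero-dominated : ∀ {y} → y ≈ 0# → Dominates V x y
      zero-dominated y≈0 = 0# , Place.O-0 V , trans y≈0 (sym (zeroʳ x))
    extend V W⊑V (inj₂ (μ , μ≉0 , dominated , attained)) with w , μw≈1 ← inverse μ μ≉0 = ask V (x * w)
      (λ V′ V⊑V′ Oxw → k V′ (⊑-trans W⊑V V⊑V′) (inj₂ (μ , μ≉0 ,
         (x * w , Oxw , (lincomb 3 (λ x w μ → (:- x) ∙ μ :* w := one ⇒
             ⊢ x := μ :* (x :* w)) x w μ μw≈1)) ∷ All.map (λ (r , Or , e) → r , O⊆ V⊑V′ Or , e) dominated ,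
         there attained)))
      (λ V′ V⊑V′ y xwy≈1 My → k V′ (⊑-trans W⊑V V⊑V′) (inj₂ (x ,
         unit-≉0 {x} {w * y} (trans (sym (*-assoc x w y)) xwy≈1) ,
         (1# , Place.O-1 V′ , sym (*-identityʳ x)) ∷ All.map (λ { {z} (r , Or , e) →
           y * r , Place.O-* V′ (Place.M⊆O V′ My) (O⊆ V⊑V′ Or) ,
               (lincomb 6 (λ x w μ y z r → (x :* y :* r) ∙ μ :* w := one ⇒ (:- (μ :* r)) ∙ x :* w :* y := one ⇒
               one ∙ z := μ :* r ⇒ ⊢ z := x :* (y :* r)) x w μ y z r μw≈1 xwy≈1 e) }) dominated ,
         here refl)))

  module Progression (A B : Carrier) (disc≉0 : fromℕ 4 * (A * A * A) + fromℕ 27 * (B * B) ≉ 0#)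
      (q : ℕ) .{{_ : ℕ.NonZero q}} where
    open GroupLaw.Short K A B disc≉0
    open Charts A B disc≉0
    open Core A B disc≉0
    open Apart q using (q^; q^-≉0)

    module Points (α β γ : Carrier) where
      open FourPoints q α β γ

      record LinePoint : Set (c ⊔ ℓ) where
        field
          x y δ    : Carrier
          on       : OnCubic x y
          torsion  : Torsion (just (x , y) , on)
          relation : α * x + β * y ≈ γ + κ * δ

      Distinct : LinePoint → LinePoint → Set (c ⊔ ℓ)
      Distinct p p′ = ¬ just (P.x , P.y) ∼ just (P′.x , P′.y)
        where
        module P = LinePoint p
        module P′ = LinePoint p′

      Integral : Place K → LinePoint → Set (c ⊔ ℓ)
      Integral W p = O x × O y × O δ
        where
        open Place W
        open LinePoint p

      Near : Place K → LinePoint → Set (c ⊔ ℓ)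
      Near W p = O δ × (∃ λ t → ∃ λ s → Chart (just (x , y)) t s × M t × M s)
        where
        open Place W
        open LinePoint p

      Classified : Place K → LinePoint → Set (c ⊔ ℓ)
      Classified W p = Integral W p ⊎ Near W p

      classified-⊑ : ∀ {V W p} → V ⊑ W → Classified V p → Classified W p
      classified-⊑ V⊑W (inj₁ (Ox , Oy , Oδ))                  = inj₁ (O⊆ V⊑W Ox , O⊆ V⊑W Oy , O⊆ V⊑W Oδ)
      classified-⊑ V⊑W (inj₂ (Oδ , t , s , ch , Mt , Ms)) = inj₂ (O⊆ V⊑W Oδ , t , s , ch , M⊆ V⊑W Mt , M⊆ V⊑W Ms)

      -- For x finite, y infinite would put 1 = (x³ + A x + B)/y² in M. For w = 1/x in M, the
      -- element (y w)² w = 1 + A w² + B w³ is a principal unit, so y w cannot be finite; its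
      -- inverse is t = x/y, and s = t w.
      classify : ∀ W → GoodPlace q W → ∀ p → Place.O W (LinePoint.δ p) → (∀ V → W ⊑ V → Classified V p → ⊥) → ⊥
      classify W good p Oδ k = ask W x x-integral x-infinite
        where
        open LinePoint p
        x-integral : ∀ V → W ⊑ V → Place.O V x → ⊥
        x-integral V W⊑V Ox = ask V y
          (λ V′ V⊑V′ Oy → k V′ (⊑-trans W⊑V V⊑V′) (inj₁ (O⊆ V⊑V′ Ox , Oy , O⊆ (⊑-trans W⊑V V⊑V′) Oδ)))
          (λ V′ V⊑V′ w yw≈1 Mw → let open Place V′ in let open GoodPlace (good-⊑ (⊑-trans W⊑V V⊑V′) good) in let Ox = O⊆ V⊑V′ Ox in
            1∉M (M-resp (lincomb 5 (λ x y w A B → (y :* w :+ one) ∙ y :* w := one ⇒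
                (:- (w :^ 2)) ∙ y :* y := x :* x :* x :+ A :* x :+ B ⇒
                ⊢ (x :* x :* x :+ A :* x :+ B) :* w :* w := one) x y w A B yw≈1 on)
              (M-* (O-* (O-+ (O-+ (O-* (O-* Ox Ox) Ox) (O-* OA Ox)) OB) (M⊆O Mw)) Mw)))
        x-infinite : ∀ V → W ⊑ V → ∀ w → x * w ≈ 1# → Place.M V w → ⊥
        x-infinite V W⊑V w xw≈1 Mw = ask V (y * w)
          (λ V′ V⊑V′ Oyw → Place.U-disjoint V′ (M⊆ V⊑V′ U-u)
            (Place.M-resp V′ (sym u≈) (Place.M-* V′ (Place.O-* V′ Oyw Oyw) (M⊆ V⊑V′ Mw))))
          (λ V′ V⊑V′ t ywt≈1 Mt → k V′ (⊑-trans W⊑V V⊑V′) (inj₂ (O⊆ (⊑-trans W⊑V V⊑V′) Oδ , t , t * w ,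
            chart (lincomb 3 (λ y w t → one ∙ y :* w :* t := one ⇒ ⊢ t :* w :* y := one) y w t ywt≈1)
                (lincomb 4 (λ x y w t → (y :* t) ∙ x :* w := one ⇒ (:- x) ∙ y :* w :* t := one ⇒
                ⊢ x := t :* y) x y w t xw≈1 ywt≈1) ,
            Mt , Place.M-* V′ (Place.M⊆O V′ Mt) (M⊆ V⊑V′ Mw))))
          where
          open Place V
          open GoodPlace (good-⊑ W⊑V good)
          u : Carrier
          u = 1# + A * w * w + B * w * w * w
          U-u : U u
          U-u = M-resp (lincomb 3 (λ A B w → ⊢ A :* w :* w :+ B :* w :* w :* w
              := one :+ A :* w :* w :+ B :* w :* w :* w :- one) A B w)
            (M-+ (M-* (O-* OA (M⊆O Mw)) Mw) (M-* (O-* (O-* OB (M⊆O Mw)) (M⊆O Mw)) Mw))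
          u≈ : u ≈ y * w * (y * w) * w
          u≈ = lincomb 5 (λ x y w A B → (:- (x :^ 2 :* w :^ 2) :- w :^ 2 :* A :- x :* w :- one) ∙ x :* w
              := one ⇒ (:- (w :^ 3)) ∙ y :* y := x :* x :* x :+ A :* x :+ B ⇒
              ⊢ one :+ A :* w :* w :+ B :* w :* w :* w := y :* w :* (y :* w) :* w) x y w A B xw≈1 on

      classify-all : ∀ W → GoodPlace q W → ∀ ps → All (Place.O W ∘ LinePoint.δ) ps → (∀ V → W ⊑ V
          → All (Classified V) ps → ⊥) → ⊥
      classify-all W good []       []         k = k W ⊑-refl []
      classify-all W good (p ∷ ps) (Oδ ∷ Oδs) k = classify-all W good ps Oδs λ V W⊑V cs →
        classify V (good-⊑ W⊑V good) p (O⊆ W⊑V Oδ) λ V′ V⊑V′ c →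
          k V′ (⊑-trans W⊑V V⊑V′) (c ∷ All.map (λ {p} → classified-⊑ {p = p} V⊑V′) cs)

      -- Two complementary sublists, recorded through what they inherit from the list: the total
      -- length, and the properties of all members and of all pairs.
      record Split (W : Place K) (ps : List LinePoint) : Set (lsuc (c ⊔ ℓ)) where
        field
          {is ns}    : List LinePoint
          integrals  : All (Integral W) is
          nears      : All (Near W) ns
          size       : length is ℕ.+ length ns ≡ length ps
          all-is     : ∀ {P : LinePoint → Set (c ⊔ ℓ)} → All P ps → All P is
          all-ns     : ∀ {P : LinePoint → Set (c ⊔ ℓ)} → All P ps → All P ns
          distinct-is : AllPairs Distinct ps → AllPairs Distinct is
          distinct-ns : AllPairs Distinct ps → AllPairs Distinct ns

      split : ∀ {W ps} → All (Classified W) ps → Split W ps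
      split []            = record { integrals = [] ; nears = [] ; size = ≡.refl ; all-is = λ _
          → [] ; all-ns = λ _ → []
                                   ; distinct-is = λ _ → [] ; distinct-ns = λ _ → [] }
      split {W} {p ∷ ps} (inj₁ i ∷ cs) = record
        { integrals = i ∷ integrals ; nears = nears ; size = ≡.cong suc size
        ; all-is = λ { (p ∷ ps) → p ∷ all-is ps } ; all-ns = λ { (_ ∷ ps) → all-ns ps }
        ; distinct-is = λ { (d ∷ ds) → all-is d ∷ distinct-is ds } ; distinct-ns = λ { (_ ∷ ds) → distinct-ns ds } }
        where open Split (split {W} {ps} cs)
      split {W} {p ∷ ps} (inj₂ n ∷ cs) = record
        { integrals = integrals ; nears = n ∷ nears ; size = ≡.trans (ℕₚ.+-suc _ _) (≡.cong suc size)
        ; all-is = λ { (_ ∷ ps) → all-is ps } ; all-ns = λ { (p ∷ ps) → p ∷ all-ns ps }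
        ; distinct-is = λ { (_ ∷ ds) → distinct-is ds } ; distinct-ns = λ { (d ∷ ds) → all-ns d ∷ distinct-ns ds } }
        where open Split (split {W} {ps} cs)

      integral-point : ∀ {V W p} → V ⊑ W → Integral V p → IntegralPoint W
      integral-point {p = p} V⊑W (Ox , Oy , Oδ) = record
        { on = on ; torsion = torsion ; Ox = O⊆ V⊑W Ox ; Oy = O⊆ V⊑W Oy ; Oδ = O⊆ V⊑W Oδ ; relation = relation }
        where open LinePoint p

      chart-relation : ∀ {x y t s δ} → Chart (just (x , y)) t s → α * x + β * y ≈ γ + κ * δ → α * t + β
          ≈ γ * s + κ * (δ * s)
      chart-relation {x} {y} {t} {s} {δ} (chart f g) relation =
        (lincomb 9 (λ α β γ κ d x y t s → (:- (α :* t) :- β) ∙ s :* y := one ⇒ (:- (α :* s)) ∙ x := t :* y ⇒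
            s ∙ α :* x :+ β :* y := γ :+ κ :* d ⇒ ⊢ α :* t :+ β
            := γ :* s :+ κ :* (d :* s)) α β γ κ δ x y t s f g relation)

      near-point : ∀ {V W p} → V ⊑ W → Near V p → NearPoint W
      near-point {p = p} V⊑W (Oδ , t , s , ch , Mt , Ms) = record
        { point = just (x , y) , on ; torsion = torsion ; ch = ch ; Mt = M⊆ V⊑W Mt ; Ms = M⊆ V⊑W Ms ; Oδ = O⊆ V⊑W Oδ
        ; relation = chart-relation ch relation }
        where open LinePoint p

      Unit : Place K → Carrier → Set (c ⊔ ℓ)
      Unit W x = ∃ λ y → Place.O W y × x * y ≈ 1#

      unit-not-M : ∀ {V W x} → V ⊑ W → Unit V x → ¬ Place.M W x
      unit-not-M {V} {W} V⊑W (y , Oy , xy≈1) Mx = 1∉M (M-resp (trans (*-comm _ _) xy≈1) (M-* (O⊆ V⊑W Oy) Mx))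
        where open Place W

      module _ {W : Place K} (good : GoodPlace q W) (Oα : Place.O W α) (Oβ : Place.O W β) (Oγ : Place.O W γ)
               (unimodular : Unit W α ⊎ Unit W β ⊎ Unit W γ) where

        -- Four points contradict β being a unit. If β is in M, three contradict α being a unit. If
        -- both are in M, the relation at an integral point puts γ in M too, against unimodularity.
        few-integral : ∀ {is} → All (Integral W) is → AllPairs Distinct is → ¬ 4 ℕ.≤ length is
        few-integral {p₁ ∷ p₂ ∷ p₃ ∷ p₄ ∷ _} (i₁ ∷ i₂ ∷ i₃ ∷ i₄ ∷ _) ((d₁₂ ∷ d₁₃ ∷ d₁₄ ∷ _) ∷ (d₂₃ ∷ d₂₄ ∷ _)
            ∷ (d₃₄ ∷ _) ∷ _) (ℕ.s≤s (ℕ.s≤s (ℕ.s≤s (ℕ.s≤s _)))) =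
          unit-or-M W β
            (λ { V W⊑V (y , Oy , βy≈1) → no-integral-β {V} (good-⊑ W⊑V good) (O⊆ W⊑V Oα) (O⊆ W⊑V Oγ) Oy βy≈1
              (integral-point {p = p₁} W⊑V i₁) (integral-point {p = p₂} W⊑V i₂)
                  (integral-point {p = p₃} W⊑V i₃) (integral-point {p = p₄} W⊑V i₄)
              ((d₁₂ ∷ d₁₃ ∷ d₁₄ ∷ []) ∷ (d₂₃ ∷ d₂₄ ∷ []) ∷ (d₃₄ ∷ []) ∷ [] ∷ []) })
            (λ V W⊑V Mβ → unit-or-M V α
              (λ { V′ V⊑V′ (y , Oy , αy≈1) → let W⊑V′ = ⊑-trans W⊑V V⊑V′ in
                no-integral-α {V′} (good-⊑ W⊑V′ good) (O⊆ W⊑V′ Oα) (O⊆ W⊑V′ Oγ) (M⊆ V⊑V′ Mβ) Oy αy≈1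
                  (integral-point {p = p₁} W⊑V′ i₁) (integral-point {p = p₂} W⊑V′ i₂)
                      (integral-point {p = p₃} W⊑V′ i₃)
                  ((d₁₂ ∷ d₁₃ ∷ []) ∷ (d₂₃ ∷ []) ∷ [] ∷ []) })
              (λ V′ V⊑V′ Mα → let W⊑V′ = ⊑-trans W⊑V V⊑V′ in
                [ (λ u → unit-not-M W⊑V′ u Mα)
                , [ (λ u → unit-not-M W⊑V′ u (M⊆ V⊑V′ Mβ))
                  , (λ u → unit-not-M W⊑V′ u (M-γ V′ W⊑V′ Mα (M⊆ V⊑V′ Mβ))) ]′ ]′ unimodular))
          where
          M-γ : ∀ V → W ⊑ V → Place.M V α → Place.M V β → Place.M V γ
          M-γ V W⊑V Mα Mβ = M-resp (lincomb 7 (λ α β γ κ d x y → one ∙ α :* x :+ β :* y := γ :+ κ :* d ⇒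
              ⊢ x :* α :+ y :* β :- κ :* d := γ) α β γ κ δ x y relation)
            (M-- (M-+ (M-* (O⊆ W⊑V (proj₁ i₁)) Mα) (M-* (O⊆ W⊑V (proj₁ (proj₂ i₁))) Mβ))
                 (Divides.∣⇒M V (GoodPlace.Mq (good-⊑ W⊑V good)) (κ-multiple {V} (O⊆ W⊑V (proj₂ (proj₂ i₁))))))
            where
            open Place V
            open LinePoint p₁

        -- Two points contradict α being a unit. Otherwise α is in M, as β always is near O, so γ
        -- must be the unit, and four points contradict that.
        few-near : ∀ {ns} → All (Near W) ns → AllPairs Distinct ns → ¬ 4 ℕ.≤ length ns
        few-near {p₁ ∷ p₂ ∷ p₃ ∷ p₄ ∷ _} (n₁ ∷ n₂ ∷ n₃ ∷ n₄ ∷ _) ((d₁₂ ∷ d₁₃ ∷ d₁₄ ∷ _) ∷ (d₂₃ ∷ d₂₄ ∷ _)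
            ∷ (d₃₄ ∷ _) ∷ _) (ℕ.s≤s (ℕ.s≤s (ℕ.s≤s (ℕ.s≤s _)))) =
          unit-or-M W α
            (λ { V W⊑V (y , Oy , αy≈1) → no-near-α {V} (good-⊑ W⊑V good) (O⊆ W⊑V Oα) (O⊆ W⊑V Oγ) Oy αy≈1
              (near-point {p = p₁} W⊑V n₁) (near-point {p = p₂} W⊑V n₂) ((d₁₂ ∷ []) ∷ [] ∷ []) })
            (λ V W⊑V Mα →
              [ (λ u → unit-not-M W⊑V u Mα)
              , [ (λ u → unit-not-M W⊑V u (near⇒Mβ {V} (good-⊑ W⊑V good) (O⊆ W⊑V Oα) (O⊆ W⊑V Oγ)
                  (near-point {p = p₁} W⊑V n₁)))
                , (λ { (y , Oy , γy≈1) → no-near-γ {V} (good-⊑ W⊑V good) (O⊆ W⊑V Oα) (O⊆ W⊑V Oγ) Mα (O⊆ W⊑V Oy) γy≈1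
                    (near-point {p = p₁} W⊑V n₁) (near-point {p = p₂} W⊑V n₂) (near-point {p = p₃} W⊑V n₃)
                        (near-point {p = p₄} W⊑V n₄)
                    ((d₁₂ ∷ d₁₃ ∷ d₁₄ ∷ []) ∷ (d₂₃ ∷ d₂₄ ∷ []) ∷ (d₃₄ ∷ []) ∷ [] ∷ []) }) ]′ ]′ unimodular)

      too-many : ∀ W → GoodPlace q W → Place.O W α → Place.O W β → Place.O W γ → Unit W α ⊎ Unit W β ⊎ Unit W γ →
        ∀ ps → All (Place.O W ∘ LinePoint.δ) ps → AllPairs Distinct ps → ¬ 7 ℕ.≤ length ps
      too-many W good Oα Oβ Oγ unimodular ps Oδs distinct 7≤ = classify-all W good ps Oδs λ V W⊑V cs →
        few V W⊑V (split {V} {ps} cs)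
        where
        unit-⊑ : ∀ {V x} → W ⊑ V → Unit W x → Unit V x
        unit-⊑ W⊑V (y , Oy , e) = y , O⊆ W⊑V Oy , e
        pigeonhole : ∀ m n → 7 ℕ.≤ m ℕ.+ n → 4 ℕ.≤ m ⊎ 4 ℕ.≤ n
        pigeonhole m n 7≤m+n with 4 ℕ.≤? m
        ... | yes 4≤m = inj₁ 4≤m
        ... | no  4≰m = inj₂ (ℕₚ.+-cancelˡ-≤ 3 4 n (ℕₚ.≤-trans 7≤m+n (ℕₚ.+-monoˡ-≤ n (ℕₚ.≤-pred (ℕₚ.≰⇒> 4≰m)))))
        few : ∀ V → W ⊑ V → Split V ps → ⊥
        few V W⊑V sp =
          [ few-integral {V} good′ (O⊆ W⊑V Oα) (O⊆ W⊑V Oβ) (O⊆ W⊑V Oγ) unimodular′ integrals (distinct-is distinct)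
          , few-near {V} good′ (O⊆ W⊑V Oα) (O⊆ W⊑V Oβ) (O⊆ W⊑V Oγ) unimodular′ nears (distinct-ns distinct) ]′
          (pigeonhole (length is) (length ns) (≡.subst (7 ℕ.≤_) (≡.sym size) 7≤))
          where
          open Split sp
          good′ = good-⊑ W⊑V good
          unimodular′ : Unit V α ⊎ Unit V β ⊎ Unit V γ
          unimodular′ = [ inj₁ ∘ unit-⊑ W⊑V , [ inj₂ ∘ inj₁ ∘ unit-⊑ W⊑V , inj₂ ∘ inj₂ ∘ unit-⊑ W⊑V ]′ ]′ unimodular

      too-many-indexed : ∀ W → GoodPlace q W → Place.O W α → Place.O W β → Place.O W γ
          → Unit W α ⊎ Unit W β ⊎ Unit W γ →
        (point : Fin 7 → LinePoint) → (∀ i → Place.O W (LinePoint.δ (point i))) → ¬ (∀ {i j} → ¬ i ≡ j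
            → Distinct (point i) (point j))
      too-many-indexed W good Oα Oβ Oγ unimodular point Oδ distinct =
        too-many W good Oα Oβ Oγ unimodular (List.tabulate point) (Allₚ.tabulate⁺ {f = point} Oδ)
            (AllPairsₚ.tabulate⁺ {f = point} (λ {i} {j} → distinct {i} {j})) ℕₚ.≤-refl

    fromℕ-q^ : ∀ n → fromℕ (q ℕ.^ n) ≈ q^ n
    fromℕ-q^ zero    = +-identityʳ 1#
    fromℕ-q^ (suc n) = trans (fromℕ-* q (q ℕ.^ n)) (*-congˡ (fromℕ-q^ n))

    -- The largest index used: a first index of at most 2, followed by six further ones at distance
    -- q⁶.
    bound : ℕ
    bound = 2 ℕ.+ 6 ℕ.* q ℕ.^ 6

    module _ {W : Place K} (good : GoodPlace q W) (α β a b : Carrier) (b≉0 : b ≉ 0#)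
             (terms : ∀ k → 1 ℕ.≤ k → k ℕ.≤ bound → ∃ λ x → ∃ λ y → Σ (OnCubic x y) λ on →
                      Torsion (just (x , y) , on) × α * x + β * y ≈ a + fromℕ k * b) where

      -- The terms k₀ + m q⁶, after division by the largest coefficient μ.
      spaced-terms : ∀ {V} → W ⊑ V → ∀ μ → μ ≉ 0# → ∀ {α′ β′ γ b′} k₀ → 1 ℕ.≤ k₀ → k₀ ℕ.≤ 2 →
        α ≈ μ * α′ → β ≈ μ * β′ → a + fromℕ k₀ * b ≈ μ * γ → b ≈ μ * b′ →
        Place.O V α′ → Place.O V β′ → Place.O V γ → Place.O V b′ →
        (let open Points α′ β′ γ in Unit V α′ ⊎ Unit V β′ ⊎ Unit V γ) → ⊥
      spaced-terms {V} W⊑V μ μ≉0 {α′} {β′} {γ} {b′} k₀ 1≤k₀ k₀≤2 α≈ β≈ γ≈ b≈ Oα Oβ Oγ Ob unimodular =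
        too-many-indexed V (good-⊑ W⊑V good) Oα Oβ Oγ unimodular point
          (λ i → Place.O-* V (Place.O-fromℕ V (toℕ i)) Ob) (λ {i} {j} → distinct {i} {j})
        where
        open Points α′ β′ γ
        open FourPoints q α′ β′ γ using (κ)
        position : ℕ → ℕ
        position m = k₀ ℕ.+ m ℕ.* q ℕ.^ 6
        scaled : ∀ {x y} m → α * x + β * y ≈ a + fromℕ (position m) * b → α′ * x + β′ * y ≈ γ + κ * (fromℕ m * b′)
        scaled {x} {y} m e = cancelˡ μ≉0
          (lincomb 15 (λ α β a b μ c d γ z x y κ k m n → one ∙ α :* x :+ β :* y := a :+ n :* b ⇒
              (μ :* z) ∙ n := k :+ m :* κ ⇒ (:- x) ∙ α := μ :* c ⇒ (:- y) ∙ β := μ :* d ⇒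
              one ∙ a :+ k :* b := μ :* γ ⇒ (:- k :+ n) ∙ b := μ :* z ⇒
              ⊢ μ :* (c :* x :+ d :* y) := μ :* (γ :+ κ :* (m :* z))) α β a b μ α′ β′ γ b′ x y κ (fromℕ k₀)
              (fromℕ m) (fromℕ (position m)) e (trans (fromℕ-+ k₀ _) (+-congˡ (trans (fromℕ-* m _) (*-congˡ
              (fromℕ-q^ 6))))) α≈ β≈ γ≈ b≈)
        term : ∀ (i : Fin 7) → ∃ λ x → ∃ λ y → Σ (OnCubic x y) λ on →
               Torsion (just (x , y) , on) × α * x + β * y ≈ a + fromℕ (position (toℕ i)) * b
        term i = terms (position (toℕ i)) (ℕₚ.≤-trans 1≤k₀ (ℕₚ.m≤m+n k₀ _))
          (ℕₚ.+-mono-≤ k₀≤2 (ℕₚ.*-monoˡ-≤ (q ℕ.^ 6) (ℕₚ.≤-pred (Finₚ.toℕ<n i))))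
        point : Fin 7 → LinePoint
        point i = let _ , _ , on , torsion , e = term i in record
          { δ = fromℕ (toℕ i) * b′ ; on = on ; torsion = torsion ; relation = scaled (toℕ i) e }
        b′≉0 : b′ ≉ 0#
        b′≉0 b′≈0 = b≉0 (trans b≈ (trans (*-congˡ b′≈0) (zeroʳ μ)))
        distinct : ∀ {i j} → ¬ i ≡ j → Distinct (point i) (point j)
        -- Equal points have equal left sides in their relations, so κ b′ i = κ b′ j, and
        -- characteristic zero gives i = j.
        distinct {i} {j} i≢j (aff x≈ y≈) = i≢j (Finₚ.toℕ-injective (ℤₚ.+-injective (fromℤ-injective
          (cancelˡ b′≉0 (cancelˡ (q^-≉0 6)
            (lincomb 11 (λ c d γ κ z x y u v m n → (:- one) ∙ c :* x :+ d :* y := γ :+ κ :* (m :* z) ⇒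
                one ∙ c :* u :+ d :* v := γ :+ κ :* (n :* z) ⇒ c ∙ x := u ⇒ d ∙ y := v ⇒
                ⊢ κ :* (z :* m) := κ :* (z :* n)) α′ β′ γ κ b′ (P.x i) (P.y i) (P.x j) (P.y j) (fromℕ (toℕ i))
                (fromℕ (toℕ j)) (P.relation i) (P.relation j) x≈ y≈))))))
          where module P (i : Fin 7) = LinePoint (point i)

      -- Two consecutive terms c₁ and c₂ enter the maximum: their difference b is then integral
      -- after division by μ. If c₂ is the maximum, the spaced terms start with it instead of c₁, so
      -- that γ is a unit. All four entries vanishing would make b zero.
      no-long-progression : ⊥
      no-long-progression = maximum W (α ∷ β ∷ c₁ ∷ c₂ ∷ []) scale
        where
        c₁ c₂ : Carrier
        c₁ = a + fromℕ 1 * b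
        c₂ = a + fromℕ 2 * b
        unit : ∀ {V μ x r} → μ ≉ 0# → x ≈ μ * r → x ≈ μ → ∃ λ y → Place.O V y × r * y ≈ 1#
        unit {V} {μ} {x} {r} μ≉0 x≈μr x≈μ = 1# , Place.O-1 V ,
          cancelˡ μ≉0 (lincomb 3 (λ μ x r → (:- one) ∙ x := μ :* r ⇒ one ∙ x := μ ⇒
              ⊢ μ :* (r :* one) := μ :* one) μ x r x≈μr x≈μ)
        scale : ∀ V → W ⊑ V → All (_≈ 0#) (α ∷ β ∷ c₁ ∷ c₂ ∷ []) ⊎
                (∃ λ μ → μ ≉ 0# × All (Dominates V μ) (α ∷ β ∷ c₁ ∷ c₂ ∷ []) × Any (_≈ μ) (α ∷ β ∷ c₁ ∷ c₂ ∷ [])) → ⊥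
        scale V W⊑V (inj₁ (_ ∷ _ ∷ c₁≈0 ∷ c₂≈0 ∷ [])) = b≉0
            (lincomb 2 (λ a b → (:- one) ∙ a :+ one :* b := # 0 ⇒ one ∙ a :+ # 2 :* b := # 0 ⇒
            ⊢ b := # 0) a b (trans (+-congˡ (*-congʳ (sym (+-identityʳ 1#)))) c₁≈0) c₂≈0)
        scale V W⊑V (inj₂ (μ , μ≉0 , (α′ , Oα , α≈) ∷ (β′ , Oβ , β≈) ∷ (γ₁ , Oγ₁ , c₁≈) ∷ (γ₂ , Oγ₂ , c₂≈)
            ∷ [] , attained)) = choose attained
          where
          b≈ : b ≈ μ * (γ₂ - γ₁)
          b≈ = lincomb 6 (λ a b μ c d n → b ∙ n := one ⇒ (:- one) ∙ a :+ n :* b := μ :* c ⇒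
              one ∙ a :+ # 2 :* b := μ :* d ⇒ ⊢ b := μ :* (d :- c)) a b μ γ₁ γ₂ (fromℕ 1)
              (+-identityʳ 1#) c₁≈ c₂≈
          Ob′ = Place.O-- V Oγ₂ Oγ₁
          first = spaced-terms W⊑V μ μ≉0 1 (ℕ.s≤s ℕ.z≤n) (ℕ.s≤s ℕ.z≤n) α≈ β≈ c₁≈ b≈ Oα Oβ Oγ₁ Ob′
          second = spaced-terms W⊑V μ μ≉0 2 (ℕ.s≤s ℕ.z≤n) ℕₚ.≤-refl α≈ β≈ c₂≈ b≈ Oα Oβ Oγ₂ Ob′
          choose : Any (_≈ μ) (α ∷ β ∷ c₁ ∷ c₂ ∷ []) → ⊥
          choose (here e)                         = first (inj₁ (unit {V} μ≉0 α≈ e))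
          choose (there (here e))                 = first (inj₂ (inj₁ (unit {V} μ≉0 β≈ e)))
          choose (there (there (here e)))         = first (inj₂ (inj₂ (unit {V} μ≉0 c₁≈ e)))
          choose (there (there (there (here e)))) = second (inj₂ (inj₂ (unit {V} μ≉0 c₂≈ e)))

-- Reduction to a short Weierstrass equation of discriminant 1.

module ShortWeierstrassForm {c ℓ} (K : AlgClosureℚ c ℓ) where
  open AlgClosureℚ K
  open LinearCombinations commRing
  open FieldProperties K
  open KernelOfReduction K
  open FourTorsionPoints K
  open Elliptic K using (Weierstrass; module Curve)

  root₁₂ : ∀ d → ∃ λ u → u * u * u * u * (u * u * u * u) * (u * u * u * u) ≈ d
  -- The polynomial is T¹² - d: eleven zero coefficients follow -d, and `algClosed` appends the
  -- leading 1.
  root₁₂ d with u , e ← algClosed (- d) (0# ∷ 0# ∷ 0# ∷ 0# ∷ 0# ∷ 0# ∷ 0# ∷ 0# ∷ 0# ∷ 0# ∷ 0# ∷ []) = u ,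
    (lincomb 2 (λ d u → one ∙ :- d :+ u :* (# 0 :+ u :* (# 0 :+ u :* (# 0 :+ u :* (# 0 :+ u :* (# 0
        :+ u :* (# 0 :+ u :* (# 0 :+ u :* (# 0 :+ u :* (# 0 :+ u :* (# 0 :+ u :* (# 0 :+ u :* (one
        :+ u :* # 0)))))))))))) := # 0 ⇒ ⊢ u :* u :* u :* u :* (u :* u :* u :* u) :* (u :* u :* u :* u)
        := d) d u e)

  module Reduction (E : Weierstrass) (Δ≉0 : Curve.IsEllipticCurve E) (s : Carrier) (6s≈1 : fromℕ 6 * s ≈ 1#) where
    open Weierstrass E
    open Curve E

    u : Carrier
    u = proj₁ (root₁₂ Δ)

    u≉0 : u ≉ 0#
    u≉0 u≈0 = Δ≉0 (lincomb 2 (λ u d → (:- one) ∙ u :* u :* u :* u :* (u :* u :* u :* u) :* (u :* u :* u :* u)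
        := d ⇒ (u :^ 11) ∙ u := # 0 ⇒ ⊢ d := # 0) u Δ (proj₂ (root₁₂ Δ)) u≈0)

    w : Carrier
    w = proj₁ (inverse u u≉0)

    uw≈1 : u * w ≈ 1#
    uw≈1 = proj₂ (inverse u u≉0)

    -- With s = 1/6 these are the classical shift ρ = b₂/12 and coefficients A₀ = -c₄/48 and B₀ =
    -- -c₆/864. The powers of w = 1/u rescale them so that the discriminant becomes Δ/u¹² = 1.
    c₆ ρ A₀ B₀ A B : Carrier
    c₆ = fromℕ 36 * b₂ * b₄ - b₂ * b₂ * b₂ - fromℕ 216 * b₆
    ρ  = fromℕ 3 * s * s * b₂
    A₀ = - (fromℕ 27 * (s * s * s * s) * c₄)
    B₀ = - (fromℕ 9 * (s * s * s * s * s) * c₆)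
    A  = A₀ * (w * w * w * w)
    B  = B₀ * (w * w * w * w * w * w)

    2·3s≈1 : fromℕ 2 * (fromℕ 3 * s) ≈ 1#
    2·3s≈1 = lincomb 1 (λ s → one ∙ # 6 :* s := one ⇒ ⊢ # 2 :* (# 3 :* s) := one) s 6s≈1

    12ρ≈b₂ : fromℕ 12 * ρ ≈ b₂
    12ρ≈b₂ = lincomb 2 (λ s b → (# 6 :* s :* b :+ b) ∙ # 6 :* s := one ⇒
        ⊢ # 12 :* (# 3 :* s :* s :* b) := b) s b₂ 6s≈1

    48A₀≈-c₄ : fromℕ 48 * A₀ ≈ - c₄
    48A₀≈-c₄ = lincomb 2 (λ s b → (:- (# 216 :* s :^ 3 :* b) :- # 36 :* s :^ 2 :* b :- # 6 :* s :* b
        :- b) ∙ # 6 :* s := one ⇒ ⊢ # 48 :* (:- (# 27 :* (s :* s :* s :* s) :* b)) := :- b) s c₄ 6s≈1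

    864B₀≈-c₆ : fromℕ 864 * B₀ ≈ - c₆
    864B₀≈-c₆ = lincomb 2 (λ s b → (:- (# 1296 :* s :^ 4 :* b) :- # 216 :* s :^ 3 :* b :- # 36 :* s :^ 2 :* b
        :- # 6 :* s :* b :- b) ∙ # 6 :* s := one ⇒ ⊢ # 864 :* (:- (# 9 :* (s :* s :* s :* s :* s) :* b))
        := :- b) s c₆ 6s≈1

    Δw¹²≈1 : Δ * (w * w * w * w * (w * w * w * w) * (w * w * w * w)) ≈ 1#
    Δw¹²≈1 = lincomb 3 (λ p r d → (:- (r :^ 3)) ∙ p :* p :* p := d ⇒
        (p :^ 2 :* r :^ 2 :+ p :* r :+ one) ∙ p :* r := one ⇒
        ⊢ d :* (r :* r :* r) := one) (u * u * u * u) (w * w * w * w) Δ (proj₂ (root₁₂ Δ))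
      (lincomb 2 (λ u w → (u :^ 3 :* w :^ 3 :+ u :^ 2 :* w :^ 2 :+ u :* w :+ one) ∙ u :* w := one ⇒
          ⊢ u :* u :* u :* u :* (w :* w :* w :* w) := one) u w uw≈1)

    1728Δ≈c₄³-c₆² : fromℕ 1728 * Δ ≈ c₄ * c₄ * c₄ - c₆ * c₆
    1728Δ≈c₄³-c₆² = lincomb 4 (λ b₂ b₄ b₆ b₈ → (:- (# 432 :* b₂ :^ 2)) ∙ # 4 :* b₈ := b₂ :* b₆ :- b₄ :* b₄ ⇒
        ⊢ # 1728 :* (:- (b₂ :* b₂ :* b₈) :- # 8 :* (b₄ :* b₄ :* b₄) :- # 27 :* (b₆ :* b₆)
        :+ # 9 :* b₂ :* b₄ :* b₆) := (b₂ :* b₂ :- # 24 :* b₄) :* (b₂ :* b₂ :- # 24 :* b₄) :* (b₂ :* b₂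
        :- # 24 :* b₄) :- (# 36 :* b₂ :* b₄ :- b₂ :* b₂ :* b₂ :- # 216 :* b₆) :* (# 36 :* b₂ :* b₄
        :- b₂ :* b₂ :* b₂ :- # 216 :* b₆)) b₂ b₄ b₆ b₈
       -- The relation 4 b₈ = b₂ b₆ - b₄², the only one among the bᵢ that the identity uses.
       (lincomb 5 (λ a b c d e → ⊢ # 4 :* (a :* a :* e :+ # 4 :* b :* e :- a :* c :* d :+ b :* (c :* c)
           :- d :* d) := (a :* a :+ # 4 :* b) :* (c :* c :+ # 4 :* e) :- (# 2 :* d :+ a :* c) :* (# 2 :* d
           :+ a :* c)) a₁ a₂ a₃ a₄ a₆)

    disc₀ : (fromℕ 4 * (A₀ * A₀ * A₀) + fromℕ 27 * (B₀ * B₀)) * - fromℕ 16 ≈ Δ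
    disc₀ = cancelˡ (char0 1727)
      (lincomb 5 (λ A₀ B₀ c₄ c₆ D → (:- (# 2304 :* A₀ :^ 2) :+ # 48 :* A₀ :* c₄ :- c₄ :^ 2) ∙ # 48 :* A₀
          := :- c₄ ⇒ (:- (# 864 :* B₀) :+ c₆) ∙ # 864 :* B₀ := :- c₆ ⇒
          (:- one) ∙ # 1728 :* D := c₄ :* c₄ :* c₄ :- c₆ :* c₆ ⇒
          ⊢ # 1728 :* ((# 4 :* (A₀ :* A₀ :* A₀) :+ # 27 :* (B₀ :* B₀)) :* (:- # 16))
          := # 1728 :* D) A₀ B₀ c₄ c₆ Δ 48A₀≈-c₄ 864B₀≈-c₆ 1728Δ≈c₄³-c₆²)

    disc*-16≈1 : (fromℕ 4 * (A * A * A) + fromℕ 27 * (B * B)) * - fromℕ 16 ≈ 1#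
    disc*-16≈1 = lincomb 4 (λ A₀ B₀ w D → (w :* w :* w :* w :* (w :* w :* w :* w) :* (w :* w :* w :* w)) ∙
        (# 4 :* (A₀ :* A₀ :* A₀) :+ # 27 :* (B₀ :* B₀)) :* (:- # 16) := D ⇒
        one ∙ D :* (w :* w :* w :* w :* (w :* w :* w :* w) :* (w :* w :* w :* w)) := one ⇒
        ⊢ (# 4 :* (A₀ :* (w :* w :* w :* w) :* (A₀ :* (w :* w :* w :* w)) :* (A₀ :* (w :* w :* w :* w)))
        :+ # 27 :* (B₀ :* (w :* w :* w :* w :* w :* w) :* (B₀ :* (w :* w :* w :* w :* w :* w)))) :* (:- # 16)
        := one) A₀ B₀ w Δ disc₀ Δw¹²≈1

    disc≉0 : fromℕ 4 * (A * A * A) + fromℕ 27 * (B * B) ≉ 0#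
    disc≉0 = unit-≉0 disc*-16≈1

    open GroupLaw.Short K A B disc≉0 renaming (neg to opposite)
    open Charts A B disc≉0
    open Core A B disc≉0 using (Torsion)

    -- `X` and `Y` complete the cube and the square (3s is 1/2) and rescale by w² and w³.
    X : Carrier → Carrier
    X x = (x + ρ) * (w * w)

    Y : Carrier → Carrier → Carrier
    Y x y = (y + (a₁ * x + a₃) * (fromℕ 3 * s)) * (w * w * w)

    φ : Maybe (Carrier × Carrier) → Maybe (Carrier × Carrier)
    φ nothing        = nothing
    φ (just (x , y)) = just (X x , Y x y)

    12p≈ : ∀ x → fromℕ 12 * (x + ρ) ≈ fromℕ 12 * x + b₂
    12p≈ x = lincomb 3 (λ x ρ b → one ∙ # 12 :* ρ := b ⇒ ⊢ # 12 :* (x :+ ρ) := # 12 :* x :+ b) x ρ b₂ 12ρ≈b₂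

    2r≈ : ∀ x y → fromℕ 2 * (y + (a₁ * x + a₃) * (fromℕ 3 * s)) ≈ fromℕ 2 * y + a₁ * x + a₃
    2r≈ x y = lincomb 5 (λ x y a b s → (x :* a :+ b) ∙ # 2 :* (# 3 :* s) := one ⇒
        ⊢ # 2 :* (y :+ (a :* x :+ b) :* (# 3 :* s)) := # 2 :* y :+ a :* x :+ b) x y a₁ a₃ s 2·3s≈1

    completed : ∀ {x y} → OnCurve x y → let x₀ = x + ρ ; y₀ = y + (a₁ * x + a₃) * (fromℕ 3 * s) in
                y₀ * y₀ ≈ x₀ * x₀ * x₀ + A₀ * x₀ + B₀
    completed {x} {y} on = cancelˡ (char0 1727)
      (lincomb 14 (λ x y p r A B a₁ a₂ a₃ a₄ a₆ b₂ b₄ b₆ → (:- (# 144 :* x :^ 2) :- # 144 :* x :* p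
          :- # 144 :* x :* a₂ :+ # 12 :* x :* b₂ :+ # 72 :* y :* a₁ :- # 144 :* p :^ 2 :- # 12 :* p :* b₂
          :- # 72 :* r :* a₁ :- # 36 :* a₁ :* a₃ :+ # 2 :* b₂ :^ 2 :- # 144 :* a₄) ∙ # 12 :* p
          := # 12 :* x :+ b₂ ⇒ (# 432 :* p :* a₁ :- # 36 :* a₁ :* b₂ :+ # 864 :* y :+ # 864 :* r
          :+ # 432 :* a₃) ∙ # 2 :* r := # 2 :* y :+ a₁ :* x :+ a₃ ⇒
          (:- (# 36 :* p)) ∙ # 48 :* A := :- (b₂ :* b₂ :- # 24 :* b₄) ⇒
          (:- (# 2)) ∙ # 864 :* B := :- (# 36 :* b₂ :* b₄ :- b₂ :* b₂ :* b₂ :- # 216 :* b₆) ⇒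
          (:- (# 432 :* x :* p) :+ # 36 :* x :* b₂) ∙ b₂ := a₁ :* a₁ :+ # 4 :* a₂ ⇒
          (:- (# 864 :* p) :+ # 72 :* b₂) ∙ b₄ := # 2 :* a₄ :+ a₁ :* a₃ ⇒
          (:- (# 432)) ∙ b₆ := a₃ :* a₃ :+ # 4 :* a₆ ⇒ (# 1728) ∙ y :* y :+ a₁ :* x :* y :+ a₃ :* y
          := x :* x :* x :+ a₂ :* (x :* x) :+ a₄ :* x :+ a₆ ⇒
          ⊢ # 1728 :* (r :* r) := # 1728 :* (p :* p :* p :+ A :* p :+ B)) x y (x + ρ) (y + (a₁ * x + a₃) *
          (fromℕ 3 * s)) A₀ B₀ a₁ a₂ a₃ a₄ a₆ b₂ b₄ b₆
         (12p≈ x) (2r≈ x y)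
         48A₀≈-c₄ 864B₀≈-c₆ refl refl refl on)

    φ-on : ∀ {x y} → OnCurve x y → On (φ (just (x , y)))
    φ-on {x} {y} on = lincomb 5 (λ p r A B w → (w :^ 6) ∙ r :* r := p :* p :* p :+ A :* p :+ B ⇒
        ⊢ r :* (w :* w :* w) :* (r :* (w :* w :* w)) := p :* (w :* w) :* (p :* (w :* w)) :* (p :* (w :* w))
        :+ A :* (w :* w :* w :* w) :* (p :* (w :* w)) :+ B :* (w :* w :* w :* w :* w :* w)) (x + ρ) (y +
        (a₁ * x + a₃) * (fromℕ 3 * s)) A₀ B₀ w (completed on)

    -- The slope of the image of a line of slope m.
    slope₀ : Carrier → Carrier
    slope₀ m = (m + a₁ * (fromℕ 3 * s)) * w

    image-third : ∀ m {x₁ y₁ x₂ y₂} → On (φ (just (x₁ , y₁))) → Slope (slope₀ m) (X x₁) (Y x₁ y₁) (X x₂) (Y x₂ y₂) →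
      Sum₀ (φ (just (x₁ , y₁))) (φ (just (x₂ , y₂))) (opposite (φ (just (sumX m x₁ x₂
          , sumY m x₁ y₁ (sumX m x₁ x₂)))))
    image-third m {x₁} {y₁} {x₂} {y₂} on m-slope = cong₃ (aff x₃≈
      (lincomb 10 (λ m w h x y z t a b ρ → (:- (w :* h :* a) :+ m :* w :+ w :* a) ∙ t := (z :+ ρ) :* (w :* w) ⇒
          (:- (w :^ 3 :* a :* ρ) :+ w :^ 3 :* b :+ w :* t :* a) ∙ # 2 :* h := one ⇒
          ⊢ (m :+ a :* h) :* w :* t :+ ((y :+ (a :* x :+ b) :* h) :* (w :* w :* w) :- (m
          :+ a :* h) :* w :* ((x :+ ρ) :* (w :* w))) := :- ((:- ((m :+ a) :* z) :- (y :- m :* x) :- b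
          :+ (a :* z :+ b) :* h) :* (w :* w :* w))) m w (fromℕ 3 * s) x₁ y₁ (sumX m x₁ x₂)
          (slope₀ m * slope₀ m - X x₁ - X x₂) a₁ a₃ ρ x₃≈ 2·3s≈1))
      (on-line (slope-line on m-slope))
      where
      ρ≈ : a₁ * (fromℕ 3 * s) * (a₁ * (fromℕ 3 * s)) - ρ - ρ ≈ - a₂ + ρ
      ρ≈ = cancelˡ (char0 3) (lincomb 4 (λ a b h ρ → (:- (# 4 :* h :^ 2)) ∙ # 12 :* ρ := a :* a :+ # 4 :* b ⇒
          (:- (# 8 :* b :* h) :+ # 24 :* h :* ρ :- # 4 :* b :+ # 12 :* ρ) ∙ # 2 :* h := one ⇒
          ⊢ # 4 :* (a :* h :* (a :* h) :- ρ :- ρ) := # 4 :* (:- b :+ ρ)) a₁ a₂ (fromℕ 3 * s) ρ 12ρ≈b₂ 2·3s≈1)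
      x₃≈ : slope₀ m * slope₀ m - X x₁ - X x₂ ≈ X (sumX m x₁ x₂)
      x₃≈ = lincomb 8 (λ m w h x y a b ρ → (w :^ 2) ∙ a :* h :* (a :* h) :- ρ :- ρ := :- b :+ ρ ⇒
          (m :* w :^ 2 :* a) ∙ # 2 :* h := one ⇒ ⊢ (m :+ a :* h) :* w :* ((m :+ a :* h) :* w) :- (x
          :+ ρ) :* (w :* w) :- (y :+ ρ) :* (w :* w) := (m :* m :+ a :* m :- b :- x :- y
          :+ ρ) :* (w :* w)) m w (fromℕ 3 * s) x₁ x₂ a₁ a₂ ρ ρ≈ 2·3s≈1

    -- Addition on E is only a relation; it is carried over to the short model, where the group
    -- axioms are at hand.
    add-image : ∀ {P Q R} → On (φ P) → On (φ Q) → Add P Q R → Sum₀ (φ P) (φ Q) (opposite (φ R))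
    add-image onP onQ (O+ Q) = O₁ (∼-sym (neg-involutive _))
    add-image onP onQ (+O P) = O₂ (∼-sym (neg-involutive _))
    add-image onP onQ (neg {x₁} {y₁} {x₂} {y₂} x≈ y≈) = O₃ (aff (*-congʳ (+-congʳ x≈))
      (lincomb 8 (λ x y z t a b h w → (a :* h :* w :^ 3) ∙ x := z ⇒
          (# 2 :* h :* w :^ 3) ∙ y :+ t :+ a :* z :+ b := # 0 ⇒
          (:- (y :* w :^ 3) :- t :* w :^ 3) ∙ # 2 :* h := one ⇒
          ⊢ (y :+ (a :* x :+ b) :* h) :* (w :* w :* w) := :- ((t :+ (a :* z
          :+ b) :* h) :* (w :* w :* w))) x₁ y₁ x₂ y₂ a₁ a₃ (fromℕ 3 * s) w x≈ y≈ 2·3s≈1))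
    add-image onP onQ (chord {x₁} {y₁} {x₂} {y₂} m x₁≉x₂ e) = image-third m onP (slope chord₀
      (cancelˡ (x≉y⇒x-y≉0 X₁≉X₂) (lincomb 5 (λ m d e f g → f ∙ m :* d := e ⇒ one ∙ e :* f := d :* g ⇒
          ⊢ d :* (m :* f) := d :* g) (slope₀ m) (X x₁ - X x₂) (Y x₁ y₁ - Y x₂ y₂) (Y x₁ y₁ + Y x₂ y₂)
          (X x₁ * X x₁ + X x₁ * X x₂ + X x₂ * X x₂ + A) chord₀ (cubics-difference onP onQ))))
      where
      chord₀ : slope₀ m * (X x₁ - X x₂) ≈ Y x₁ y₁ - Y x₂ y₂
      chord₀ = lincomb 10 (λ m w h x y z t a b ρ → (:- (w :^ 3)) ∙ m :* (z :- x) := t :- y ⇒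
          ⊢ (m :+ a :* h) :* w :* ((x :+ ρ) :* (w :* w) :- (z :+ ρ) :* (w :* w))
          := (y :+ (a :* x :+ b) :* h) :* (w :* w :* w) :- (t :+ (a :* z
          :+ b) :* h) :* (w :* w :* w)) m w (fromℕ 3 * s) x₁ y₁ x₂ y₂ a₁ a₃ ρ e
      X₁≉X₂ : X x₁ ≉ X x₂
      X₁≉X₂ p = x₁≉x₂ (lincomb 5 (λ x y ρ u w → (:- (x :* u :* w) :+ y :* u :* w :- x :+ y) ∙ u :* w := one ⇒
          (u :^ 2) ∙ (x :+ ρ) :* (w :* w) := (y :+ ρ) :* (w :* w) ⇒ ⊢ x := y) x₁ x₂ ρ u w uw≈1 p)
    add-image onP onQ (tangent {x₁} {y₁} {x₂} {y₂} m x≈ y≈ _ e) = image-third m onP (slope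
      (lincomb 10 (λ x y z t a b h w m ρ → (:- (a :* h :* w :^ 3) :+ w :^ 2 :* m) ∙ x := z ⇒
          (:- (w :^ 3)) ∙ y := t ⇒ ⊢ m :* ((x :+ ρ) :* (w :* w) :- (z :+ ρ) :* (w :* w))
          := (y :+ (a :* x :+ b) :* h) :* (w :* w :* w) :- (t :+ (a :* z
          :+ b) :* h) :* (w :* w :* w)) x₁ y₁ x₂ y₂ a₁ a₃ (fromℕ 3 * s) w (slope₀ m) ρ x≈ y≈)
      (lincomb 7 (λ p r m A w x y → (w :^ 4) ∙ m :* (# 2 :* r) := # 3 :* (p :* p) :+ A ⇒
          (# 2 :* p :* w :^ 2 :+ x) ∙ p :* (w :* w) := x ⇒ (:- (m :* w)) ∙ r :* (w :* w :* w) := y ⇒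
          ⊢ m :* w :* (r :* (w :* w :* w) :+ y) := p :* (w :* w) :* (p :* (w :* w)) :+ p :* (w :* w) :* x
          :+ x :* x :+ A :* (w :* w :* w :* w)) (x₁ + ρ) (y₁ + (a₁ * x₁ + a₃) * (fromℕ 3 * s)) (m + a₁ *
          (fromℕ 3 * s)) A₀ w (X x₂) (Y x₂ y₂)
        tangent₀ (*-congʳ (+-congʳ x≈)) (*-congʳ (+-cong y≈ (*-congʳ (+-congʳ (*-congˡ x≈)))))))
      where
      tangent₀ : (m + a₁ * (fromℕ 3 * s)) * (fromℕ 2 * (y₁ + (a₁ * x₁ + a₃) * (fromℕ 3 * s)))
          ≈ fromℕ 3 * ((x₁ + ρ) * (x₁ + ρ)) + A₀
      tangent₀ = cancelˡ (char0 47)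
        (lincomb 13 (λ m h p r A x y a₁ a₂ a₃ a₄ b₂ b₄ → (:- (# 12 :* p) :- # 12 :* x :- b₂) ∙ # 12 :* p
            := # 12 :* x :+ b₂ ⇒ (# 48 :* m :+ # 24 :* a₁) ∙ # 2 :* r := # 2 :* y :+ a₁ :* x :+ a₃ ⇒
            (:- one) ∙ # 48 :* A := :- (b₂ :* b₂ :- # 24 :* b₄) ⇒ (# 48 :* r :* a₁) ∙ # 2 :* h := one ⇒
            (:- (# 24 :* x)) ∙ b₂ := a₁ :* a₁ :+ # 4 :* a₂ ⇒ (:- (# 24)) ∙ b₄ := # 2 :* a₄ :+ a₁ :* a₃ ⇒
            (# 48) ∙ m :* (# 2 :* y :+ a₁ :* x :+ a₃) := # 3 :* (x :* x) :+ # 2 :* a₂ :* x :+ a₄ :- a₁ :* y ⇒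
            ⊢ # 48 :* ((m :+ a₁ :* h) :* (# 2 :* r)) := # 48 :* (# 3 :* (p :* p)
            :+ A)) m (fromℕ 3 * s) (x₁ + ρ) (y₁ + (a₁ * x₁ + a₃) * (fromℕ 3 * s)) A₀ x₁ y₁ a₁ a₂ a₃ a₄ b₂ b₄
          (12p≈ x₁) (2r≈ x₁ y₁) 48A₀≈-c₄ 2·3s≈1 refl refl e)

    on-cong : ∀ {P Q} → P ∼ Q → On P → On Q
    on-cong O∼O       _  = tt
    on-cong (aff {x} {y} {z} {t} p q) on =
        lincomb 6 (λ x y z t A B → (x :^ 2 :+ x :* z :+ z :^ 2 :+ A) ∙ x := z ⇒ (:- y :- t) ∙ y := t ⇒
        one ∙ y :* y := x :* x :* x :+ A :* x :+ B ⇒ ⊢ t :* t := z :* z :* z :+ A :* z :+ B) x y z t A B p q on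

    multiple-image : ∀ {P} (onP : On (φ P)) {n R} → Mul n P R → φ R ∼ proj₁ (n · (φ P , onP))
    multiple-image onP mul0 = O∼O
    multiple-image {P} onP (mulS {n} {_} {R} {S} nP≈R R+P≈S) = ∼-sym (sum-unique (φ P , onP) (n · (φ P , onP))
      (swap₁₂ (cong₁ R∼ (add-image {R} {P} {S} (on-cong (∼-sym R∼) (proj₂ (n · (φ P , onP)))) onP R+P≈S))))
      where R∼ = multiple-image onP nP≈R

    torsion-image : ∀ {x y} → IsTorsion (just (x , y)) → Σ (On (φ (just (x , y)))) λ on → Torsion (φ (just (x
        , y)) , on)
    torsion-image (on , n , nP≈O) = φ-on on , n , ∼-sym (multiple-image (φ-on on) nP≈O)

-- The modulus and the bound obtained from the j-invariant.

module EffectiveBound {c ℓ} (K : AlgClosureℚ c ℓ) where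
  open AlgClosureℚ K
  open Elliptic K
  open LinearCombinations commRing
  open FieldProperties K
  open Places K using (_⊑_; O⊆; M⊆; ⊑-refl; ⊑-trans; ask)
  open KernelOfReduction K
  open FourTorsionPoints K
  open Progressions K
  open ShortWeierstrassForm K

  -- Coefficients are listed from the constant term upwards and the list may end in zeros, so the
  -- last non-zero entry is sought.
  leading : List ℤ → ℤ
  leading []       = + 0
  leading (a ∷ as) with leading as ℤₚ.≟ + 0
  ... | yes _ = a
  ... | no  _ = leading as

  leading≡0⇒eval≈0 : ∀ as {x} → leading as ≡ + 0 → eval (map fromℤ as) x ≈ 0#
  leading≡0⇒eval≈0 []       _ = refl
  leading≡0⇒eval≈0 (a ∷ as) {x} e with leading as ℤₚ.≟ + 0
  ... | yes e′ = lincomb 3 (λ x a p → one ∙ a := # 0 ⇒ x ∙ p := # 0 ⇒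
      ⊢ a :+ x :* p := # 0) x (fromℤ a) (eval (map fromℤ as) x) (reflexive (≡.cong fromℤ e))
      (leading≡0⇒eval≈0 as e′)
  ... | no  ne = ⊥-elim (ne e)

  leading≢0 : ∀ {as} → Any (λ a → ¬ a ≡ + 0) as → ¬ leading as ≡ + 0
  leading≢0 {a ∷ as} p e with leading as ℤₚ.≟ + 0
  leading≢0 {a ∷ as} (here a≢0) e | yes _  = a≢0 e
  leading≢0 {a ∷ as} (there p)  _ | yes e  = leading≢0 p e
  leading≢0 {a ∷ as} _          e | no  ne = ne e

  O-fromℤ : ∀ (W : Place K) i → Place.O W (fromℤ i)
  O-fromℤ W (+ n)    = Place.O-fromℕ W n
  O-fromℤ W -[1+ n ] = Place.O-neg W (Place.O-fromℕ W (suc n))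

  M-abs : ∀ (W : Place K) i → Place.M W (fromℤ i) → Place.M W (fromℕ ℤ.∣ i ∣)
  M-abs W (+ n)    Mi = Mi
  M-abs W -[1+ n ] Mi = Place.M-resp W (lincomb 1 (λ a → ⊢ :- (:- a) := a) (fromℕ (suc n))) (Place.M-neg W Mi)

  -- z is y to the degree of the polynomial.
  reversed-eval : ∀ W {x y} → x * y ≈ 1# → Place.M W y → ∀ as → ¬ leading as ≡ + 0 →
    ∃ λ z → ∃ λ r → Place.O W z × Place.M W r × eval (map fromℤ as) x * z ≈ fromℤ (leading as) + r
  reversed-eval W xy≈1 My []       ne = ⊥-elim (ne ≡.refl)
  reversed-eval W {x} {y} xy≈1 My (a ∷ as) ne with leading as ℤₚ.≟ + 0
  ... | yes e  = 1# , 0# , O-1 , M-0 ,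
    (lincomb 3 (λ x a p → x ∙ p := # 0 ⇒ ⊢ (a :+ x :* p) :* one
        := a :+ # 0) x (fromℤ a) (eval (map fromℤ as) x) (leading≡0⇒eval≈0 as e))
    where open Place W
  ... | no  ne′ with z , r , Oz , Mr , e ← reversed-eval W xy≈1 My as ne′ =
    z * y , fromℤ a * z * y + r , O-* Oz (M⊆O My) , M-+ (M-* (O-* (O-fromℤ W a) Oz) My) Mr ,
    (lincomb 7 (λ x y z a p r l → (z :* p) ∙ x :* y := one ⇒ one ∙ p :* z := l :+ r ⇒
        ⊢ (a :+ x :* p) :* (z :* y) := l :+ (a :* z :* y :+ r)) x y z (fromℤ a) (eval (map fromℤ as) x) r
        (fromℤ (leading as)) xy≈1 e)
    where open Place W

  -- Divided by the top power of an infinite x, the equation leaves the leading coefficient plus an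
  -- element of M.
  leading∈M : ∀ W {x y} → x * y ≈ 1# → Place.M W y → ∀ as → ¬ leading as ≡ + 0 →
              eval (map fromℤ as) x ≈ 0# → Place.M W (fromℤ (leading as))
  leading∈M W {x} xy≈1 My as ne root with z , r , _ , Mr , e ← reversed-eval W xy≈1 My as ne =
    Place.M-resp W (lincomb 4 (λ z r l p → one ∙ p :* z := l :+ r ⇒ (:- z) ∙ p := # 0 ⇒
        ⊢ :- r := l) z r (fromℤ (leading as)) (eval (map fromℤ as) x) e root) (Place.M-neg W Mr)

  -- The place from which every enlargement starts: ℤ with the ideal generated by q, embedded in the
  -- field.
  integers : ∀ q → ¬ q ≡ 1 → Place K
  integers q q≢1 = record
    { O = λ x → Lift (c ⊔ ℓ) (∃ λ i → x ≈ fromℤ i)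
    ; M = λ x → Lift (c ⊔ ℓ) (∃ λ i → x ≈ fromℤ (+ q ℤ.* i))
    ; O-resp = λ { x≈y (lift (i , e)) → lift (i , trans (sym x≈y) e) }
    ; M-resp = λ { x≈y (lift (i , e)) → lift (i , trans (sym x≈y) e) }
    ; O-1 = lift (+ 1 , sym (+-identityʳ 1#))
    ; O-neg = λ { (lift (i , e)) → lift (ℤ.- i , trans (-‿cong e) (sym (fromℤ-neg i))) }
    ; O-+ = λ { (lift (i , e)) (lift (j , f)) → lift (i ℤ.+ j , trans (+-cong e f) (sym (fromℤ-+ i j))) }
    ; O-* = λ { (lift (i , e)) (lift (j , f)) → lift (i ℤ.* j , trans (*-cong e f) (sym (fromℤ-* i j))) }
    ; M-0 = lift (+ 0 , reflexive (≡.cong fromℤ (≡.sym (ℤₚ.*-zeroʳ (+ q)))))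
    ; M-+ = λ { (lift (i , e)) (lift (j , f)) → lift (i ℤ.+ j ,
        trans (+-cong e f) (trans (sym (fromℤ-+ (+ q ℤ.* i) (+ q ℤ.* j))) (reflexive (≡.cong fromℤ (≡.sym
            (ℤₚ.*-distribˡ-+ (+ q) i j)))))) }
    ; M-* = λ { (lift (i , e)) (lift (j , f)) → lift (i ℤ.* j ,
        trans (*-cong e f) (trans (sym (fromℤ-* i (+ q ℤ.* j))) (reflexive (≡.cong fromℤ (swap i j))))) }
    ; M⊆O = λ { (lift (i , e)) → lift (+ q ℤ.* i , e) }
    ; 1∉M = λ { (lift (i , e)) → q≢1 (ℕₚ.m*n≡1⇒m≡1 q ℤ.∣ i ∣ (≡.trans (≡.sym (ℤₚ.abs-* (+ q) i))
        (≡.cong ℤ.∣_∣ (≡.sym (fromℤ-injective {+ 1} {+ q ℤ.* i} (trans (+-identityʳ 1#) e)))))) }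
    }
    where
    swap : ∀ i j → i ℤ.* (+ q ℤ.* j) ≡ + q ℤ.* (i ℤ.* j)
    swap i j = ≡.trans (≡.sym (ℤₚ.*-assoc i (+ q) j)) (≡.trans (≡.cong (ℤ._* j) (ℤₚ.*-comm i (+ q)))
        (ℤₚ.*-assoc (+ q) i j))

  -- Congruent to 1 modulo 6 and modulo l, so that neither of these lies in M together with it.
  modulus : ℤ → ℕ
  modulus l = suc (6 ℕ.* ℤ.∣ l ∣)

  module _ {W : Place K} (l : ℤ) (Mq : Place.M W (fromℕ (modulus l))) where
    open Place W

    6∣q-1 : fromℕ (modulus l) ≈ 1# + fromℕ 6 * fromℕ ℤ.∣ l ∣
    6∣q-1 = +-congˡ (fromℕ-* 6 ℤ.∣ l ∣)

    6∉M : ¬ M (fromℕ 6)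
    6∉M M6 = 1∉M (M-resp (lincomb 3 (λ q l t → one ∙ q := one :+ t :* l ⇒
        ⊢ q :- l :* t := one) (fromℕ (modulus l)) (fromℕ ℤ.∣ l ∣) (fromℕ 6) 6∣q-1)
      (M-- Mq (M-* (O-fromℕ ℤ.∣ l ∣) M6)))

    l∉M : ¬ M (fromℤ l)
    l∉M Ml = 1∉M (M-resp (lincomb 3 (λ q l t → one ∙ q := one :+ t :* l ⇒
        ⊢ q :- t :* l := one) (fromℕ (modulus l)) (fromℕ ℤ.∣ l ∣) (fromℕ 6) 6∣q-1)
      (M-- Mq (M-* (O-fromℕ 6) (M-abs W l Ml))))

  root-integral : ∀ W {x z} → Place.O W z → x * x * x ≈ z → (∀ V → W ⊑ V → Place.O V x → ⊥) → ⊥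
  root-integral W {x} {z} Oz e k = ask W x k λ V W⊑V y xy≈1 My →
    Place.1∉M V (Place.M-resp V (lincomb 3 (λ x y z → (:- (y :^ 3)) ∙ x :* x :* x := z ⇒
        (x :^ 2 :* y :^ 2 :+ x :* y :+ one) ∙ x :* y := one ⇒ ⊢ z :* y :* y :* y := one) x y z e xy≈1)
      (Place.M-* V (Place.O-* V (Place.O-* V (O⊆ W⊑V Oz) (Place.M⊆O V My)) (Place.M⊆O V My)) My))

  square-root-integral : ∀ W {x z} → Place.O W z → x * x ≈ z → (∀ V → W ⊑ V → Place.O V x → ⊥) → ⊥
  square-root-integral W {x} {z} Oz e k = ask W x k λ V W⊑V y xy≈1 My →
    Place.1∉M V (Place.M-resp V (lincomb 3 (λ x y z → (:- (y :^ 2)) ∙ x :* x := z ⇒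
        (x :* y :+ one) ∙ x :* y := one ⇒ ⊢ z :* y :* y := one) x y z e xy≈1)
      (Place.M-* V (Place.O-* V (O⊆ W⊑V Oz) (Place.M⊆O V My)) My))

  module _ (j : Carrier) where
    annihilator : List ℤ
    annihilator = proj₁ (algebraic j)

    l : ℤ
    l = leading annihilator

    l≢0 : ¬ l ≡ + 0
    l≢0 = leading≢0 (proj₁ (proj₂ (algebraic j)))

    q : ℕ
    q = modulus l

    length-bound : ℕ
    length-bound = 2 ℕ.+ 6 ℕ.* q ℕ.^ 6

    q≢1 : ¬ q ≡ 1
    q≢1 q≡1 = l≢0 (ℤₚ.∣i∣≡0⇒i≡0 (ℕₚ.m+n≡0⇒m≡0 ℤ.∣ l ∣ (ℕₚ.suc-injective q≡1)))

    module _ (E : Weierstrass) (Δ≉0 : Curve.IsEllipticCurve E) (isJ : Curve.IsJInvariant E j) where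
      open Weierstrass E
      open Curve E

      s : Carrier
      s = proj₁ (inverse (fromℕ 6) (char0 5))

      6s≈1 : fromℕ 6 * s ≈ 1#
      6s≈1 = proj₂ (inverse (fromℕ 6) (char0 5))

      open Reduction E Δ≉0 s 6s≈1
      open GroupLaw.Short K A B disc≉0 using (OnCubic)
      open Core A B disc≉0 using (GoodPlace; Torsion)
      open Progression A B disc≉0 q using (no-long-progression; bound)

      -- From c₄³ = j Δ and Δ w¹² = 1; the right side is -j/48³.
      A³≈ : A * A * A ≈ - (fromℕ 27 * fromℕ 27 * fromℕ 27 * (s * s * s * s) * (s * s * s * s) * (s * s * s * s) * j)
      A³≈ = lincomb 5 (λ t r c d j → (# 19683 :* t :^ 3 :* r :^ 3) ∙ j :* d := c :* c :* c ⇒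
          (:- (# 19683 :* t :^ 3 :* j)) ∙ d :* (r :* r :* r) := one ⇒
          ⊢ :- (# 27 :* t :* c) :* r :* (:- (# 27 :* t :* c) :* r) :* (:- (# 27 :* t :* c) :* r)
          := :- (# 27 :* # 27 :* # 27 :* t :* t :* t :* j)) (s * s * s * s) (w * w * w * w) c₄ Δ j isJ Δw¹²≈1

      -- The equation -16 (4A³ + 27B²) = 1 solved for B², with 8 s³ = 1/27 and 81 s⁴ = 1/16.
      B²≈ : B * B ≈ fromℕ 8 * (s * s * s) * (- (fromℕ 81 * (s * s * s * s)) - fromℕ 4 * (A * A * A))
      B²≈ = cancelˡ (char0 431) (lincomb 4 (λ A B p r → (:- (# 216 :* p)) ∙ (# 4 :* (A :* A :* A)
          :+ # 27 :* (B :* B)) :* (:- # 16) := one ⇒ (:- (# 432 :* B :^ 2) :+ # 1296 :* r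
          :- one) ∙ # 216 :* p := one ⇒ one ∙ # 1296 :* r := one ⇒
          ⊢ # 432 :* (B :* B) := # 432 :* (# 8 :* p :* (:- (# 81 :* r) :- # 4 :* (A :* A :* A)))) A B
          (s * s * s) (s * s * s * s)
        disc*-16≈1 (lincomb 1 (λ s → (# 36 :* s :^ 2 :+ # 6 :* s :+ one) ∙ # 6 :* s := one ⇒
            ⊢ # 216 :* (s :* s :* s) := one) s 6s≈1)
            (lincomb 1 (λ s → (# 216 :* s :^ 3 :+ # 36 :* s :^ 2 :+ # 6 :* s :+ one) ∙ # 6 :* s := one ⇒
            ⊢ # 1296 :* (s :* s :* s :* s) := one) s 6s≈1))

      -- Starting from ℤ with q, the place is enlarged until it contains in turn 1/6 (as 6 is not in
      -- M), j (as l is not in M), A and B (as roots of monic integral equations).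
      good-place : (∀ W → GoodPlace q W → ⊥) → ⊥
      good-place k = s-integral λ V₁ Mq₁ Os₁ → ask V₁ j
        (λ V₂ V₁⊑V₂ Oj → let Os₂ = O⊆ V₁⊑V₂ Os₁ in
          root-integral V₂ (O-A³ V₂ Os₂ Oj) A³≈ λ V₃ V₂⊑V₃ OA → let Os₃ = O⊆ V₂⊑V₃ Os₂ in
          square-root-integral V₃ (O-B² V₃ Os₃ OA) B²≈ λ V₄ V₃⊑V₄ OB → let V₁⊑V₄ = ⊑-trans V₁⊑V₂ (⊑-trans V₂⊑V₃ V₃⊑V₄) in
          k V₄ (record
            { OA = O⊆ V₃⊑V₄ OA ; OB = OB ; O-disc⁻¹ = Place.O-neg V₄ (Place.O-fromℕ V₄ 16)
            ; O-½ = Place.O-* V₄ (Place.O-fromℕ V₄ 3) (O⊆ V₁⊑V₄ Os₁)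
            ; disc*disc⁻¹≈1 = disc*-16≈1 ; 2*½≈1 = 2·3s≈1 ; Mq = M⊆ V₁⊑V₄ Mq₁ }))
        (λ V₂ V₁⊑V₂ y jy≈1 My → l∉M {V₂} l (M⊆ V₁⊑V₂ Mq₁)
          (leading∈M V₂ jy≈1 My annihilator l≢0 (proj₂ (proj₂ (algebraic j)))))
        where
        W₀ : Place K
        W₀ = integers q q≢1
        Mq₀ : Place.M W₀ (fromℕ q)
        Mq₀ = lift (+ 1 , reflexive (≡.cong fromℤ (≡.sym (ℤₚ.*-identityʳ (+ q)))))
        s-integral : (∀ V → Place.M V (fromℕ q) → Place.O V s → ⊥) → ⊥
        s-integral k = ask W₀ s
          (λ V W₀⊑V Os → k V (M⊆ {W₀} W₀⊑V Mq₀) Os)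
          (λ V W₀⊑V y sy≈1 My → 6∉M {V} l (M⊆ {W₀} W₀⊑V Mq₀)
            (Place.M-resp V (lincomb 3 (λ s y t → (:- y) ∙ t :* s := one ⇒ t ∙ s :* y := one ⇒
                ⊢ y := t) s y (fromℕ 6) 6s≈1 sy≈1) My))
        O-A³ : ∀ V → Place.O V s → Place.O V j →
               Place.O V (- (fromℕ 27 * fromℕ 27 * fromℕ 27 * (s * s * s * s) * (s * s * s * s) *
                   (s * s * s * s) * j))
        O-A³ V Os Oj = O-neg (O-* (O-* (O-* (O-* (O-* (O-* (O-fromℕ 27) (O-fromℕ 27)) (O-fromℕ 27)) Os⁴) Os⁴) Os⁴) Oj)
          where
          open Place V
          Os⁴ = O-* (O-* (O-* Os Os) Os) Os
        O-B² : ∀ V → Place.O V s → Place.O V A →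
               Place.O V (fromℕ 8 * (s * s * s) * (- (fromℕ 81 * (s * s * s * s)) - fromℕ 4 * (A * A * A)))
        O-B² V Os OA = O-* (O-* (O-fromℕ 8) (O-* (O-* Os Os) Os))
          (O-- (O-neg (O-* (O-fromℕ 81) (O-* (O-* (O-* Os Os) Os) Os))) (O-* (O-fromℕ 4) (O-* (O-* OA OA) OA)))
          where open Place V

      -- Both coordinates of E are affine functions of the coordinates of the short model, so one
      -- statement serves for the two; the constant δ is absorbed into the start of the progression.
      linear-form-bounded : ∀ {p} {S : Carrier → Set p} α β δ →
        (∀ {v} → S v → ∃ λ x → ∃ λ y → IsTorsion (just (x , y)) × v ≈ α * X x + β * Y x y + δ) →
        ∀ n → ContainsAP S n → n ℕ.≤ bound
      linear-form-bounded {S = S} α β δ coordinates n (a , b , b≉0 , terms) = decidable-stable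
          (n ℕ.≤? bound) λ n≰bound →
        good-place λ W good → no-long-progression {W} good α β (a - δ) b b≉0 (term (ℕₚ.≰⇒> n≰bound))
        where
        term : bound ℕ.< n → ∀ k → 1 ℕ.≤ k → k ℕ.≤ bound → ∃ λ x → ∃ λ y → Σ (OnCubic x y) λ on →
               Torsion (just (x , y) , on) × α * x + β * y ≈ a - δ + fromℕ k * b
        -- Indices of terms start at 1 while positions in `Fin n` start at 0, so the term of index k
        -- + 1 is found at position k.
        term bound<n (suc k) _ k<bound = let k<n = ℕₚ.<-trans k<bound bound<n
                                             x , y , tors , e = coordinates (terms (fromℕ< k<n))
                                             on , tors′ = torsion-image tors
          in X x , Y x y , on , tors′ ,
             (lincomb 6 (λ p a b δ k m → (:- one) ∙ a :+ m :* b := p :+ δ ⇒ b ∙ m := k ⇒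
                 ⊢ p := a :- δ :+ k :* b) (α * X x + β * Y x y) a b δ (fromℕ (suc k)) (fromℕ (suc (toℕ
                 (fromℕ< k<n)))) e (reflexive (≡.cong (λ i → fromℕ (suc i)) (Finₚ.toℕ-fromℕ< k<n))))

      TorsionX-bounded : ∀ n → ContainsAP TorsionX n → n ℕ.≤ length-bound
      TorsionX-bounded = linear-form-bounded {S = TorsionX} (u * u) 0# (- ρ) λ { {x} (y , tors) → x , y , tors ,
        (lincomb 5 (λ x z ρ u w → (:- (x :* u :* w) :- ρ :* u :* w :- x :- ρ) ∙ u :* w := one ⇒
            ⊢ x := u :* u :* ((x :+ ρ) :* (w :* w)) :+ # 0 :* z :+ :- ρ) x (Y x y) ρ u w uw≈1) }

      TorsionY-bounded : ∀ n → ContainsAP TorsionY n → n ℕ.≤ length-bound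
      -- The coefficients come from y = u³ Y - (a₁ x + a₃)/2 with x = u² X - ρ and 3s for 1/2.
      TorsionY-bounded = linear-form-bounded {S = TorsionY} (- (fromℕ 3 * s * a₁ * (u * u))) (u * u * u)
          (fromℕ 3 * s * a₁ * ρ - fromℕ 3 * s * a₃)
        λ { {y} (x , tors) → x , y , tors ,
          (lincomb 8 (λ x y ρ u w h a b → (:- (x :* u :^ 2 :* w :^ 2 :* h :* a) :- u :^ 2 :* w :^ 2 :* h :* b
              :- y :* u :^ 2 :* w :^ 2 :+ ρ :* u :* w :* h :* a :- u :* w :* h :* b :- y :* u :* w
              :+ ρ :* h :* a :- h :* b :- y) ∙ u :* w := one ⇒
              ⊢ y := :- (h :* a :* (u :* u)) :* ((x :+ ρ) :* (w :* w)) :+ u :* u :* u :* ((y :+ (a :* x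
              :+ b) :* h) :* (w :* w :* w)) :+ (h :* a :* ρ :- h :* b)) x y ρ u w (fromℕ 3 * s) a₁ a₃ uw≈1) }

theorem1p2 : ∀ {c ℓ} (K : AlgClosureℚ c ℓ) →
    let open AlgClosureℚ K
        open Elliptic K
    in ∃ λ (B : Carrier → ℕ) →
         ∀ (E : Weierstrass) (j : Carrier) →
         Curve.IsEllipticCurve E → Curve.IsJInvariant E j →
         (∀ n → ContainsAP (Curve.TorsionX E) n → n ≤ B j) ×
         (∀ n → ContainsAP (Curve.TorsionY E) n → n ≤ B j)
theorem1p2 K = length-bound , λ E j Δ≉0 isJ → TorsionX-bounded j E Δ≉0 isJ , TorsionY-bounded j E Δ≉0 isJ
  where open EffectiveBound K
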